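{- Let $k\ge 1$ and $n\ge (2k)^{2k^2}$ be integers. Then \[ f_{2k}(n,P_{2k})\le (2k-1)\,{\rm ex}(n,P_{2k})+(k-1)\binom{2k-1}{2}. \] Furthermore, equality holds when $2k-1$ is a prime and $n\in\{a(2k-1)+(k-1),\ a(2k-1)+k\}$ for some integer $a$.
   Context: $P_m$ denotes the path on $m$ vertices. For a graph $H$ and a coloring of the edges of $K_n$ with $k$ colors, an edge is NIM-$H$ if it is not contained in any monochromatic copy of $H$; $f_k(n,H)$ is the maximum, over all $k$-colorings of the edges of $K_n$, of the number of NIM-$H$ edges. ${\rm ex}(n,H)$ is the Turán number of $H$ (maximum number of edges of an $n$-vertex graph with no copy of $H$). -}

module Defs where

open import Data.Nat using (ℕ; zero; suc; _+_; _*_; _∸_; _^_; _≤_; _<_; _<ᵇ_)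
open import Data.Nat.Combinatorics using (_C_)
open import Data.Bool using (Bool; true; false; _∧_)
open import Data.Fin using (Fin; toℕ)
open import Data.List using (List; length; filterᵇ; cartesianProduct; allFin)
open import Data.List.Relation.Unary.All using (All)
open import Data.List.Relation.Unary.Unique.Propositional using (Unique)
open import Data.Product using (Σ; ∃; _×_; _,_; proj₁; proj₂)
open import Data.Sum using (_⊎_)
open import Function.Definitions using (Injective)
open import Relation.Binary.PropositionalEquality using (_≡_)
open import Relation.Nullary using (¬_)

-- Simple graphs on vertex set Fin n (symmetric Bool adjacency; loops are
-- irrelevant since only pairs u < v are counted and paths are injective).

record Graph (n : ℕ) : Set where
  field
    adj : Fin n → Fin n → Bool
    sym : ∀ u v → adj u v ≡ adj v u
open Graph public

edgeCount : ∀ {n} → Graph n → ℕ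
edgeCount {n} G =
  length (filterᵇ (λ p → (toℕ (proj₁ p) <ᵇ toℕ (proj₂ p)) ∧ adj G (proj₁ p) (proj₂ p))
                  (cartesianProduct (allFin n) (allFin n)))

IsPathMap : ∀ {n} (m : ℕ) → (Fin n → Fin n → Set) → (Fin m → Fin n) → Set
IsPathMap {n} m E f =
  Injective _≡_ _≡_ f × (∀ (i j : Fin m) → toℕ j ≡ suc (toℕ i) → E (f i) (f j))

ContainsPath : ∀ {n} → ℕ → Graph n → Set
ContainsPath {n} m G = Σ (Fin m → Fin n) λ f → IsPathMap m (λ u v → adj G u v ≡ true) f

IsExPath : ℕ → ℕ → ℕ → Set
IsExPath n m e =
  (Σ (Graph n) λ G → ¬ ContainsPath m G × edgeCount G ≡ e)
  × (∀ (G : Graph n) → ¬ ContainsPath m G → edgeCount G ≤ e)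

-- r-edge-colourings of K_n (values on the diagonal are irrelevant)

record Colouring (r n : ℕ) : Set where
  field
    col : Fin n → Fin n → Fin r
    col-sym : ∀ u v → col u v ≡ col v u
open Colouring public

InMonoPath : ∀ {r n} → Colouring r n → ℕ → Fin n → Fin n → Set
InMonoPath {r} {n} c m u v =
  Σ (Fin r) λ κ → Σ (Fin m → Fin n) λ f →
    IsPathMap m (λ x y → col c x y ≡ κ) f
    × Σ (Fin m) λ i → Σ (Fin m) λ j → toℕ j ≡ suc (toℕ i)
        × ((f i ≡ u × f j ≡ v) ⊎ (f i ≡ v × f j ≡ u))

NIM : ∀ {r n} → Colouring r n → ℕ → Fin n → Fin n → Set
NIM c m u v = ¬ InMonoPath c m u v

NIMList : ∀ {r n} → Colouring r n → ℕ → List (Fin n × Fin n) → Set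
NIMList c m es =
  Unique es × All (λ p → (toℕ (proj₁ p) < toℕ (proj₂ p)) × NIM c m (proj₁ p) (proj₂ p)) es

NIMCount≤ : ∀ {r n} → Colouring r n → ℕ → ℕ → Set
NIMCount≤ c m b = ∀ es → NIMList c m es → length es ≤ b

NIMCount≥ : ∀ {r n} → Colouring r n → ℕ → ℕ → Set
NIMCount≥ c m b = Σ _ λ es → NIMList c m es × length es ≡ b

{-# OPTIONS --safe #-}
module Submission where

-- Write k = j + 1, p = 2k − 1 and D = j(j+1)/2.  The join of K_j with an independent set is free of
-- paths on 2k vertices and has j n − D edges; a rotation argument shows that this is extremal when
-- n ≡ j, j + 1 (mod p), and that a path-free graph with a vertex of large degree cannot do better.
--
-- Upper bound.  Let Y_i be the set of vertices covered by NIM-edges of colour i.  A path of colour i on 2k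
-- vertices starting at y ∈ Y_i could be modified to contain the NIM-edge at y, so colour i has no such path inside
-- Y_i, and it contributes at most j |Y_i| edges.  Let X be the set of vertices lying in all Y_i, so that
-- Σ |Y_i| ≤ p n + |X|.  By pigeonhole many vertices W see every vertex of X in a single colour.  Some colour κ has
-- a path on 2k vertices inside W, so no vertex of X sees W in colour κ, and at most j see it in any other colour i.
-- Where at least one does, it has large degree in colour i inside Y_i, which improves the bound there by D.
--
-- Lower bound.  Take the affine plane over ℤ/p, colour the lines of p directions by p colours, and the lines X = x
-- with 1 ≤ x ≤ j by the last colour.  In every direction the j points of the line through the origin with
-- 1 ≤ X ≤ j are joined to all vertices outside the plane, and the last colour takes all remaining edges.

open import Defs hiding (sym)
open import Data.Nat as ℕ using (ℕ; zero; suc; NonZero; _<_; _≤_)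
import Data.Nat.Properties as ℕ
open import Data.Nat.Combinatorics using (_C_; nC1≡n; nCk+nC[k+1]≡[n+1]C[k+1])
open import Data.Nat.Coprimality using (Coprime; coprime-Bézout)
import Data.Nat.Divisibility as ℕ
import Data.Nat.DivMod as ℕ
open import Data.Nat.GCD using (module Bézout)
open import Data.Nat.ListAction using (sum)
open import Data.Nat.Primality using (Prime; euclidsLemma; prime⇒irreducible)
open import Data.Nat.Tactic.RingSolver using (solve-∀)
open import Data.Bool using (Bool; true; _∧_; _∨_)
open import Data.Bool.Properties using (T?; T-∧; T-∨; T-≡; ∨-comm)
open import Data.Empty using (⊥; ⊥-elim)
open import Data.Fin as Fin using (Fin; zero; suc; toℕ; _≟_)
open import Data.Fin.Properties as Fin using (toℕ-injective; toℕ<n; toℕ-fromℕ<; toℕ-inject≤; inject≤-injective; combine-remQuot; remQuot-combine)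
open import Data.List using (List; []; _∷_; _++_; _ʳ++_; length; filter; map; [_]; lookup; tabulate; allFin; upTo; take; reverse; cartesianProduct)
open import Data.List.Properties using (length-++; length-map; length-tabulate; length-upTo; length-take; length-filter; filter-accept; filter-reject; filter-++; filter-all; filter-none; filter-notAll; map-tabulate; ++-identityʳ; take++drop≡id; ʳ++-defn)
open import Data.List.Membership.Propositional using (_∈_; _∉_; find; lose)
open import Data.List.Membership.Propositional.Properties using (∈-∃++; ∈-filter⁺; ∈-filter⁻; ∈-++⁺ˡ; ∈-++⁺ʳ; ∈-++⁻; ∈-map⁺; ∈-map⁻; ∈-allFin; ∈-lookup; ∈-tabulate⁺; ∈-tabulate⁻; ∈-upTo⁺; ∈-cartesianProduct⁺)
open import Data.List.Relation.Binary.Permutation.Propositional as Perm using (_↭_; prep; swap; ↭-refl; ↭-sym; ↭-trans; ↭-reflexive; ↭⇒↭ₛ)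
open import Data.List.Relation.Binary.Permutation.Propositional.Properties using (∈-resp-↭; ↭-length; filter-↭; ++↭ʳ++; shift; ++-comm)
import Data.List.Relation.Binary.Permutation.Setoid.Properties as PermSetoid
open import Data.List.Relation.Unary.All as All using (All; []; _∷_)
import Data.List.Relation.Unary.All.Properties as Allₚ
open import Data.List.Relation.Unary.AllPairs as AllPairs using (AllPairs; []; _∷_)
import Data.List.Relation.Unary.AllPairs.Properties as AllPairsₚ
open import Data.List.Relation.Unary.Any using (Any; here; there; any?)
open import Data.List.Relation.Unary.Linked as Linked using (Linked; []; [-]; _∷_)
open import Data.List.Relation.Unary.Unique.Propositional using (Unique)
import Data.List.Relation.Unary.Unique.Propositional.Properties as Unique
open import Data.Product using (Σ; ∃; _×_; _,_; proj₁; proj₂)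
open import Data.Sum using (_⊎_; inj₁; inj₂; [_,_]′)
open import Function using (_∘_; id; case_of_; Equivalence)
open import Relation.Binary.Definitions using (DecidableEquality)
open import Relation.Binary.PropositionalEquality as ≡ using (_≡_; _≢_; refl; sym; trans; cong; cong₂; subst; setoid; module ≡-Reasoning)
open import Relation.Nullary using (¬_; Dec; yes; no; ¬?; _×-dec_; _⊎-dec_; contradiction)
open import Relation.Nullary.Decidable using (decidable-stable; map′)
open import Relation.Unary using (Decidable)

-- Lines over ℤ/p

-- The summand (k - 1) C(p, 2) equals p j²: the estimate j Σ |Y_i| ≤ j (p n + |X|) with |X| ≤ p j
-- already gives p j n + p j². As ex(n) ≥ j n - D, this may overshoot the goal by p D, so D must be
-- saved p times. There are two sources. A vertex in fewer than p of the Y_i makes the estimate of Σ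
-- |Y_i| too large by at least 1, so p D / j such vertices suffice. If there are fewer, most of W
-- lies in every Y_i but one, and a further pigeonhole makes the exceptional colour constant on a
-- large part of W. This is what puts the neighbours of a vertex of X inside Y_i, so that its large
-- degree counts there. The exceptional colour has to be κ, because Y_i contains no long path of
-- colour i. A colour i other than κ that no vertex of X uses towards W leaves its share j² ≥ D of p
-- j² unspent. The size of n pays for pigeonholing p j + 1 vertices at a factor 2k each, and four
-- more factors for the later selections: p j + 5 ≤ 2k² once k ≥ 2.

module Modular (p : ℕ) .{{_ : NonZero p}} where

  open import Data.Integer as ℤ using (ℤ; +_; -[1+_]; ∣_∣; _+_; _*_; _-_; -_)
  import Data.Integer.Properties as ℤ
  import Data.Integer.DivMod as ℤ
  open import Data.Integer.Tactic.RingSolver renaming (solve-∀ to solveℤ-∀)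

  infix 4 _≈_
  -- Congruence modulo p. The quotient is kept as data, so that each rule below becomes a ring
  -- identity.
  record _≈_ (a b : ℤ) : Set where
    constructor by
    field
      quotient : ℤ
      equality : a ≡ b + quotient * + p

  ≈-sym : ∀ {a b} → a ≈ b → b ≈ a
  ≈-sym {a} {b} (by t eq) = by (- t) (trans (lemma b t (+ p)) (cong (λ z → z + (- t) * + p) (sym eq)))
    where lemma : ∀ b t p → b ≡ b + t * p + (- t) * p
          lemma = solveℤ-∀

  ≈-trans : ∀ {a b d} → a ≈ b → b ≈ d → a ≈ d
  ≈-trans {d = d} (by t refl) (by s refl) = by (s + t) (lemma d s t (+ p))
    where lemma : ∀ d s t p → d + s * p + t * p ≡ d + (s + t) * p
          lemma = solveℤ-∀

  mod-≈ : ∀ a → + toℕ (a ℕ.mod p) ≈ + a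
  mod-≈ a = by (- + (a ℕ./ p)) (begin
      + toℕ (a ℕ.mod p) ≡⟨ cong +_ (toℕ-fromℕ< (ℕ.m%n<n a p)) ⟩
      + (a ℕ.% p) ≡⟨ lemma (+ (a ℕ.% p)) (+ (a ℕ./ p)) (+ p) ⟩
      + (a ℕ.% p) + + (a ℕ./ p) * + p + (- + (a ℕ./ p)) * + p ≡⟨ cong (λ z → z + (- + (a ℕ./ p)) * + p) (sym (begin
        + a ≡⟨ cong +_ (ℕ.m≡m%n+[m/n]*n a p) ⟩
        + (a ℕ.% p ℕ.+ a ℕ./ p ℕ.* p) ≡⟨ cong (λ z → + (a ℕ.% p) + z) (ℤ.pos-* (a ℕ./ p) p) ⟩
        + (a ℕ.% p) + + (a ℕ./ p) * + p ∎)) ⟩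
      + a + (- + (a ℕ./ p)) * + p ∎)
    where open ≡-Reasoning
          lemma : ∀ r d p → r ≡ r + d * p + (- d) * p
          lemma = solveℤ-∀

  -- A nonzero quotient would push one of the two representatives to at least p.
  Fin-≈ : ∀ {x y : Fin p} → + toℕ x ≈ + toℕ y → x ≡ y
  Fin-≈ {x} {y} (by (+ zero) eq) = toℕ-injective (ℤ.+-injective (trans eq (ℤ.+-identityʳ (+ toℕ y))))
  Fin-≈ {x} {y} (by (+ suc t) eq) = contradiction (toℕ<n x) (ℕ.≤⇒≯ (ℕ.≤-trans (ℕ.≤-trans (ℕ.m≤m+n p (t ℕ.* p)) (ℕ.m≤n+m _ (toℕ y)))
    (ℕ.≤-reflexive (sym (ℤ.+-injective (trans eq (cong (λ z → + toℕ y + z) (sym (ℤ.pos-* (suc t) p)))))))))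
  Fin-≈ {x} {y} (by -[1+ t ] eq) = contradiction (toℕ<n y) (ℕ.≤⇒≯ (ℕ.≤-trans (ℕ.≤-trans (ℕ.m≤m+n p (t ℕ.* p)) (ℕ.m≤n+m _ (toℕ x)))
    (ℕ.≤-reflexive (sym (ℤ.+-injective (trans eq′ (cong (λ z → + toℕ x + z) (sym (ℤ.pos-* (suc t) p)))))))))
    where eq′ : + toℕ y ≡ + toℕ x + + suc t * + p
          eq′ = _≈_.equality (≈-sym {+ toℕ x} {+ toℕ y} (by -[1+ t ] eq))

  ∣∣-cases : ∀ a → a ≡ + ∣ a ∣ ⊎ a ≡ - + ∣ a ∣
  ∣∣-cases (+ n) = inj₁ refl
  ∣∣-cases -[1+ n ] = inj₂ refl

  ∣⇒≈0 : ∀ {a} → p ℕ.∣ ∣ a ∣ → a ≈ + 0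
  ∣⇒≈0 {a} (ℕ.divides s eq) with ∣∣-cases a
  ... | inj₁ a≡ = by (+ s) (trans a≡ (trans (cong +_ eq) (trans (ℤ.pos-* s p) (sym (ℤ.+-identityˡ _)))))
  ... | inj₂ a≡ = by (- + s) (trans a≡ (trans (cong (λ z → - + z) eq) (trans (cong -_ (ℤ.pos-* s p)) (lemma (+ s) (+ p)))))
    where lemma : ∀ s p → - (s * p) ≡ + 0 + (- s) * p
          lemma = solveℤ-∀

  ≈0⇒∣ : ∀ {a} → a ≈ + 0 → p ℕ.∣ ∣ a ∣
  ≈0⇒∣ (by t refl) = ℕ.divides ∣ t ∣ (trans (cong ∣_∣ (ℤ.+-identityˡ (t * + p))) (ℤ.abs-* t (+ p)))

  module _ (prime : Prime p) where

    integral : ∀ a b → a * b ≈ + 0 → a ≈ + 0 ⊎ b ≈ + 0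
    integral a b ab with euclidsLemma ∣ a ∣ ∣ b ∣ prime (subst (p ℕ.∣_) (ℤ.abs-* a b) (≈0⇒∣ ab))
    ... | inj₁ d = inj₁ (∣⇒≈0 d)
    ... | inj₂ d = inj₂ (∣⇒≈0 d)

    coprime : ∀ {x} → ¬ p ℕ.∣ x → Coprime x p
    coprime ¬p∣x (d∣x , d∣p) with prime⇒irreducible prime d∣p
    ... | inj₁ d≡1 = d≡1
    ... | inj₂ refl = contradiction d∣x ¬p∣x

    unit-ℕ : ∀ {x} → ¬ p ℕ.∣ x → ∃ λ w → w * + x ≈ + 1
    unit-ℕ {x} ¬p∣x with coprime-Bézout (coprime ¬p∣x)
    ... | Bézout.+- s t eq = + s , by (+ t) (trans (sym (ℤ.pos-* s x)) (trans (cong +_ (sym eq)) (cong (λ z → + 1 + z) (ℤ.pos-* t p))))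
    ... | Bézout.-+ s t eq = - + s , by (- + t) (trans (lemma₁ (+ s) (+ x)) (trans (cong (λ z → + 1 - z) (begin
        + 1 + + s * + x ≡⟨ cong (λ z → + 1 + z) (ℤ.pos-* s x) ⟨
        + (1 ℕ.+ s ℕ.* x) ≡⟨ cong +_ eq ⟩
        + (t ℕ.* p) ≡⟨ ℤ.pos-* t p ⟩
        + t * + p ∎)) (lemma₂ (+ t) (+ p))))
      where open ≡-Reasoning
            lemma₁ : ∀ s x → (- s) * x ≡ + 1 - (+ 1 + s * x)
            lemma₁ = solveℤ-∀
            lemma₂ : ∀ t p → + 1 - t * p ≡ + 1 + (- t) * p
            lemma₂ = solveℤ-∀

    unit : ∀ {a} → ¬ a ≈ + 0 → ∃ λ w → w * a ≈ + 1
    unit {a} a≉0 with unit-ℕ (λ d → a≉0 (∣⇒≈0 d)) | ∣∣-cases a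
    ... | w , by t eq | inj₁ a≡ = w , by t (trans (cong (w *_) a≡) eq)
    ... | w , by t eq | inj₂ a≡ = - w , by t (trans (cong ((- w) *_) a≡) (trans (lemma w (+ ∣ a ∣)) eq))
      where lemma : ∀ w x → (- w) * (- x) ≡ w * x
            lemma = solveℤ-∀

  ≈-cancel : ∀ x y a → x + a ≈ y + a → x ≈ y
  ≈-cancel x y a (by t eq) = by t (trans (lemma₁ x a) (trans (cong (_- a) eq) (lemma₂ y a (t * + p))))
    where lemma₁ : ∀ x a → x ≡ x + a - a
          lemma₁ = solveℤ-∀
          lemma₂ : ∀ y a s → y + a + s - a ≡ y + s
          lemma₂ = solveℤ-∀

  ≈-difference : ∀ x y → x - y ≈ + 0 → x ≈ y
  ≈-difference x y (by t eq) = by t (trans (lemma₁ x y) (trans (cong (λ z → z + y) eq) (lemma₂ (t * + p) y)))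
    where lemma₁ : ∀ x y → x ≡ x - y + y
          lemma₁ = solveℤ-∀
          lemma₂ : ∀ s y → + 0 + s + y ≡ y + s
          lemma₂ = solveℤ-∀

  ≈-reflexive : ∀ {a b} → a ≡ b → a ≈ b
  ≈-reflexive {b = b} eq = by (+ 0) (trans eq (sym (ℤ.+-identityʳ b)))

  ≈-+ : ∀ {a b a′ b′} → a ≈ b → a′ ≈ b′ → a + a′ ≈ b + b′
  ≈-+ {b = b} {b′ = b′} (by t refl) (by s refl) = by (t + s) (lemma b b′ t s (+ p))
    where lemma : ∀ b b′ t s p → b + t * p + (b′ + s * p) ≡ b + b′ + (t + s) * p
          lemma = solveℤ-∀

  ≈-*ʳ : ∀ {a b} c → a ≈ b → a * c ≈ b * c
  ≈-*ʳ {b = b} c (by t refl) = by (t * c) (lemma b c t (+ p))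
    where lemma : ∀ b c t p → (b + t * p) * c ≡ b * c + t * c * p
          lemma = solveℤ-∀

  ≈-neg : ∀ {a b} → a ≈ b → - a ≈ - b
  ≈-neg {b = b} (by t refl) = by (- t) (lemma b t (+ p))
    where lemma : ∀ b t p → - (b + t * p) ≡ - b + (- t) * p
          lemma = solveℤ-∀

  ≈-eliminate : ∀ y b c x i → y ≈ b + c * x → c + i ≡ + p → y + i * x ≈ b
  ≈-eliminate y b c x i e c+i = ≈-trans (≈-+ e (≈-reflexive {i * x} refl)) (by x (trans (lemma b c x i) (trans (cong (λ z → b + z * x) c+i)
      (cong (λ z → b + z) (ℤ.*-comm (+ p) x)))))
    where lemma : ∀ b c x i → b + c * x + i * x ≡ b + (c + i) * x
          lemma = solveℤ-∀

  -- Subtracting the two equations removes y and y′. Modulo a prime, this forces i = k once x and x′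
  -- differ.
  ≈-slopes : ∀ y y′ x x′ i k → y + i * x ≈ y′ + i * x′ → y + k * x ≈ y′ + k * x′ → (i - k) * (x - x′) ≈ + 0
  ≈-slopes y y′ x x′ i k e₁ e₂ = ≈-trans (≈-reflexive (lemma₁ (i - k) x x′))
      (≈-trans (≈-+ (≈-trans (≈-reflexive (sym (lemma₂ y i k x))) (≈-trans (≈-+ e₁ (≈-neg e₂)) (≈-reflexive (lemma₂ y′ i k x′))))
        (≈-reflexive refl)) (≈-reflexive (ℤ.+-inverseʳ ((i - k) * x′))))
    where lemma₁ : ∀ d x x′ → d * (x - x′) ≡ d * x - d * x′
          lemma₁ = solveℤ-∀
          lemma₂ : ∀ y i k x → y + i * x - (y + k * x) ≡ (i - k) * x
          lemma₂ = solveℤ-∀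

  -- The direction joining two points is (y′ - y) / (x - x′), with w as the inverse of the
  -- denominator.
  ≈-meet : ∀ y y′ x x′ i w → w * (x - x′) ≈ + 1 → i ≈ w * (y′ - y) → y + i * x ≈ y′ + i * x′
  ≈-meet y y′ x x′ i w e₁ e₂ = ≈-trans (≈-reflexive (lemma₁ y i x x′)) (≈-trans (≈-+ (≈-+ (≈-reflexive {y} refl)
      (≈-trans (≈-*ʳ (x - x′) e₂) (≈-trans (≈-reflexive (lemma₂ w (y′ - y) (x - x′))) (≈-*ʳ (y′ - y) e₁)))) (≈-reflexive {i * x′} refl))
      (≈-reflexive (cong (λ z → z + i * x′) (lemma₃ y y′))))
    where lemma₁ : ∀ y i x x′ → y + i * x ≡ y + i * (x - x′) + i * x′
          lemma₁ = solveℤ-∀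
          lemma₂ : ∀ w e d → w * e * d ≡ w * d * e
          lemma₂ = solveℤ-∀
          lemma₃ : ∀ y y′ → y + + 1 * (y′ - y) ≡ y′
          lemma₃ = solveℤ-∀

  residue : ∀ a → ∃ λ (i : Fin p) → + toℕ i ≈ a
  residue a = Fin.fromℕ< {a ℤ.%ℕ p} (ℤ.n%ℕd<d a p) , ≈-sym (by (a ℤ./ℕ p)
    (trans (ℤ.a≡a%ℕn+[a/ℕn]*n a p) (cong (λ r → + r + a ℤ./ℕ p * + p) (sym (toℕ-fromℕ< (ℤ.n%ℕd<d a p))))))

  opaque

    -- (X , Y) lies on the line Y + i X = b of direction i.
    line : Fin p → Fin p → Fin p → Fin p
    line i X Y = (toℕ Y ℕ.+ toℕ i ℕ.* toℕ X) ℕ.mod p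

    line-≈ : ∀ i X Y → + toℕ (line i X Y) ≈ + toℕ Y + + toℕ i * + toℕ X
    line-≈ i X Y = subst (λ z → + toℕ (line i X Y) ≈ + toℕ Y + z) (ℤ.pos-* (toℕ i) (toℕ X)) (mod-≈ (toℕ Y ℕ.+ toℕ i ℕ.* toℕ X))

    -- The solution Y of Y + i X = b, with p - i standing for -i so that the formula stays in ℕ.
    ordinate : Fin p → Fin p → Fin p → Fin p
    ordinate i b X = (toℕ b ℕ.+ (p ℕ.∸ toℕ i) ℕ.* toℕ X) ℕ.mod p

    ordinate-≈ : ∀ i b X → + toℕ (ordinate i b X) ≈ + toℕ b + + (p ℕ.∸ toℕ i) * + toℕ X
    ordinate-≈ i b X = subst (λ z → + toℕ (ordinate i b X) ≈ + toℕ b + z) (ℤ.pos-* (p ℕ.∸ toℕ i) (toℕ X))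
      (mod-≈ (toℕ b ℕ.+ (p ℕ.∸ toℕ i) ℕ.* toℕ X))

  line-≡⇒≈ : ∀ i {X X′ Y Y′} → line i X Y ≡ line i X′ Y′ → + toℕ Y + + toℕ i * + toℕ X ≈ + toℕ Y′ + + toℕ i * + toℕ X′
  line-≡⇒≈ i {X} {X′} {Y} {Y′} eq = ≈-trans (≈-sym (line-≈ i X Y))
    (subst (λ z → + toℕ z ≈ + toℕ Y′ + + toℕ i * + toℕ X′) (sym eq) (line-≈ i X′ Y′))

  line-injective : ∀ i X {Y Y′} → line i X Y ≡ line i X Y′ → Y ≡ Y′
  line-injective i X {Y} {Y′} eq = Fin-≈ (≈-cancel (+ toℕ Y) (+ toℕ Y′) (+ toℕ i * + toℕ X) (line-≡⇒≈ i eq))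

  line-axis : ∀ i {x} y → toℕ x ≡ 0 → line i x y ≡ y
  line-axis i {x} y x≡0 = Fin-≈ (≈-trans (line-≈ i x y) (≈-reflexive
    (trans (cong (λ z → + toℕ y + + toℕ i * + z) x≡0) (trans (cong (λ z → + toℕ y + z) (ℤ.*-zeroʳ (+ toℕ i))) (ℤ.+-identityʳ (+ toℕ y))))))

  line-ordinate : ∀ i b X → line i X (ordinate i b X) ≡ b
  line-ordinate i b X = Fin-≈ (≈-trans (line-≈ i X (ordinate i b X))
    (≈-eliminate (+ toℕ (ordinate i b X)) (+ toℕ b) (+ (p ℕ.∸ toℕ i)) (+ toℕ X) (+ toℕ i)
      (ordinate-≈ i b X) (cong +_ (ℕ.m∸n+n≡m (ℕ.<⇒≤ (toℕ<n i))))))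

  module _ (prime : Prime p) where

    difference≉0 : ∀ {X X′ : Fin p} → X ≢ X′ → ¬ (+ toℕ X - + toℕ X′ ≈ + 0)
    difference≉0 {X} {X′} ne d = ne (Fin-≈ (≈-difference (+ toℕ X) (+ toℕ X′) d))

    line-unique : ∀ {X X′ Y Y′} → X ≢ X′ → ∀ {i k} → line i X Y ≡ line i X′ Y′ → line k X Y ≡ line k X′ Y′ → i ≡ k
    line-unique {X} {X′} {Y} {Y′} ne {i} {k} eqi eqk = [ (λ i≈k → Fin-≈ (≈-difference (+ toℕ i) (+ toℕ k) i≈k))
        , (λ X≈ → contradiction X≈ (difference≉0 ne)) ]′
      (integral prime (+ toℕ i - + toℕ k) (+ toℕ X - + toℕ X′)
        (≈-slopes (+ toℕ Y) (+ toℕ Y′) (+ toℕ X) (+ toℕ X′) (+ toℕ i) (+ toℕ k) (line-≡⇒≈ i eqi) (line-≡⇒≈ k eqk)))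

    line-exists : ∀ {X X′} Y Y′ → X ≢ X′ → ∃ λ i → line i X Y ≡ line i X′ Y′
    line-exists {X} {X′} Y Y′ ne = meet (unit prime (difference≉0 ne))
      where
      meet : (∃ λ w → w * (+ toℕ X - + toℕ X′) ≈ + 1) → ∃ λ i → line i X Y ≡ line i X′ Y′
      meet (w , inverse) = let i , i≈ = residue (w * (+ toℕ Y′ - + toℕ Y)) in
        i , Fin-≈ (≈-trans (line-≈ i X Y) (≈-trans
          (≈-meet (+ toℕ Y) (+ toℕ Y′) (+ toℕ X) (+ toℕ X′) (+ toℕ i) w inverse i≈) (≈-sym (line-≈ i X′ Y′))))

open import Data.Nat hiding (_≟_)
open import Data.Nat.Properties hiding (_≟_)

-- Lists and paths

cancel-≤ : ∀ c {a b a′ b′} → c + a ≡ a′ → c + b ≡ b′ → a′ ≤ b′ → a ≤ b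
cancel-≤ c {a} {b} refl refl = +-cancelˡ-≤ c a b

module _ {A : Set} where

  Unique-resp : {xs ys : List A} → xs ↭ ys → Unique xs → Unique ys
  Unique-resp p = PermSetoid.Unique-resp-↭ (setoid A) (↭⇒↭ₛ p)

  uncons-∈ : ∀ {v : A} {S} → v ∈ S → ∃ λ S′ → S ↭ v ∷ S′
  uncons-∈ {v} v∈S with ∈-∃++ v∈S
  ... | ys , zs , refl = ys ++ zs , shift v ys zs

  ∈-uncons : ∀ {v w : A} {S S′} → S ↭ v ∷ S′ → w ∈ S → w ≢ v → w ∈ S′
  ∈-uncons p w∈S w≢v with ∈-resp-↭ p w∈S
  ... | here eq = contradiction eq w≢v
  ... | there w∈S′ = w∈S′

  complement : ∀ {xs ys : List A} → Unique xs → (∀ {v} → v ∈ xs → v ∈ ys) → ∃ λ zs → ys ↭ xs ++ zs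
  complement {[]} [] _ = _ , ↭-refl
  complement {x ∷ xs} (x# ∷ u) sub
    with ys′ , p ← uncons-∈ (sub (here refl))
    with zs , q ← complement u (λ v∈ → ∈-uncons p (sub (there v∈)) (λ { refl → All.lookup x# v∈ refl }))
    = zs , ↭-trans p (prep x q)

  unique-⊆-length : ∀ {xs ys : List A} → Unique xs → (∀ {v} → v ∈ xs → v ∈ ys) → length xs ≤ length ys
  unique-⊆-length {xs} u sub with zs , p ← complement u sub =
    ≤-trans (m≤m+n _ _) (≤-reflexive (sym (trans (↭-length p) (length-++ xs))))

  Unique-++ʳ : ∀ (xs : List A) {ys} → Unique (xs ++ ys) → Unique ys
  Unique-++ʳ [] u = u
  Unique-++ʳ (x ∷ xs) (_ ∷ u) = Unique-++ʳ xs u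

  Unique-disjoint : ∀ (xs : List A) {ys v} → Unique (xs ++ ys) → v ∈ xs → v ∉ ys
  Unique-disjoint (x ∷ xs) (x# ∷ u) (here refl) v∈ys = All.lookup x# (∈-++⁺ʳ xs v∈ys) refl
  Unique-disjoint (x ∷ xs) (x# ∷ u) (there v∈xs) v∈ys = Unique-disjoint xs u v∈xs v∈ys

  count : {P : A → Set} → Decidable P → List A → ℕ
  count P? xs = length (filter P? xs)

  module _ {P : A → Set} (P? : Decidable P) where

    count-↭ : ∀ {xs ys} → xs ↭ ys → count P? xs ≡ count P? ys
    count-↭ p = ↭-length (filter-↭ P? p)

    count-++ : ∀ xs ys → count P? (xs ++ ys) ≡ count P? xs + count P? ys
    count-++ xs ys = trans (cong length (filter-++ P? xs ys)) (length-++ (filter P? xs))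

    count-accept : ∀ {x} xs → P x → count P? (x ∷ xs) ≡ suc (count P? xs)
    count-accept xs px = cong length (filter-accept P? {xs = xs} px)

    count-reject : ∀ {x} xs → ¬ P x → count P? (x ∷ xs) ≡ count P? xs
    count-reject xs ¬px = cong length (filter-reject P? {xs = xs} ¬px)

    count-cons-≤ : ∀ x xs → count P? (x ∷ xs) ≤ suc (count P? xs)
    count-cons-≤ x xs with P? x
    ... | yes _ = ≤-refl
    ... | no _ = n≤1+n _

  lastOf : A → List A → A
  lastOf v [] = v
  lastOf v (w ∷ l) = lastOf w l

  lastOf-++ : ∀ v xs w ys → lastOf v (xs ++ w ∷ ys) ≡ lastOf w ys
  lastOf-++ v [] w ys = refl
  lastOf-++ v (x ∷ xs) w ys = lastOf-++ x xs w ys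

  reverse-lastOf : ∀ v zs w → ∃ λ l → zs ʳ++ (v ∷ w) ≡ lastOf v zs ∷ l × lastOf (lastOf v zs) l ≡ lastOf v w
  reverse-lastOf v [] w = w , refl , refl
  reverse-lastOf v (z ∷ zs) w with reverse-lastOf z zs (v ∷ w)
  ... | l , eq , eq′ = l , eq , eq′

  -- The consecutive pairs (a , b) of v ∷ l are one fewer than its vertices, so if R holds
  -- for many second and Q for many first components, both hold for one pair.
  crossing : ∀ {Q R : A → Set} (Q? : Decidable Q) (R? : Decidable R) v l →
    suc (length l) < count R? l + count Q? (v ∷ l) →
    ∃ λ zs → ∃ λ b → ∃ λ ys → l ≡ zs ++ b ∷ ys × Q (lastOf v zs) × R b
  crossing Q? R? v [] lt = contradiction (≤-trans lt (count-cons-≤ Q? v [])) λ { (s≤s ()) }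
  crossing Q? R? v (b ∷ l) lt with R? b | Q? v | crossing Q? R? b l
  ... | yes rb | yes qv | _ = [] , b , l , refl , qv , rb
  ... | yes rb | no _ | rec = let zs , b′ , ys , eq , q , r = rec (s≤s⁻¹ lt) in
    b ∷ zs , b′ , ys , cong (b ∷_) eq , q , r
  ... | no _ | yes qv | rec = let zs , b′ , ys , eq , q , r = rec (s≤s⁻¹ (≤-trans lt (≤-reflexive (+-suc _ _)))) in
    b ∷ zs , b′ , ys , cong (b ∷_) eq , q , r
  ... | no _ | no _ | rec = let zs , b′ , ys , eq , q , r = rec (<-trans (n<1+n _) lt) in
    b ∷ zs , b′ , ys , cong (b ∷_) eq , q , r

  module _ {E : A → A → Set} where

    Linked-++ˡ : ∀ xs {ys} → Linked E (xs ++ ys) → Linked E xs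
    Linked-++ˡ [] _ = []
    Linked-++ˡ (x ∷ []) _ = [-]
    Linked-++ˡ (x ∷ y ∷ xs) (e ∷ l) = e ∷ Linked-++ˡ (y ∷ xs) l

    Linked-++ʳ : ∀ xs {ys} → Linked E (xs ++ ys) → Linked E ys
    Linked-++ʳ [] l = l
    Linked-++ʳ (x ∷ []) [-] = []
    Linked-++ʳ (x ∷ []) (_ ∷ l) = l
    Linked-++ʳ (x ∷ y ∷ xs) (_ ∷ l) = Linked-++ʳ (y ∷ xs) l

    Linked-join : ∀ x xs {y ys} → Linked E (x ∷ xs) → E (lastOf x xs) y → Linked E (y ∷ ys) → Linked E (x ∷ xs ++ y ∷ ys)
    Linked-join x [] _ e l = e ∷ l
    Linked-join x (x′ ∷ xs) (e′ ∷ l′) e l = e′ ∷ Linked-join x′ xs l′ e l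

    Linked-ʳ++ : (∀ {a b} → E a b → E b a) → ∀ v zs {w} → Linked E (v ∷ zs) → Linked E (v ∷ w) → Linked E (zs ʳ++ (v ∷ w))
    Linked-ʳ++ E-sym v [] _ l = l
    Linked-ʳ++ E-sym v (z ∷ zs) (e ∷ l′) l = Linked-ʳ++ E-sym z zs l′ (E-sym e ∷ l)

-- Triangular numbers tri n = C(n, 2)

tri : ℕ → ℕ
tri zero = 0
tri (suc n) = n + tri n

tri-+ : ∀ a b → tri (a + b) ≡ tri a + tri b + a * b
tri-+ zero b = sym (+-identityʳ _)
tri-+ (suc a) b = trans (cong (a + b +_) (tri-+ a b)) (lemma a b (tri a) (tri b))
  where lemma : ∀ a b x y → a + b + (x + y + a * b) ≡ a + x + y + (b + a * b)
        lemma = solve-∀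

tri-double : ∀ n → tri n + tri n + n ≡ n * n
tri-double zero = refl
tri-double (suc n) = trans (lemma n (tri n)) (trans (cong (λ z → z + n + suc n) (tri-double n)) (lemma′ n))
  where lemma : ∀ n x → n + x + (n + x) + suc n ≡ x + x + n + n + suc n
        lemma = solve-∀
        lemma′ : ∀ n → n * n + n + suc n ≡ suc n * suc n
        lemma′ = solve-∀

-- This is where D = tri (suc j) comes from: the join of K_j with n - j independent vertices has tri
-- j + j (n - j) = j n - D edges.
tri+tri-suc : ∀ j → tri j + tri (suc j) ≡ j * j
tri+tri-suc j = trans (lemma j (tri j)) (tri-double j)
  where lemma : ∀ j x → x + (j + x) ≡ x + x + j
        lemma = solve-∀

half-≤ : ∀ {a b} → a + a ≤ b + b → a ≤ b
half-≤ {a} {b} le with a ≤? b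
... | yes a≤b = a≤b
... | no a≰b = contradiction le (<⇒≱ (+-mono-< (≰⇒> a≰b) (≰⇒> a≰b)))

-- The clique on p = 2j + 1 vertices has exactly j edges per vertex, so disjoint copies of it meet
-- the bound j n.
tri-edge : ∀ j → tri (suc (j + j)) ≡ j * suc (j + j)
tri-edge j = trans (cong (j + j +_) (tri-+ j j)) (trans (lemma (tri j) j) (trans (cong (λ z → j + z + j * j) (tri-double j)) (lemma′ j)))
  where lemma : ∀ x j → j + j + (x + x + j * j) ≡ j + (x + x + j) + j * j
        lemma = solve-∀
        lemma′ : ∀ j → j + j * j + j * j ≡ j * suc (j + j)
        lemma′ = solve-∀

tri-≤ : ∀ j {n} → n ≤ suc (j + j) → tri n ≤ j * n
tri-≤ j {zero} _ = z≤n
tri-≤ j {suc m} (s≤s m≤) = half-≤ (cancel-≤ (suc m) (trans (+-comm (suc m) _) (tri-double (suc m))) (lemma j m) (*-monoʳ-≤ (suc m) (s≤s m≤)))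
  where lemma : ∀ j m → suc m + (j * suc m + j * suc m) ≡ suc m * suc (j + j)
        lemma = solve-∀

-- With D = j(j+1)/2 this is (r − j)(r − j − 1) ≥ 0.
tri-deficit : ∀ j r → j * r ≤ tri r + tri (suc j)
tri-deficit j r with r ≤? j
... | yes r≤j with d , refl ← m≤n⇒∃[o]m+o≡n r≤j = begin
    (r + d) * r ≡⟨ lemma r d ⟩
    r * r + r * d ≡⟨ cong (_+ r * d) (sym (tri-double r)) ⟩
    tri r + tri r + r + r * d ≤⟨ m≤m+n _ _ ⟩
    tri r + tri r + r + r * d + tri (suc d) ≡⟨ lemma′ (tri r) r d (tri (suc d)) ⟩
    tri r + (tri r + tri (suc d) + r * suc d) ≡⟨ cong (tri r +_) (sym (trans (cong tri (sym (+-suc r d))) (tri-+ r (suc d)))) ⟩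
    tri r + tri (suc (r + d)) ∎
  where open ≤-Reasoning
        lemma : ∀ r d → (r + d) * r ≡ r * r + r * d
        lemma = solve-∀
        lemma′ : ∀ x r d y → x + x + r + r * d + y ≡ x + (x + y + r * suc d)
        lemma′ = solve-∀
... | no r≰j with d , refl ← m≤n⇒∃[o]m+o≡n (≰⇒> r≰j) = begin
    j * (suc j + d) ≤⟨ m≤m+n _ (tri d + d) ⟩
    j * (suc j + d) + (tri d + d) ≡⟨ cancel (suc j) ⟩
    tri (suc j) + tri d + suc j * d + tri (suc j) ≡⟨ cong (_+ tri (suc j)) (tri-+ (suc j) d) ⟨
    tri (suc j + d) + tri (suc j) ∎
  where open ≤-Reasoning
        lemma : ∀ j d y → suc j + (j * (suc j + d) + (y + d)) ≡ suc j * suc j + (y + suc j * d)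
        lemma = solve-∀
        lemma′ : ∀ s d x y → x + x + s + (y + s * d) ≡ s + (x + y + s * d + x)
        lemma′ = solve-∀
        cancel : ∀ s → j * (suc j + d) + (tri d + d) ≡ tri (suc j) + tri d + suc j * d + tri (suc j)
        cancel s = +-cancelˡ-≡ (suc j) _ _ (trans (lemma j d (tri d)) (trans (cong (_+ (tri d + suc j * d)) (sym (tri-double (suc j)))) (lemma′ (suc j) d (tri (suc j)) (tri d))))

-- Convexity: both pairs of arguments have the same sum, and the pair on the right is spread further
-- apart.
tri-exchange : ∀ r x y → tri (r + x) + tri (r + y) ≤ tri (r + x + y) + tri r
tri-exchange r x y = begin
    tri (r + x) + tri (r + y) ≡⟨ cong (tri (r + x) +_) (tri-+ r y) ⟩
    tri (r + x) + (tri r + tri y + r * y) ≤⟨ +-monoʳ-≤ (tri (r + x)) (+-monoʳ-≤ (tri r + tri y) (*-monoˡ-≤ y (m≤m+n r x))) ⟩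
    tri (r + x) + (tri r + tri y + (r + x) * y) ≡⟨ lemma (tri (r + x)) (tri r) (tri y) _ ⟩
    tri (r + x) + tri y + (r + x) * y + tri r ≡⟨ cong (_+ tri r) (tri-+ (r + x) y) ⟨
    tri (r + x + y) + tri r ∎
  where open ≤-Reasoning
        lemma : ∀ a b c d → a + (b + c + d) ≡ a + c + d + b
        lemma = solve-∀

-- The parabola tri x - j x is symmetric about p / 2, and the hypotheses place c between r and its
-- mirror image p - r.
tri-core : ∀ j {r c} → r ≤ c → r + c ≤ suc (j + j) → tri c + j * r ≤ tri r + j * c
tri-core j {r} r≤c r+c≤ with m , refl ← m≤n⇒∃[o]m+o≡n r≤c = begin
    tri (r + m) + j * r ≡⟨ cong (_+ j * r) (tri-+ r m) ⟩
    tri r + tri m + r * m + j * r ≡⟨ lemma (tri r) (tri m) r m j ⟩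
    tri r + (r * m + tri m) + j * r ≤⟨ +-monoˡ-≤ (j * r) (+-monoʳ-≤ (tri r) (half-≤
      (cancel-≤ m (trans (lemma₁ r m (tri m)) (trans (cong (r * m + r * m +_) (tri-double m)) (lemma₂ r m))) (lemma₃ j m) (*-monoʳ-≤ m r+c≤)))) ⟩
    tri r + j * m + j * r ≡⟨ lemma₄ (tri r) r m j ⟩
    tri r + j * (r + m) ∎
  where open ≤-Reasoning
        lemma : ∀ a b r m j → a + b + r * m + j * r ≡ a + (r * m + b) + j * r
        lemma = solve-∀
        lemma₁ : ∀ r m x → m + (r * m + x + (r * m + x)) ≡ r * m + r * m + (x + x + m)
        lemma₁ = solve-∀
        lemma₂ : ∀ r m → r * m + r * m + m * m ≡ m * (r + (r + m))
        lemma₂ = solve-∀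
        lemma₃ : ∀ j m → m + (j * m + j * m) ≡ m * suc (j + j)
        lemma₃ = solve-∀
        lemma₄ : ∀ a r m j → a + j * m + j * r ≡ a + j * (r + m)
        lemma₄ = solve-∀

-- Graphs without long paths: rotations and the Turán bound

record SimpleGraph (V : Set) : Set₁ where
  field
    E : V → V → Set
    E? : ∀ u → Decidable (E u)
    E-sym : ∀ {u v} → E u v → E v u
    E-irr : ∀ {v} → ¬ E v v

module _ {V : Set} (_≟_ : DecidableEquality V) where

  open import Data.List.Membership.DecPropositional _≟_ using (_∈?_; _∉?_)

  count-∈ : ∀ {xs} ys → Unique xs → (∀ {v} → v ∈ xs → v ∈ ys) → length xs ≤ count (_∈? xs) ys
  count-∈ {xs} ys u sub = unique-⊆-length u (λ v∈ → ∈-filter⁺ (_∈? xs) (sub v∈) v∈)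

  module OnGraph (G : SimpleGraph V) where
    open SimpleGraph G

    deg : V → List V → ℕ
    deg v S = count (E? v) S

    -- Every vertex counts its neighbours later in the list. By `e-↭` the order does not matter, so
    -- lists without repetition can serve as vertex sets.
    e : List V → ℕ
    e [] = 0
    e (v ∷ S) = deg v S + e S

    deg-self : ∀ v S → deg v (v ∷ S) ≡ deg v S
    deg-self v S = count-reject (E? v) S E-irr

    deg-swap : ∀ u v S → deg u (v ∷ S) + deg v S ≡ deg v (u ∷ S) + deg u S
    deg-swap u v S with E? u v | E? v u
    ... | yes _ | yes _ = cong suc (+-comm (deg u S) _)
    ... | no _ | no _ = +-comm (deg u S) _
    ... | yes p | no q = contradiction (E-sym p) q
    ... | no q | yes p = contradiction (E-sym p) q

    e-↭ : ∀ {S T} → S ↭ T → e S ≡ e T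
    e-↭ Perm.refl = refl
    e-↭ (prep v p) = cong₂ _+_ (count-↭ (E? v) p) (e-↭ p)
    e-↭ (swap {S} {T} u v p) = begin
      deg u (v ∷ S) + (deg v S + e S) ≡⟨ +-assoc (deg u (v ∷ S)) _ _ ⟨
      deg u (v ∷ S) + deg v S + e S ≡⟨ cong (_+ e S) (deg-swap u v S) ⟩
      deg v (u ∷ S) + deg u S + e S ≡⟨ +-assoc (deg v (u ∷ S)) _ _ ⟩
      deg v (u ∷ S) + (deg u S + e S) ≡⟨ cong₂ _+_ (count-↭ (E? v) (prep u p)) (cong₂ _+_ (count-↭ (E? u) p) (e-↭ p)) ⟩
      deg v (u ∷ T) + (deg u T + e T) ∎
      where open ≡.≡-Reasoning
    e-↭ (Perm.trans p q) = trans (e-↭ p) (e-↭ q)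

    e-++-≥ : ∀ S T → e S + e T ≤ e (S ++ T)
    e-++-≥ [] T = ≤-refl
    e-++-≥ (v ∷ S) T = begin
      deg v S + e S + e T ≡⟨ +-assoc (deg v S) _ _ ⟩
      deg v S + (e S + e T) ≤⟨ +-mono-≤ (≤-trans (m≤m+n _ (deg v T)) (≤-reflexive (sym (count-++ (E? v) S T)))) (e-++-≥ S T) ⟩
      deg v (S ++ T) + e (S ++ T) ∎
      where open ≤-Reasoning

    e-++-closed : ∀ S T → (∀ {u w} → u ∈ S → w ∈ T → ¬ E u w) → e (S ++ T) ≡ e S + e T
    e-++-closed [] T _ = refl
    e-++-closed (v ∷ S) T sep = begin
      deg v (S ++ T) + e (S ++ T) ≡⟨ cong₂ _+_ (trans (count-++ (E? v) S T) (trans (cong (λ l → deg v S + length l)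
         (filter-none (E? v) (All.tabulate (sep (here refl))))) (+-identityʳ _))) (e-++-closed S T (sep ∘ there)) ⟩
      deg v S + (e S + e T) ≡⟨ +-assoc (deg v S) _ _ ⟨
      deg v S + e S + e T ∎
      where open ≡.≡-Reasoning

    e-mono : ∀ {S T} → Unique S → (∀ {v} → v ∈ S → v ∈ T) → e S ≤ e T
    e-mono {S} u sub with Z , p ← complement u sub =
      ≤-trans (≤-trans (m≤m+n _ _) (e-++-≥ S Z)) (≤-reflexive (sym (e-↭ p)))

    e≤tri : ∀ S → e S ≤ tri (length S)
    e≤tri [] = z≤n
    e≤tri (v ∷ S) = +-mono-≤ (length-filter (E? v) S) (e≤tri S)

    record Path (S P : List V) : Set where
      constructor path
      field
        unique : Unique P
        linked : Linked E P
        inside : ∀ {v} → v ∈ P → v ∈ S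
    open Path public

    Path-mono : ∀ {S T P} → (∀ {v} → v ∈ S → v ∈ T) → Path S P → Path T P
    Path-mono sub (path u l i) = path u l (sub ∘ i)

    NoPath : ℕ → List V → Set
    NoPath p S = ∀ P → Path S P → length P ≤ p

    -- For P inside S this makes P a union of components of the graph on S.
    Closed : List V → List V → Set
    Closed P S = ∀ {u w} → u ∈ P → w ∈ S → E u w → w ∈ P

    exit? : ∀ U P S → (∃ λ u → ∃ λ w → u ∈ U × w ∈ S × w ∉ P × E u w)
                    ⊎ (∀ {u w} → u ∈ U → w ∈ S → E u w → w ∈ P)
    exit? U P S with any? (λ u → any? (λ w → (w ∉? P) ×-dec E? u w) S) U
    ... | yes p = let u , u∈ , q = find p ; w , w∈ , w∉ , e = find q in inj₁ (u , w , u∈ , w∈ , w∉ , e)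
    ... | no ¬p = inj₂ λ {u} {w} u∈ w∈ e → decidable-stable (w ∈? P) λ w∉ → ¬p (lose u∈ (lose w∈ (w∉ , e)))

    Path-cons : ∀ {S v l w} → Path S (v ∷ l) → w ∈ S → w ∉ v ∷ l → E v w → Path S (w ∷ v ∷ l)
    Path-cons (path u l i) w∈ w∉ e = path (All.tabulate (λ x∈ eq → w∉ (subst (_∈ _) (sym eq) x∈)) ∷ u) (E-sym e ∷ l)
      λ { (here refl) → w∈ ; (there x∈) → i x∈ }

    -- Pósa rotation: v is attached to the head of w and the segment before w is reversed. The
    -- vertex preceding w becomes the start, and the last vertex stays if w is nonempty. With w
    -- empty the whole path is reversed.
    flip-initial : ∀ {S} v zs w → Path S (v ∷ zs ++ w) → Linked E (v ∷ w) →
      ∃ λ l → Path S (lastOf v zs ∷ l) × (v ∷ zs ++ w ↭ lastOf v zs ∷ l) × lastOf (lastOf v zs) l ≡ lastOf v w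
    flip-initial v zs w (path u l i) lw with reverse-lastOf v zs w | Linked-ʳ++ E-sym v zs (Linked-++ˡ (v ∷ zs) l) lw
    ... | l′ , eq , eq′ | lk = l′ , path (Unique-resp p u) (subst (Linked E) eq lk) (i ∘ ∈-resp-↭ (↭-sym p)) , p , eq′
      where p : v ∷ zs ++ w ↭ lastOf v zs ∷ l′
            p = ↭-trans (++↭ʳ++ (v ∷ zs) w) (↭-reflexive eq)

    record Cycle (S P : List V) : Set where
      constructor cycle
      field
        first : V
        rest : List V
        isPath : Path S (first ∷ rest)
        isPerm : P ↭ first ∷ rest
        closing : E (lastOf first rest) first

    Cycle-start : ∀ {S P u} → Cycle S P → u ∈ P → ∃ λ l → Path S (u ∷ l) × (P ↭ u ∷ l)
    Cycle-start {u = u} (cycle v l pt p cl) u∈P with ∈-∃++ (∈-resp-↭ p u∈P)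
    ... | [] , ys , refl = ys , pt , p
    ... | x ∷ xs , ys , refl = ys ++ x ∷ xs , path (Unique-resp q (unique pt)) lk (inside pt ∘ ∈-resp-↭ (↭-sym q)) , ↭-trans p q
      where q : x ∷ xs ++ u ∷ ys ↭ u ∷ ys ++ x ∷ xs
            q = ++-comm (x ∷ xs) (u ∷ ys)
            lk = Linked-join u ys (Linked-++ʳ (x ∷ xs) (linked pt)) (subst (λ z → E z x) (lastOf-++ x xs u ys) cl) (Linked-++ˡ (x ∷ xs) (linked pt))

    deg-inside : ∀ {S v l} → Unique S → (∀ {w} → w ∈ S → E v w → w ∈ v ∷ l) → deg v S ≤ count (E? v) l
    deg-inside {S} {v} {l} uS full = unique-⊆-length (Unique.filter⁺ (E? v) uS) λ w∈ → case ∈-filter⁻ (E? v) {xs = S} w∈ of λ (w∈S , e) →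
      case full w∈S e of λ { (here refl) → ⊥-elim (E-irr e) ; (there w∈l) → ∈-filter⁺ (E? v) w∈l e }

    -- A path through all of C has at most p - |C| ≤ t vertices outside C. Hence degree above t is
    -- enough to rotate an end into C, where degrees exceed j, and two ends of degree above j close
    -- the path to a cycle.
    module _ {j t p : ℕ} {S C : List V} (uS : Unique S) (noPath : NoPath p S) (uC : Unique C) (p≤ : p ≤ suc (j + j))
      (good-C : ∀ {v} → v ∈ C → suc j ≤ deg v S)
      (deg> : ∀ {v} → v ∈ S → suc j ≤ deg v S ⊎ t < deg v S)
      (p≤C+t : p ≤ length C + t) where

      private
        Full : V → List V → Set
        Full v P = ∀ {w} → w ∈ S → E v w → w ∈ P

        full? : ∀ v P → (∃ λ w → w ∈ S × w ∉ P × E v w) ⊎ Full v P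
        full? v P with exit? [ v ] P S
        ... | inj₁ (_ , w , here refl , w∈ , w∉ , e) = inj₁ (w , w∈ , w∉ , e)
        ... | inj₂ f = inj₂ (f (here refl))

        -- Among the more than t end vertices obtained by rotation one lies in C,
        -- as the path has at most t vertices outside C.
        rotate-to-good : ∀ v l → Path S (v ∷ l) → (∀ {x} → x ∈ C → x ∈ v ∷ l) → Full v (v ∷ l) →
          ∃ λ v′ → ∃ λ l′ → Path S (v′ ∷ l′) × (v ∷ l ↭ v′ ∷ l′) × suc j ≤ deg v′ S × lastOf v′ l′ ≡ lastOf v l
        rotate-to-good v l pt C⊆ full with deg> (inside pt (here refl))
        ... | inj₁ good = v , l , pt , ↭-refl , good , refl
        ... | inj₂ t< with crossing (_∈? C) (E? v) v l
                    (≤-<-trans (≤-trans (noPath _ pt) p≤C+t) (<-≤-trans (+-monoʳ-< (length C) t<)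
                      (≤-trans (+-mono-≤ (count-∈ (v ∷ l) uC C⊆) (deg-inside uS full)) (≤-reflexive (+-comm (count (_∈? C) (v ∷ l)) _)))))
        ... | zs , b , ys , refl , q , r with flip-initial v zs (b ∷ ys) pt (r ∷ Linked-++ʳ (v ∷ zs) (linked pt))
        ... | l′ , pt′ , pm , eq = lastOf v zs , l′ , pt′ , pm , good-C q , trans eq (sym (lastOf-++ v zs b ys))

        -- The ends have at least 2 (j + 1) > p neighbours on the path between them, counted with
        -- multiplicity. So some consecutive a, b have x adjacent to a and v to b, as in Dirac's
        -- theorem; reversing the part up to a leaves a path from a to x, closed by the edge x a.
        close : ∀ v l → Path S (v ∷ l) → Full v (v ∷ l) → suc j ≤ deg v S →
          ∀ x → x ≡ lastOf v l → Full x (v ∷ l) → suc j ≤ deg x S → Cycle S (v ∷ l)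
        close v l pt full good x eqx fullx goodx with crossing (E? x) (E? v) v l
            (≤-<-trans (≤-trans (noPath _ pt) p≤) (≤-trans (s≤s (≤-reflexive (sym (+-suc j j))))
              (+-mono-≤ (≤-trans good (deg-inside uS full)) (≤-trans goodx (unique-⊆-length (Unique.filter⁺ (E? x) uS)
                 λ w∈ → case ∈-filter⁻ (E? x) {xs = S} w∈ of λ (w∈S , e) → ∈-filter⁺ (E? x) (fullx w∈S e) e)))))
        ... | zs , b , ys , refl , q , r with flip-initial v zs (b ∷ ys) pt (r ∷ Linked-++ʳ (v ∷ zs) (linked pt))
        ... | l′ , pt′ , pm , eq = cycle (lastOf v zs) l′ pt′ pm (subst (λ z → E z (lastOf v zs)) (trans eqx (trans (lastOf-++ v zs b ys) (sym eq))) q)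

        -- An end with a neighbour outside extends the path. Otherwise both ends are made good by
        -- rotations and the path closes to a cycle, which is either a component or can be cut open
        -- at a vertex with a neighbour outside. Each extension adds a vertex and no path exceeds p
        -- vertices, so `fuel` cannot run out.
        grow : ∀ fuel v l → Path S (v ∷ l) → (∀ {x} → x ∈ C → x ∈ v ∷ l) → p < length (v ∷ l) + fuel →
          ∃ λ P → Path S P × Closed P S × 0 < length P
        grow zero v l pt C⊆ lt = contradiction (noPath _ pt) (<⇒≱ (subst (p <_) (+-identityʳ _) lt))
        grow (suc fuel) v l pt C⊆ lt = from-start
          where
          Result = ∃ λ P → Path S P × Closed P S × 0 < length P

          extend : ∀ {v′ l′} → Path S (v′ ∷ l′) → v ∷ l ↭ v′ ∷ l′ → (∃ λ w → w ∈ S × w ∉ v′ ∷ l′ × E v′ w) → Result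
          extend pt′ pm (w , w∈ , w∉ , e) = grow fuel w _ (Path-cons pt′ w∈ w∉ e) (there ∘ ∈-resp-↭ pm ∘ C⊆)
            (≤-trans lt (≤-reflexive (trans (+-suc _ fuel) (cong (λ k → suc k + fuel) (↭-length pm)))))

          transport-full : ∀ {x P Q} → P ↭ Q → Full x P → Full x Q
          transport-full pm f w∈ e = ∈-resp-↭ pm (f w∈ e)

          from-cycle : Cycle S (v ∷ l) → Result
          from-cycle cy with exit? (v ∷ l) (v ∷ l) S
          ... | inj₂ closed = v ∷ l , pt , closed , s≤s z≤n
          ... | inj₁ (u , w , u∈ , w∈ , w∉ , e) with l′ , pt′ , pm ← Cycle-start cy u∈ =
            extend pt′ pm (w , w∈ , w∉ ∘ ∈-resp-↭ (↭-sym pm) , e)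

          from-good-ends : ∀ {v′ l′} → Path S (v′ ∷ l′) → v ∷ l ↭ v′ ∷ l′ → Full v′ (v′ ∷ l′) → suc j ≤ deg v′ S →
            ∀ x → x ≡ lastOf v′ l′ → Full x (v′ ∷ l′) → suc j ≤ deg x S → Result
          from-good-ends pt′ pm f g x eq fx gx with close _ _ pt′ f g x eq fx gx
          ... | cycle a b c d e = from-cycle (cycle a b c (↭-trans pm d) e)

          from-good-start : ∀ {v′ l′} → Path S (v′ ∷ l′) → v ∷ l ↭ v′ ∷ l′ → Full v′ (v′ ∷ l′) → suc j ≤ deg v′ S → Result
          -- Reversal brings the other end to the front. The rotation that repairs it fixes the last
          -- vertex, which is the end already known to be good.
          from-good-start {v′} {l′} pt′ pm f g with
              flip-initial v′ l′ [] (subst (Path S) (cong (v′ ∷_) (sym (++-identityʳ l′))) pt′) [-]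
          ... | l″ , pt″ , pm″ , eq″ with full? (lastOf v′ l′) (lastOf v′ l′ ∷ l″) | subst (λ z → v′ ∷ z ↭ lastOf v′ l′ ∷ l″) (++-identityʳ l′) pm″
          ... | inj₁ out | pm₂ = extend pt″ (↭-trans pm pm₂) out
          ... | inj₂ f″ | pm₂ with rotate-to-good _ l″ pt″ (∈-resp-↭ (↭-trans pm pm₂) ∘ C⊆) f″
          ... | x , l₃ , pt₃ , pm₃ , g₃ , eq₃ with full? x (x ∷ l₃)
          ... | inj₁ out = extend pt₃ (↭-trans pm (↭-trans pm₂ pm₃)) out
          ... | inj₂ f₃ = from-good-ends pt₃ (↭-trans pm (↭-trans pm₂ pm₃)) f₃ g₃ v′ (sym (trans eq₃ eq″)) (transport-full (↭-trans pm₂ pm₃) f) g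

          from-start : Result
          from-start with full? v (v ∷ l)
          ... | inj₁ out = extend pt ↭-refl out
          ... | inj₂ f with rotate-to-good v l pt C⊆ f
          ... | v′ , l′ , pt′ , pm , g , _ with full? v′ (v′ ∷ l′)
          ... | inj₁ out = extend pt′ pm out
          ... | inj₂ f′ = from-good-start pt′ pm f′ g

      closed-path : ∀ {v l} → C ≡ v ∷ l → Path S C → ∃ λ P → Path S P × Closed P S × 0 < length P
      closed-path {v} {l} refl pt = grow (suc p) v l pt id (m≤n+m (suc p) (suc (length l)))

    record Removed (S : List V) (v : V) : Set where
      constructor removed
      field
        {remaining} : List V
        perm : S ↭ v ∷ remaining
        e-removed : e S ≡ deg v S + e remaining
        unique-remaining : Unique remaining
        remaining⊆ : ∀ {w} → w ∈ remaining → w ∈ S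

    remove : ∀ {S v} → Unique S → v ∈ S → Removed S v
    remove {S} {v} u v∈ with S′ , p ← uncons-∈ v∈ with _ ∷ u′ ← Unique-resp p u =
      removed p (trans (e-↭ p) (cong (_+ e S′) (trans (sym (deg-self v S′)) (count-↭ (E? v) (↭-sym p))))) u′ (∈-resp-↭ (↭-sym p) ∘ there)

    record Split (S P : List V) : Set where
      constructor split
      field
        {others} : List V
        perm : S ↭ P ++ others
        e-split : e S ≡ e P + e others
        unique-others : Unique others
        others⊆ : ∀ {w} → w ∈ others → w ∈ S
        length-split : length S ≡ length P + length others
        separated : ∀ {u w} → u ∈ P → w ∈ others → ¬ E u w

    split-closed : ∀ {S P} → Unique S → Path S P → Closed P S → Split S P
    split-closed {S} {P} u (path uP _ i) closed with R , p ← complement uP i =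
      split p (trans (e-↭ p) (e-++-closed P R sep)) (Unique-++ʳ P u′) R⊆ (trans (↭-length p) (length-++ P)) sep
      where
      u′ = Unique-resp p u
      R⊆ : ∀ {w} → w ∈ R → w ∈ S
      R⊆ = ∈-resp-↭ (↭-sym p) ∘ ∈-++⁺ʳ P
      sep : ∀ {u w} → u ∈ P → w ∈ R → ¬ E u w
      sep u∈ w∈ e = Unique-disjoint P u′ (closed u∈ (R⊆ w∈) e) w∈

    NoPath-⊆ : ∀ {p S T} → (∀ {v} → v ∈ T → v ∈ S) → NoPath p S → NoPath p T
    NoPath-⊆ sub noPath P pt = noPath P (Path-mono sub pt)

    low-or-all : ∀ k S → (∃ λ v → v ∈ S × deg v S ≤ k) ⊎ (∀ {v} → v ∈ S → suc k ≤ deg v S)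
    low-or-all k S with any? (λ v → deg v S ≤? k) S
    ... | yes p = inj₁ (find p)
    ... | no ¬p = inj₂ λ v∈ → ≰⇒> (λ le → ¬p (lose v∈ le))

    module _ (j : ℕ) where
      private
        p : ℕ
        p = suc (j + j)

      closed-path-of-high-degree : ∀ {S v} → Unique S → NoPath p S → (∀ {v} → v ∈ S → suc j ≤ deg v S) → v ∈ S →
        ∃ λ P → Path S P × Closed P S × 0 < length P
      -- For a single vertex C the value t = 2j meets p ≤ |C| + t, and every degree satisfies the
      -- first alternative.
      closed-path-of-high-degree {S} {v} u noPath high v∈ = closed-path {j} {j + j} {p} {S} {[ v ]} u noPath ([] ∷ []) ≤-refl
        (λ { (here refl) → high v∈ }) (λ w∈ → inj₁ (high w∈)) ≤-refl refl (path ([] ∷ []) [-] λ { (here refl) → v∈ })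

      -- A vertex of degree at most j is removed at cost j. If there is none, some component is
      -- spanned by a path; it has at most p vertices, hence by `tri-≤` at most j edges per vertex,
      -- and is removed as a whole.
      erdős-gallai : ∀ N S → length S ≤ N → Unique S → NoPath p S → e S ≤ j * length S
      erdős-gallai N [] _ _ _ = z≤n
      erdős-gallai (suc N) S@(_ ∷ _) le u noPath with low-or-all j S
      ... | inj₁ (v , v∈ , d≤) with removed {S′} pm eq u′ sub ← remove u v∈ = begin
          e S ≡⟨ eq ⟩
          deg v S + e S′ ≤⟨ +-mono-≤ d≤ (erdős-gallai N S′ (s≤s⁻¹ (≤-trans (≤-reflexive (sym (↭-length pm))) le)) u′ (NoPath-⊆ sub noPath)) ⟩
          j + j * length S′ ≡⟨ *-suc j _ ⟨
          j * suc (length S′) ≡⟨ cong (j *_) (↭-length pm) ⟨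
          j * length S ∎
        where open ≤-Reasoning
      ... | inj₂ high with P , pt , closed , pos ← closed-path-of-high-degree u noPath high (here refl)
          with split {R} pm eq u′ sub len _ ← split-closed u pt closed = begin
          e S ≡⟨ eq ⟩
          e P + e R ≤⟨ +-mono-≤ (≤-trans (e≤tri P) (tri-≤ j (noPath P pt))) (erdős-gallai N R
            (s≤s⁻¹ (≤-trans (+-monoˡ-≤ (length R) pos) (≤-trans (≤-reflexive (sym len)) le))) u′ (NoPath-⊆ sub noPath)) ⟩
          j * length P + j * length R ≡⟨ *-distribˡ-+ j (length P) _ ⟨
          j * (length P + length R) ≡⟨ cong (j *_) len ⟨
          j * length S ∎
        where open ≤-Reasoning

      -- Arises as a component, of minimum degree above j, of what remains after deleting vertices
      -- of degree at most j. In `bound` the core may be a clique and every other vertex is charged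
      -- j edges.
      record Core (S : List V) : Set where
        constructor core
        field
          {start} : V
          {rest} : List V
          isPath : Path S (start ∷ rest)
          high : ∀ {v} → v ∈ start ∷ rest → suc j ≤ deg v S
          long : suc (suc j) ≤ suc (length rest)
          bound : e S + j * suc (length rest) ≤ tri (suc (length rest)) + j * length S

      deg-⊆ : ∀ {S T} v → Unique T → (∀ {w} → w ∈ T → w ∈ S) → deg v T ≤ deg v S
      deg-⊆ {S} {T} v u sub = unique-⊆-length (Unique.filter⁺ (E? v) u) λ w∈ → case ∈-filter⁻ (E? v) {xs = T} w∈ of λ (w∈T , ev) → ∈-filter⁺ (E? v) (sub w∈T) ev

      -- Vertices of degree at most j are deleted one at a time. If this reaches j vertices, the
      -- total is at most tri j + j (|S| - j) = j |S| - D. If it stops earlier, a component of the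
      -- rest is the core.
      degenerate-or-core : ∀ N S → length S ≤ N → Unique S → NoPath p S → j ≤ length S →
        e S + tri (suc j) ≤ j * length S ⊎ Core S
      degenerate-or-core N S le u noPath j≤ with length S ℕ.≟ j
      ... | yes refl = inj₁ (≤-trans (+-monoˡ-≤ _ (e≤tri S)) (≤-reflexive (tri+tri-suc (length S))))
      degenerate-or-core N [] le u noPath z≤n | no ¬eq = contradiction refl ¬eq
      degenerate-or-core (suc N) S@(s ∷ _) le u noPath j≤ | no ¬eq with low-or-all j S
      ... | inj₁ (v , v∈ , d≤) with removed {S′} pm eq u′ sub ← remove u v∈
          with degenerate-or-core N S′ (s≤s⁻¹ (≤-trans (≤-reflexive (sym (↭-length pm))) le)) u′ (NoPath-⊆ sub noPath)
            (s≤s⁻¹ (≤-trans (≤∧≢⇒< j≤ (¬eq ∘ sym)) (≤-reflexive (↭-length pm))))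
      ... | inj₁ d = inj₁ (begin
          e S + tri (suc j) ≡⟨ trans (cong (_+ tri (suc j)) eq) (+-assoc (deg v S) _ _) ⟩
          deg v S + (e S′ + tri (suc j)) ≤⟨ +-mono-≤ d≤ d ⟩
          j + j * length S′ ≡⟨ *-suc j _ ⟨
          j * suc (length S′) ≡⟨ cong (j *_) (↭-length pm) ⟨
          j * length S ∎)
        where open ≤-Reasoning
      ... | inj₂ (core {c} {C} pt h lg b) = inj₂ (core (Path-mono sub pt) (λ w∈ → ≤-trans (h w∈) (deg-⊆ _ u′ sub)) lg (begin
          e S + j * suc (length C) ≡⟨ trans (cong (_+ j * suc (length C)) eq) (+-assoc (deg v S) _ _) ⟩
          deg v S + (e S′ + j * suc (length C)) ≤⟨ +-mono-≤ d≤ b ⟩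
          j + (tri (suc (length C)) + j * length S′) ≡⟨ lemma j (tri (suc (length C))) (length S′) ⟩
          tri (suc (length C)) + j * suc (length S′) ≡⟨ cong (λ z → tri (suc (length C)) + j * z) (↭-length pm) ⟨
          tri (suc (length C)) + j * length S ∎))
        where open ≤-Reasoning
              lemma : ∀ j a b → j + (a + j * b) ≡ a + j * suc b
              lemma = solve-∀
      degenerate-or-core (suc N) S@(s ∷ _) le u noPath j≤ | no ¬eq | inj₂ high
          with closed-path-of-high-degree u noPath high (here refl)
      ... | c ∷ C , pt , closed , _ with split {R} pm eq u′ sub len _ ← split-closed u pt closed =
          inj₂ (core pt (high ∘ inside pt) (s≤s (≤-trans (high (inside pt (here refl)))
            (≤-trans (deg-inside u (closed (here refl))) (length-filter (E? c) C)))) (begin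
          e S + j * suc (length C) ≡⟨ cong (_+ j * suc (length C)) eq ⟩
          e (c ∷ C) + e R + j * suc (length C) ≤⟨ +-monoˡ-≤ (j * suc (length C)) (+-mono-≤ (e≤tri (c ∷ C)) (erdős-gallai (length R) R ≤-refl u′ (NoPath-⊆ sub noPath))) ⟩
          tri (suc (length C)) + j * length R + j * suc (length C) ≡⟨ lemma (tri (suc (length C))) j (length R) (suc (length C)) ⟩
          tri (suc (length C)) + j * (suc (length C) + length R) ≡⟨ cong (λ z → tri (suc (length C)) + j * z) len ⟨
          tri (suc (length C)) + j * length S ∎))
        where open ≤-Reasoning
              lemma : ∀ a j b c → a + j * b + j * c ≡ a + j * (c + b)
              lemma = solve-∀

      -- The bound is the size of q disjoint copies of K_p and one K_r. Admitting r = p covers the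
      -- residue j + 1 when j = 0.
      faudree-schelp : ∀ N S q r → length S ≤ N → length S ≡ q * p + r → r ≤ p → Unique S → NoPath p S →
        e S ≤ q * p * j + tri r
      faudree-schelp N S zero r le eq r≤ u noPath = ≤-trans (e≤tri S) (≤-reflexive (cong tri eq))
      faudree-schelp N S (suc q) zero le eq r≤ u noPath = begin
          e S ≤⟨ erdős-gallai N S le u noPath ⟩
          j * length S ≡⟨ trans (cong (j *_) eq) (lemma j (suc q * p)) ⟩
          suc q * p * j + 0 ∎
        where open ≤-Reasoning
              lemma : ∀ j x → j * (x + 0) ≡ x * j + 0
              lemma = solve-∀
      faudree-schelp zero S (suc q) (suc r) le eq r≤ u noPath = contradiction (≤-trans (≤-reflexive (sym eq)) le) λ ()
      faudree-schelp (suc N) S (suc q) (suc r) le eq r≤ u noPath with low-or-all r S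
      ... | inj₁ (v , v∈ , d≤) with removed {S′} pm eq′ u′ sub ← remove u v∈ = begin
          e S ≡⟨ eq′ ⟩
          deg v S + e S′ ≤⟨ +-mono-≤ d≤ (faudree-schelp N S′ (suc q) r (s≤s⁻¹ (≤-trans (≤-reflexive (sym (↭-length pm))) le))
            (suc-injective (trans (sym (↭-length pm)) (trans eq (+-suc (suc q * p) r)))) (≤-trans (n≤1+n r) r≤) u′ (NoPath-⊆ sub noPath)) ⟩
          r + (suc q * p * j + tri r) ≡⟨ lemma r (suc q * p * j) (tri r) ⟩
          suc q * p * j + (r + tri r) ∎
        where open ≤-Reasoning
              lemma : ∀ a b c → a + (b + c) ≡ b + (a + c)
              lemma = solve-∀
      ... | inj₂ high with degenerate-or-core (suc N) S le u noPath
              (≤-trans (≤-trans (m≤m+n j (suc j)) (≤-reflexive (+-suc j j))) (≤-trans (≤-trans (m≤m+n p (q * p)) (m≤m+n _ (suc r))) (≤-reflexive (sym eq))))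
      ... | inj₁ d = cancel-≤ (tri (suc j)) (+-comm (tri (suc j)) (e S)) refl (begin
          e S + tri (suc j) ≤⟨ d ⟩
          j * length S ≡⟨ trans (cong (j *_) eq) (*-distribˡ-+ j (suc q * p) _) ⟩
          j * (suc q * p) + j * suc r ≤⟨ +-monoʳ-≤ (j * (suc q * p)) (tri-deficit j (suc r)) ⟩
          j * (suc q * p) + (tri (suc r) + tri (suc j)) ≡⟨ lemma j (suc q * p) (tri (suc r)) (tri (suc j)) ⟩
          tri (suc j) + (suc q * p * j + tri (suc r)) ∎)
        where open ≤-Reasoning
              lemma : ∀ j x a b → j * x + (a + b) ≡ b + (x * j + a)
              lemma = solve-∀
      ... | inj₂ (core {c} {C} pt h lg b) with m≤n⇒∃[o]m+o≡n (noPath _ pt)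
      ... | s , c+s≡p with suc r ≤? s
      -- The core leaves room for the residue: s = p - |C| is at least the residue, and the bound
      -- carried by the core is enough.
      ... | yes r≤s = cancel-≤ (j * ∣C∣) (+-comm (j * ∣C∣) (e S)) refl (begin
          e S + j * ∣C∣ ≤⟨ b ⟩
          tri ∣C∣ + j * length S ≡⟨ trans (cong (λ z → tri ∣C∣ + j * z) eq) (lemma (tri ∣C∣) j (suc q * p) (suc r)) ⟩
          j * (suc q * p) + (tri ∣C∣ + j * suc r) ≤⟨ +-monoʳ-≤ (j * (suc q * p)) (tri-core j r≤c
              (≤-trans (+-monoˡ-≤ ∣C∣ r≤s) (≤-reflexive (trans (+-comm s ∣C∣) c+s≡p)))) ⟩
          j * (suc q * p) + (tri (suc r) + j * ∣C∣) ≡⟨ lemma′ j (suc q * p) (tri (suc r)) (j * ∣C∣) ⟩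
          j * ∣C∣ + (suc q * p * j + tri (suc r)) ∎)
        where open ≤-Reasoning
              ∣C∣ : ℕ
              ∣C∣ = suc (length C)
              lemma : ∀ a j x y → a + j * (x + y) ≡ j * x + (a + j * y)
              lemma = solve-∀
              lemma′ : ∀ j x a b → j * x + (a + b) ≡ b + (x * j + a)
              lemma′ = solve-∀
              s≤j : s ≤ j
              s≤j = cancel-≤ (suc j) refl refl (≤-trans (+-monoˡ-≤ s (<⇒≤ lg)) (≤-reflexive c+s≡p))
              r≤c : suc r ≤ ∣C∣
              r≤c = ≤-trans r≤s (≤-trans s≤j (≤-trans (n≤1+n j) (<⇒≤ lg)))
      -- Now every degree exceeds s = p - |C|, so the core can be grown into a component, which is
      -- split off.
      ... | no r≰s with P , ptP , closed , pos ← closed-path {j} {s} {p} {S} {c ∷ C} u noPath (unique pt) ≤-refl h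
                (λ v∈ → inj₂ (≤-trans (≰⇒> r≰s) (high v∈))) (≤-reflexive (sym c+s≡p)) refl pt
          with split {R} pm eq′ u′ sub len _ ← split-closed u ptP closed
          with length P ≤? suc r
      -- A component no larger than the residue is taken out of the K_r. A larger one, below, is
      -- taken out of a K_p, whose remaining y vertices join the residue.
      ... | yes P≤r with x , refl-eq ← m≤n⇒∃[o]m+o≡n P≤r = begin
          e S ≡⟨ eq′ ⟩
          e P + e R ≤⟨ +-mono-≤ (e≤tri P) (faudree-schelp N R (suc q) x
             (s≤s⁻¹ (≤-trans (+-monoˡ-≤ (length R) pos) (≤-trans (≤-reflexive (sym len)) le)))
             (+-cancelˡ-≡ (length P) _ _ (trans (sym len) (trans eq (trans (cong (suc q * p +_) (sym refl-eq)) (lemma (suc q * p) (length P) x)))))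
             (≤-trans (≤-trans (m≤n+m x (length P)) (≤-reflexive refl-eq)) r≤) u′ (NoPath-⊆ sub noPath)) ⟩
          tri (length P) + (suc q * p * j + tri x) ≡⟨ lemma (tri (length P)) (suc q * p * j) (tri x) ⟩
          suc q * p * j + (tri (length P) + tri x) ≤⟨ +-monoʳ-≤ (suc q * p * j) (m≤m+n _ _) ⟩
          suc q * p * j + (tri (length P) + tri x + length P * x) ≡⟨ cong (suc q * p * j +_) (tri-+ (length P) x) ⟨
          suc q * p * j + tri (length P + x) ≡⟨ cong (λ z → suc q * p * j + tri z) refl-eq ⟩
          suc q * p * j + tri (suc r) ∎
        where open ≤-Reasoning
              lemma : ∀ a b c → a + (b + c) ≡ b + (a + c)
              lemma = solve-∀
      ... | no P≰r with x , eqx ← m≤n⇒∃[o]m+o≡n (<⇒≤ (≰⇒> P≰r)) with y , eqy ← m≤n⇒∃[o]m+o≡n (noPath P ptP) = begin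
          e S ≡⟨ eq′ ⟩
          e P + e R ≤⟨ +-mono-≤ (e≤tri P) (faudree-schelp N R q (suc r + y)
             (s≤s⁻¹ (≤-trans (+-monoˡ-≤ (length R) pos) (≤-trans (≤-reflexive (sym len)) le)))
             (+-cancelˡ-≡ (length P) _ _ (trans (sym len) (trans eq (trans (cong (λ z → z + q * p + suc r) (sym eqy)) (lemma′ (length P) y (q * p) (suc r))))))
             (≤-trans (+-monoˡ-≤ y (<⇒≤ (≰⇒> P≰r))) (≤-reflexive eqy)) u′ (NoPath-⊆ sub noPath)) ⟩
          tri (length P) + (q * p * j + tri (suc r + y)) ≡⟨ lemma (tri (length P)) (q * p * j) (tri (suc r + y)) ⟩
          q * p * j + (tri (length P) + tri (suc r + y)) ≡⟨ cong (λ z → q * p * j + (tri z + tri (suc r + y))) eqx ⟨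
          q * p * j + (tri (suc r + x) + tri (suc r + y)) ≤⟨ +-monoʳ-≤ (q * p * j) (tri-exchange (suc r) x y) ⟩
          q * p * j + (tri (suc r + x + y) + tri (suc r)) ≡⟨ cong (λ z → q * p * j + (tri z + tri (suc r))) (trans (cong (_+ y) eqx) eqy) ⟩
          q * p * j + (tri p + tri (suc r)) ≡⟨ cong (λ z → q * p * j + (z + tri (suc r))) (tri-edge j) ⟩
          q * p * j + (j * p + tri (suc r)) ≡⟨ lemma″ (q * p) j p (tri (suc r)) ⟩
          suc q * p * j + tri (suc r) ∎
        where open ≤-Reasoning
              lemma : ∀ a b c → a + (b + c) ≡ b + (a + c)
              lemma = solve-∀
              lemma′ : ∀ a y b r → a + y + b + r ≡ a + (b + (r + y))
              lemma′ = solve-∀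
              lemma″ : ∀ x j p a → x * j + (j * p + a) ≡ (p + x) * j + a
              lemma″ = solve-∀

      high-except : ∀ {S x v} → ¬ Any (λ v → v ≢ x × deg v S < j) S → j ≤ deg x S → v ∈ S → j ≤ deg v S
      high-except {S} {x} {v} none d v∈ with v ≟ x
      ... | yes refl = d
      ... | no v≢x = ≮⇒≥ λ lt → none (lose v∈ (v≢x , lt))

      -- Removing a vertex of degree < j gains 1 in the bound and costs x at most one neighbour.  Once no such
      -- vertex is left, a core is swallowed by a closed path, which is too short to contain x and splits off.
      high-degree-deficit : ∀ N S x t → length S ≤ N → t ≤ tri (suc j) → Unique S → NoPath p S → x ∈ S →
        p + t ≤ deg x S → e S + t ≤ j * length S
      high-degree-deficit N S x zero le t≤ u noPath x∈ d = ≤-trans (≤-reflexive (+-identityʳ _)) (erdős-gallai N S le u noPath)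
      high-degree-deficit zero [] x (suc t) le t≤ u noPath () d
      high-degree-deficit (suc N) S x (suc t) le t≤ u noPath x∈ d with any? (λ v → ¬? (v ≟ x) ×-dec (suc (deg v S) ≤? j)) S
      ... | yes found with v , v∈ , v≢x , d< ← find found with removed {S′} pm eq′ u′ sub ← remove u v∈ = begin
          e S + suc t ≡⟨ trans (cong (_+ suc t) eq′) (lemma (deg v S) (e S′) t) ⟩
          suc (deg v S) + (e S′ + t) ≤⟨ +-mono-≤ d< (high-degree-deficit N S′ x t (s≤s⁻¹ (≤-trans (≤-reflexive (sym (↭-length pm))) le))
              (<⇒≤ t≤) u′ (NoPath-⊆ sub noPath) (∈-uncons pm x∈ (v≢x ∘ sym))
              (s≤s⁻¹ (≤-trans (≤-reflexive (sym (+-suc p t))) (≤-trans d (≤-trans (≤-reflexive (count-↭ (E? x) pm)) (count-cons-≤ (E? x) v S′)))))) ⟩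
          j + j * length S′ ≡⟨ *-suc j _ ⟨
          j * suc (length S′) ≡⟨ cong (j *_) (↭-length pm) ⟨
          j * length S ∎
        where open ≤-Reasoning
              lemma : ∀ a b t → a + b + suc t ≡ suc a + (b + t)
              lemma = solve-∀
      ... | no none with degenerate-or-core (suc N) S le u noPath
              (≤-trans (≤-trans (≤-trans (m≤m+n j j) (n≤1+n _)) (m≤m+n p (suc t))) (≤-trans d (length-filter (E? x) S)))
      ... | inj₁ deficit = ≤-trans (+-monoʳ-≤ (e S) t≤) deficit
      -- A core has at least j + 2 vertices, so s ≤ j - 1, and the minimum degree j guaranteed by
      -- `none` exceeds s.
      ... | inj₂ (core {c} {C} pt h lg b) with s , c+s≡p ← m≤n⇒∃[o]m+o≡n (noPath _ pt)
          with P , ptP , closed , pos ← closed-path {j} {s} {p} {S} {c ∷ C} u noPath (unique pt) ≤-refl h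
                (λ v∈ → inj₂ (≤-trans (cancel-≤ (suc j) (+-suc (suc j) s) refl
                    (≤-trans (+-monoˡ-≤ s lg) (≤-trans (≤-reflexive c+s≡p) ≤-refl))) (high-except none (≤-trans (≤-trans (≤-trans (m≤m+n j j) (n≤1+n _)) (m≤m+n p (suc t))) d) v∈))) (≤-reflexive (sym c+s≡p)) refl pt
          with split {R} pm eq′ u′ sub len sep ← split-closed u ptP closed = begin
          e S + suc t ≡⟨ trans (cong (_+ suc t) eq′) (+-assoc (e P) _ _) ⟩
          e P + (e R + suc t) ≤⟨ +-mono-≤ (≤-trans (e≤tri P) (tri-≤ j (noPath P ptP))) (high-degree-deficit N R x (suc t)
              (s≤s⁻¹ (≤-trans (+-monoˡ-≤ (length R) pos) (≤-trans (≤-reflexive (sym len)) le))) t≤ u′ (NoPath-⊆ sub noPath) x∈R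
              (≤-trans d (≤-reflexive deg-x))) ⟩
          j * length P + j * length R ≡⟨ *-distribˡ-+ j (length P) _ ⟨
          j * (length P + length R) ≡⟨ cong (j *_) len ⟨
          j * length S ∎
        where
          open ≤-Reasoning
          x∉P : x ∉ P
          x∉P x∈P = contradiction (≤-trans d (unique-⊆-length (Unique.filter⁺ (E? x) u) λ w∈ → case ∈-filter⁻ (E? x) {xs = S} w∈ of
              λ (w∈S , ew) → closed x∈P w∈S ew)) (<⇒≱ (≤-<-trans (noPath P ptP) (m<m+n p (s≤s z≤n))))
          x∈R : x ∈ R
          x∈R with ∈-++⁻ P (∈-resp-↭ pm x∈)
          ... | inj₁ x∈P = contradiction x∈P x∉P
          ... | inj₂ x∈R = x∈R
          deg-x : deg x S ≡ deg x R
          deg-x = trans (count-↭ (E? x) pm) (trans (count-++ (E? x) P R)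
            (cong (λ l → length l + deg x R) (filter-none (E? x) (All.tabulate λ w∈ e → x∉P (closed w∈ x∈ (E-sym e))))))

-- Counting and sums

module _ {A : Set} where

  lookup-injective : ∀ {L : List A} → Unique L → ∀ {i k} → lookup L i ≡ lookup L k → i ≡ k
  lookup-injective (x# ∷ u) {zero} {zero} eq = refl
  lookup-injective {x ∷ L} (x# ∷ u) {zero} {suc k} eq = contradiction eq (All.lookup x# (∈-lookup k))
  lookup-injective {x ∷ L} (x# ∷ u) {suc i} {zero} eq = contradiction (sym eq) (All.lookup x# (∈-lookup i))
  lookup-injective (x# ∷ u) {suc i} {suc k} eq = cong suc (lookup-injective u eq)

  module _ {R : A → A → Set} where

    lookup-linked : ∀ {L : List A} → Linked R L → ∀ i k → toℕ k ≡ suc (toℕ i) → R (lookup L i) (lookup L k)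
    lookup-linked (r ∷ l) zero (suc zero) eq = r
    lookup-linked (r ∷ l) (suc i) (suc k) eq = lookup-linked l i k (suc-injective eq)
    lookup-linked [-] zero (suc ()) eq

    tabulate-linked : ∀ {m} (f : Fin m → A) → (∀ i k → toℕ k ≡ suc (toℕ i) → R (f i) (f k)) → Linked R (tabulate f)
    tabulate-linked {zero} f r = []
    tabulate-linked {suc zero} f r = [-]
    tabulate-linked {suc (suc m)} f r = r zero (suc zero) refl ∷ tabulate-linked (f ∘ suc) (λ i k eq → r (suc i) (suc k) (cong suc eq))

  lookup-consecutive : ∀ (xs : List A) u v ys → let L = xs ++ u ∷ v ∷ ys in
    ∃ λ i → ∃ λ k → toℕ k ≡ suc (toℕ i) × lookup L i ≡ u × lookup L k ≡ v
  lookup-consecutive [] u v ys = zero , suc zero , refl , refl , refl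
  lookup-consecutive (x ∷ xs) u v ys with i , k , eq , eqi , eqk ← lookup-consecutive xs u v ys =
    suc i , suc k , cong suc eq , eqi , eqk

  -- Serves as a zigzag path in a complete bipartite graph.
  alternate : List A → List A → List A
  alternate [] ws = []
  alternate (x ∷ xs) [] = []
  alternate (x ∷ xs) (w ∷ ws) = x ∷ w ∷ alternate xs ws

  ∈-alternate : ∀ xs ws {v} → v ∈ alternate xs ws → v ∈ xs ⊎ v ∈ ws
  ∈-alternate (x ∷ xs) (w ∷ ws) (here eq) = inj₁ (here eq)
  ∈-alternate (x ∷ xs) (w ∷ ws) (there (here eq)) = inj₂ (here eq)
  ∈-alternate (x ∷ xs) (w ∷ ws) (there (there v∈)) with ∈-alternate xs ws v∈
  ... | inj₁ v∈xs = inj₁ (there v∈xs)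
  ... | inj₂ v∈ws = inj₂ (there v∈ws)

  Unique-alternate : ∀ {xs ws} → Unique xs → Unique ws → (∀ {v} → v ∈ xs → v ∉ ws) → Unique (alternate xs ws)
  Unique-alternate [] _ _ = []
  Unique-alternate (x# ∷ ux) [] _ = []
  Unique-alternate {x ∷ xs} {w ∷ ws} (x# ∷ ux) (w# ∷ uw) dis =
    ((λ { refl → dis (here refl) (here refl) }) ∷ All.tabulate (λ v∈ → λ { refl → case ∈-alternate xs ws v∈ of λ
       { (inj₁ p) → All.lookup x# p refl ; (inj₂ q) → dis (here refl) (there q) } }))
    ∷ All.tabulate (λ v∈ → λ { refl → case ∈-alternate xs ws v∈ of λ
       { (inj₁ p) → dis (there p) (here refl) ; (inj₂ q) → All.lookup w# q refl } })
    ∷ Unique-alternate ux uw (λ p q → dis (there p) (there q))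

  Linked-alternate : ∀ {R : A → A → Set} xs ws → (∀ {x w} → x ∈ xs → w ∈ ws → R x w × R w x) → Linked R (alternate xs ws)
  Linked-alternate [] ws r = []
  Linked-alternate (x ∷ xs) [] r = []
  Linked-alternate (x ∷ []) (w ∷ ws) r = proj₁ (r (here refl) (here refl)) ∷ [-]
  Linked-alternate (x ∷ x′ ∷ xs) (w ∷ []) r = proj₁ (r (here refl) (here refl)) ∷ [-]
  Linked-alternate (x ∷ x′ ∷ xs) (w ∷ w′ ∷ ws) r = proj₁ (r (here refl) (here refl)) ∷ proj₂ (r (there (here refl)) (here refl))
    ∷ Linked-alternate (x′ ∷ xs) (w′ ∷ ws) (λ p q → r (there p) (there q))

  length-alternate : ∀ k xs ws → k ≤ length xs → k ≤ length ws → k + k ≤ length (alternate xs ws)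
  length-alternate zero xs ws _ _ = z≤n
  length-alternate (suc k) (x ∷ xs) (w ∷ ws) (s≤s p) (s≤s q) = s≤s (≤-trans (≤-reflexive (+-suc k k)) (s≤s (length-alternate k xs ws p q)))

Sum : {A : Set} → (A → ℕ) → List A → ℕ
Sum f xs = sum (map f xs)

indicator : ∀ {P : Set} → Dec P → ℕ
indicator (yes _) = 1
indicator (no _) = 0

module _ {A : Set} where

  Sum-mono : ∀ {f g : A → ℕ} xs → (∀ {x} → x ∈ xs → f x ≤ g x) → Sum f xs ≤ Sum g xs
  Sum-mono [] _ = z≤n
  Sum-mono (x ∷ xs) h = +-mono-≤ (h (here refl)) (Sum-mono xs (h ∘ there))

  Sum-+ : ∀ (f g : A → ℕ) xs → Sum (λ x → f x + g x) xs ≡ Sum f xs + Sum g xs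
  Sum-+ f g [] = refl
  Sum-+ f g (x ∷ xs) = trans (cong (f x + g x +_) (Sum-+ f g xs)) (lemma (f x) (g x) (Sum f xs) (Sum g xs))
    where lemma : ∀ a b c d → a + b + (c + d) ≡ a + c + (b + d)
          lemma = solve-∀

  Sum-*ʳ : ∀ (f : A → ℕ) c xs → Sum (λ x → f x * c) xs ≡ Sum f xs * c
  Sum-*ʳ f c [] = refl
  Sum-*ʳ f c (x ∷ xs) = trans (cong (f x * c +_) (Sum-*ʳ f c xs)) (sym (*-distribʳ-+ c (f x) _))

  Sum-const : ∀ c (xs : List A) → Sum (λ _ → c) xs ≡ length xs * c
  Sum-const c [] = refl
  Sum-const c (x ∷ xs) = cong (c +_) (Sum-const c xs)

  count-Sum : ∀ {P : A → Set} (P? : Decidable P) xs → count P? xs ≡ Sum (indicator ∘ P?) xs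
  count-Sum P? [] = refl
  count-Sum P? (x ∷ xs) with P? x
  ... | yes _ = cong suc (count-Sum P? xs)
  ... | no _ = count-Sum P? xs

  count-complement : ∀ {P : A → Set} (P? : Decidable P) xs → count P? xs + count (¬? ∘ P?) xs ≡ length xs
  count-complement P? [] = refl
  count-complement P? (x ∷ xs) with P? x
  ... | yes _ = cong suc (count-complement P? xs)
  ... | no _ = trans (+-suc _ _) (cong suc (count-complement P? xs))

Sum-zero : ∀ {A : Set} (xs : List A) → Sum (λ _ → 0) xs ≡ 0
Sum-zero [] = refl
Sum-zero (x ∷ xs) = Sum-zero xs

Sum-swap : ∀ {A B : Set} (f : A → B → ℕ) xs ys → Sum (λ x → Sum (f x) ys) xs ≡ Sum (λ y → Sum (λ x → f x y) xs) ys
Sum-swap f [] ys = sym (Sum-zero ys)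
Sum-swap f (x ∷ xs) ys = trans (cong (Sum (f x) ys +_) (Sum-swap f xs ys)) (sym (Sum-+ (f x) (λ y → Sum (λ z → f z y) xs) ys))

Sum-cong : ∀ {A : Set} {f g : A → ℕ} xs → (∀ x → f x ≡ g x) → Sum f xs ≡ Sum g xs
Sum-cong [] _ = refl
Sum-cong (x ∷ xs) h = cong₂ _+_ (h x) (Sum-cong xs h)

count-swap : ∀ {A B : Set} {P : A → B → Set} (P? : ∀ x → Decidable (P x)) xs ys →
  Sum (λ x → count (P? x) ys) xs ≡ Sum (λ y → count (λ x → P? x y) xs) ys
count-swap P? xs ys = trans (Sum-cong xs λ x → count-Sum (P? x) ys) (trans (Sum-swap (λ x y → indicator (P? x y)) xs ys)
  (Sum-cong ys λ y → sym (count-Sum (λ x → P? x y) xs)))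

length-allFin : ∀ m → length (allFin m) ≡ m
length-allFin m = length-tabulate id

count-one : ∀ {m} (k : Fin m) → count (k ≟_) (allFin m) ≡ 1
count-one {m} k = ≤-antisym
  (unique-⊆-length {ys = [ k ]} (Unique.filter⁺ (k ≟_) (Unique.allFin⁺ m)) λ i∈ → here (sym (proj₂ (∈-filter⁻ (k ≟_) {xs = allFin m} i∈))))
  (unique-⊆-length {xs = [ k ]} ([] ∷ []) λ { (here refl) → ∈-filter⁺ (k ≟_) (∈-allFin k) refl })

Sum-fibres : ∀ {A : Set} {m} (f : A → Fin m) xs → Sum (λ i → count (λ x → f x ≟ i) xs) (allFin m) ≡ length xs
Sum-fibres {m = m} f xs = trans (count-swap (λ i x → f x ≟ i) (allFin m) xs)
  (trans (Sum-cong {g = λ _ → 1} xs (λ x → count-one (f x))) (trans (Sum-const 1 xs) (*-identityʳ _)))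

pigeonhole : ∀ {A : Set} {m} → 0 < m → (f : A → Fin m) → ∀ xs → ∃ λ i → length xs ≤ m * count (λ x → f x ≟ i) xs
pigeonhole {m = suc m} _ f xs with any? (λ i → length xs ≤? suc m * count (λ x → f x ≟ i) xs) (allFin (suc m))
... | yes found = let i , _ , le = find found in i , le
... | no none = contradiction total (<⇒≱ (begin-strict
    suc m * length xs ≡⟨ cong (suc m *_) (Sum-fibres f xs) ⟨
    suc m * Sum c (allFin (suc m)) ≡⟨ *-comm (suc m) _ ⟩
    Sum c (allFin (suc m)) * suc m ≡⟨ Sum-*ʳ c (suc m) (allFin (suc m)) ⟨
    Sum (λ i → c i * suc m) (allFin (suc m)) <⟨ m<n+m _ {suc m} (s≤s z≤n) ⟩
    suc m + Sum (λ i → c i * suc m) (allFin (suc m)) ≡⟨ cong (_+ Sum (λ i → c i * suc m) (allFin (suc m))) (trans (Sum-const 1 (allFin (suc m))) (trans (*-identityʳ _) (length-allFin (suc m)))) ⟨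
    Sum (λ _ → 1) (allFin (suc m)) + Sum (λ i → c i * suc m) (allFin (suc m)) ≡⟨ Sum-+ (λ _ → 1) (λ i → c i * suc m) (allFin (suc m)) ⟨
    Sum (λ i → suc (c i * suc m)) (allFin (suc m)) ∎))
  where
  open ≤-Reasoning
  c : Fin (suc m) → ℕ
  c i = count (λ x → f x ≟ i) xs
  total : Sum (λ i → suc (c i * suc m)) (allFin (suc m)) ≤ suc m * length xs
  total = ≤-trans (Sum-mono (allFin (suc m)) λ {i} i∈ → ≤-trans (≤-reflexive (cong suc (*-comm (c i) (suc m)))) (≰⇒> λ le → none (lose i∈ le)))
    (≤-reflexive (trans (Sum-const (length xs) (allFin (suc m))) (cong (_* length xs) (length-allFin (suc m)))))

ascending-allFin : ∀ n → AllPairs (λ u v → toℕ u < toℕ v) (allFin n)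
ascending-allFin n = go id (λ lt → lt)
  where go : ∀ {m} (f : Fin m → Fin n) → (∀ {i k} → toℕ i < toℕ k → toℕ (f i) < toℕ (f k)) → AllPairs (λ u v → toℕ u < toℕ v) (tabulate f)
        go {zero} f mono = []
        go {suc m} f mono = All.tabulate (λ v∈ → case ∈-tabulate⁻ v∈ of λ { (i , refl) → mono (s≤s z≤n) }) ∷ go (f ∘ suc) (mono ∘ s≤s)

-- Edges as ordered pairs of vertices

module Edges {n : ℕ} (G : SimpleGraph (Fin n)) where
  open SimpleGraph G
  open OnGraph _≟_ G

  Ascending : List (Fin n) → Set
  Ascending = AllPairs (λ u v → toℕ u < toℕ v)

  edges : List (Fin n) → List (Fin n × Fin n)
  edges [] = []
  edges (v ∷ S) = map (v ,_) (filter (E? v) S) ++ edges S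

  length-edges : ∀ S → length (edges S) ≡ e S
  length-edges [] = refl
  length-edges (v ∷ S) = trans (length-++ (map (v ,_) (filter (E? v) S))) (cong₂ _+_ (length-map (v ,_) (filter (E? v) S)) (length-edges S))

  ∈-edges⁺ : ∀ {S u v} → Ascending S → u ∈ S → v ∈ S → toℕ u < toℕ v → E u v → (u , v) ∈ edges S
  ∈-edges⁺ asc (here refl) (here refl) lt _ = contradiction refl (<⇒≢ lt)
  ∈-edges⁺ (_ ∷ asc) (here refl) (there v∈) lt ev = ∈-++⁺ˡ (∈-map⁺ _ (∈-filter⁺ (E? _) v∈ ev))
  ∈-edges⁺ (v< ∷ asc) (there u∈) (here refl) lt ev = contradiction lt (<-asym (All.lookup v< u∈))
  ∈-edges⁺ {x ∷ S} (_ ∷ asc) (there u∈) (there v∈) lt ev = ∈-++⁺ʳ (map (x ,_) (filter (E? x) S)) (∈-edges⁺ asc u∈ v∈ lt ev)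

  ∈-edges⁻ : ∀ {S u v} → Ascending S → (u , v) ∈ edges S → u ∈ S × v ∈ S × toℕ u < toℕ v × E u v
  ∈-edges⁻ {x ∷ S} (x< ∷ asc) uv∈ with ∈-++⁻ (map (x ,_) (filter (E? x) S)) uv∈
  ... | inj₂ in-rest = let u∈ , v∈ , lt , ev = ∈-edges⁻ asc in-rest in there u∈ , there v∈ , lt , ev
  ... | inj₁ first with ∈-map⁻ (x ,_) first
  ... | _ , v∈′ , refl = let v∈ , ev = ∈-filter⁻ (E? x) {xs = S} v∈′ in here refl , there v∈ , All.lookup x< v∈ , ev

  Unique-edges : ∀ {S} → Ascending S → Unique (edges S)
  Unique-edges [] = []
  Unique-edges {x ∷ S} (x< ∷ asc) = Unique.++⁺ (Unique.map⁺ (λ { refl → refl })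
      (Unique.filter⁺ (E? x) (AllPairs.map (λ lt → λ { refl → contradiction refl (<⇒≢ lt) }) asc))) (Unique-edges asc)
    λ { (first , in-rest) → case ∈-map⁻ (x ,_) first of λ { (_ , _ , refl) →
        contradiction refl (<⇒≢ (All.lookup x< (proj₁ (∈-edges⁻ asc in-rest)))) } }

  length-≤-e : ∀ {S ps} → Ascending S → Unique ps →
    (∀ {u v} → (u , v) ∈ ps → toℕ u < toℕ v × E u v × u ∈ S × v ∈ S) → length ps ≤ e S
  length-≤-e {S} asc u h = ≤-trans (unique-⊆-length u λ uv∈ → let lt , ev , u∈ , v∈ = h uv∈ in ∈-edges⁺ asc u∈ v∈ lt ev)
    (≤-reflexive (length-edges S))

-- The adjacency of a `Graph` may hold on the diagonal, so loops are cut out here.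
graphOf : ∀ {n} → Graph n → SimpleGraph (Fin n)
graphOf G = record
  { E = λ u v → u ≢ v × adj G u v ≡ true
  ; E? = λ u v → ¬? (u ≟ v) ×-dec (adj G u v Data.Bool.≟ true)
  ; E-sym = λ {u} {v} (ne , a) → (ne ∘ sym) , trans (Graph.sym G v u) a
  ; E-irr = λ (ne , _) → ne refl
  }

module _ {n} (G : Graph n) where
  open OnGraph _≟_ (graphOf G)
  open Edges (graphOf G)

  private
    chosen : Fin n × Fin n → Bool
    chosen q = (toℕ (proj₁ q) <ᵇ toℕ (proj₂ q)) ∧ adj G (proj₁ q) (proj₂ q)

    pairs : List (Fin n × Fin n)
    pairs = cartesianProduct (allFin n) (allFin n)

  edgeCount≡e : edgeCount G ≡ e (allFin n)
  edgeCount≡e = ≤-antisym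
    (length-≤-e (ascending-allFin n) (Unique.filter⁺ (T? ∘ chosen) (Unique.cartesianProduct⁺ (Unique.allFin⁺ n) (Unique.allFin⁺ n)))
      λ {u} {v} uv∈ → let _ , t = ∈-filter⁻ (T? ∘ chosen) {xs = pairs} uv∈
                          t₁ , t₂ = Equivalence.to T-∧ t
                          lt = <ᵇ⇒< (toℕ u) (toℕ v) t₁
                      in lt , ((λ { refl → <-irrefl refl lt }) , Equivalence.to T-≡ t₂) , ∈-allFin u , ∈-allFin v)
    (≤-trans (≤-reflexive (sym (length-edges (allFin n)))) (unique-⊆-length (Unique-edges (ascending-allFin n))
      λ { {u , v} uv∈ → let _ , _ , lt , (_ , a) = ∈-edges⁻ (ascending-allFin n) uv∈ in
        ∈-filter⁺ (T? ∘ chosen) (∈-cartesianProduct⁺ (∈-allFin u) (∈-allFin v)) (Equivalence.from T-∧ (<⇒<ᵇ lt , Equivalence.from T-≡ a)) }))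
    where open import Data.Bool.Properties using (T?)

  noPath-of-graph : ∀ {m} → ¬ ContainsPath (suc m) G → NoPath m (allFin n)
  noPath-of-graph {m} none P (path u l _) = ≮⇒≥ λ lt → none (truncated lt)
    where
    truncated : suc m ≤ length P → ContainsPath (suc m) G
    truncated le = subst (λ k → ContainsPath k G) (trans (length-take (suc m) P) (m≤n⇒m⊓n≡m le))
      (lookup Q , lookup-injective uQ , λ i k eq → proj₂ (lookup-linked lQ i k eq))
      where Q = take (suc m) P
            uQ = Unique.take⁺ (suc m) u
            lQ = Linked-++ˡ Q (subst (Linked _) (sym (take++drop≡id (suc m) P)) l)

-- Upper bound

module _ {r n} (c : Colouring r n) where

  colourGraph : Fin r → SimpleGraph (Fin n)
  colourGraph i = record
    { E = λ u v → u ≢ v × col c u v ≡ i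
    ; E? = λ u v → ¬? (u ≟ v) ×-dec (col c u v ≟ i)
    ; E-sym = λ {u} {v} (ne , eq) → (ne ∘ sym) , trans (col-sym c v u) eq
    ; E-irr = λ (ne , _) → ne refl
    }

  MonoPath : Fin r → List (Fin n) → Set
  MonoPath i L = Unique L × Linked (SimpleGraph.E (colourGraph i)) L

  InMonoPath-sym : ∀ {m u v} → InMonoPath c m u v → InMonoPath c m v u
  InMonoPath-sym (κ , f , isPath , i , k , eq , inj₁ uv) = κ , f , isPath , i , k , eq , inj₂ uv
  InMonoPath-sym (κ , f , isPath , i , k , eq , inj₂ vu) = κ , f , isPath , i , k , eq , inj₁ vu

  inMonoPath : ∀ {i m} xs u v ys → MonoPath i (xs ++ u ∷ v ∷ ys) → length (xs ++ u ∷ v ∷ ys) ≡ m → InMonoPath c m u v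
  inMonoPath {i} xs u v ys (uL , lL) refl with a , b , eq , eqa , eqb ← lookup-consecutive xs u v ys =
    i , lookup (xs ++ u ∷ v ∷ ys) , (lookup-injective uL , λ a b eq → proj₂ (lookup-linked lL a b eq)) , a , b , eq , inj₁ (eqa , eqb)

  -- If y′ lies on the path, rotate the path so that y y′ becomes one of its edges;
  -- otherwise put y′ in front of y and drop the last vertex.
  edge-at-path-end : ∀ {i k y y′ l} → SimpleGraph.E (colourGraph i) y y′ → MonoPath i (y ∷ l) →
    2 ≤ k → k ≤ length (y ∷ l) → InMonoPath c k y y′
  edge-at-path-end {i} {suc (suc m)} {y} {y′} {l} ey (uL , lL) (s≤s (s≤s _)) (s≤s le) = go (y′ ∈? l′)
    where
    open import Data.List.Membership.DecPropositional {A = Fin n} _≟_ using (_∈?_)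
    l′ = take (suc m) l
    len : length l′ ≡ suc m
    len = trans (length-take (suc m) l) (m≤n⇒m⊓n≡m le)
    u′ : Unique (y ∷ l′)
    u′ = Unique.take⁺ (suc (suc m)) uL
    lk′ : Linked _ (y ∷ l′)
    lk′ = Linked-++ˡ (y ∷ l′) (subst (λ z → Linked _ (y ∷ z)) (sym (take++drop≡id (suc m) l)) lL)
    go : Dec (y′ ∈ l′) → InMonoPath c (suc (suc m)) y y′
    go (yes y′∈) with ∈-∃++ y′∈
    ... | zs , ys , eq = inMonoPath (reverse zs) y y′ ys
        (subst Unique form (Unique-resp pm (subst (λ z → Unique (y ∷ z)) eq u′)) ,
         subst (Linked _) form (Linked-ʳ++ (SimpleGraph.E-sym (colourGraph i)) y zs (Linked-++ˡ (y ∷ zs) lk″) (ey ∷ Linked-++ʳ (y ∷ zs) lk″)))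
        (trans (cong length (sym form)) (trans (sym (↭-length pm)) (cong suc (trans (cong length (sym eq)) len))))
      where form = ʳ++-defn zs {y ∷ y′ ∷ ys}
            pm : y ∷ zs ++ y′ ∷ ys ↭ zs ʳ++ (y ∷ y′ ∷ ys)
            pm = ++↭ʳ++ (y ∷ zs) (y′ ∷ ys)
            lk″ = subst (λ z → Linked _ (y ∷ z)) eq lk′
    go (no y′∉) = InMonoPath-sym (inMonoPath [] y′ y (take m l′)
        (All.tabulate fresh ∷ Unique.take⁺ (suc m) u′ , SimpleGraph.E-sym (colourGraph i) ey ∷
          Linked-++ˡ (y ∷ take m l′) (subst (λ z → Linked _ (y ∷ z)) (sym (take++drop≡id m l′)) lk′))
        (cong (λ z → ℕ.suc (ℕ.suc z)) (trans (length-take m l′) (m≤n⇒m⊓n≡m (≤-trans (n≤1+n m) (≤-reflexive (sym len)))))))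
      where fresh : ∀ {x} → x ∈ y ∷ take m l′ → y′ ≢ x
            fresh (here refl) eq = proj₁ ey (sym eq)
            fresh (there x∈) refl = y′∉ (subst (_ ∈_) (take++drop≡id m l′) (∈-++⁺ˡ x∈))

-- NIM-edges counted through the sets Y_i

module UpperBound (j p m n : ℕ) (p≡ : p ≡ suc (j + j)) (m≡ : m ≡ suc p)
  (c : Colouring m n) (es : List (Fin n × Fin n)) (nim : NIMList c m es) where

  module H (i : Fin m) = OnGraph _≟_ (colourGraph c i)

  Covered : Fin m → Fin n → Set
  Covered i v = Any (λ q → col c (proj₁ q) (proj₂ q) ≡ i × (proj₁ q ≡ v ⊎ proj₂ q ≡ v)) es

  covered? : ∀ i → Decidable (Covered i)
  covered? i v = any? (λ q → (col c (proj₁ q) (proj₂ q) ≟ i) ×-dec ((proj₁ q ≟ v) ⊎-dec (proj₂ q ≟ v))) es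

  2≤m : 2 ≤ m
  2≤m = ≤-trans (s≤s (≤-trans (s≤s z≤n) (≤-reflexive (sym p≡)))) (≤-reflexive (sym m≡))

  m≤ : ∀ {x} → p < x → m ≤ x
  m≤ lt = ≤-trans (≤-reflexive m≡) lt

  -- Only the first vertex has to be covered; the rest of the path may leave Y_i. This makes the
  -- bound available for paths that run through W.
  covered-end : ∀ {i v l} → Covered i v → MonoPath c i (v ∷ l) → length (v ∷ l) ≤ p
  covered-end cov mp = ≮⇒≥ λ lt → case find cov of λ ((u , w) , q∈ , eq , ends) →
    let u<w , isNIM = All.lookup (proj₂ nim) q∈
        u≢w = λ (u≡w : u ≡ w) → <⇒≢ u<w (cong toℕ u≡w)
    in case ends of λ
      { (inj₁ refl) → isNIM (edge-at-path-end c (u≢w , eq) mp 2≤m (m≤ lt))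
      ; (inj₂ refl) → isNIM (InMonoPath-sym c (edge-at-path-end c (u≢w ∘ sym , trans (col-sym c w u) eq) mp 2≤m (m≤ lt))) }

  -- The set Y_i.
  cover : Fin m → List (Fin n)
  cover i = filter (covered? i) (allFin n)

  Unique-cover : ∀ i → Unique (cover i)
  Unique-cover i = Unique.filter⁺ (covered? i) (Unique.allFin⁺ n)

  ∈-cover⁺ : ∀ {i v} → Covered i v → v ∈ cover i
  ∈-cover⁺ {i} {v} cov = ∈-filter⁺ (covered? i) (∈-allFin v) cov

  ∈-cover⁻ : ∀ {i v} → v ∈ cover i → Covered i v
  ∈-cover⁻ {i} v∈ = proj₂ (∈-filter⁻ (covered? i) {xs = allFin n} v∈)

  cover-noPath : ∀ i → H.NoPath i p (cover i)
  cover-noPath i [] _ = z≤n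
  cover-noPath i (v ∷ P) pt = covered-end (∈-cover⁻ (OnGraph.inside pt (here refl))) (OnGraph.unique pt , OnGraph.linked pt)

  length-es : length es ≤ Sum (λ i → H.e i (cover i)) (allFin m)
  length-es = ≤-trans (≤-reflexive (sym (Sum-fibres colour es))) (Sum-mono (allFin m) λ {i} _ →
    Edges.length-≤-e (colourGraph c i) (AllPairsₚ.filter⁺ (covered? i) (ascending-allFin n))
      (Unique.filter⁺ (λ q → colour q ≟ i) (proj₁ nim)) λ q∈ → case ∈-filter⁻ (λ q → colour q ≟ i) {xs = es} q∈ of λ (q∈es , eq) →
        let u<v = proj₁ (All.lookup (proj₂ nim) q∈es) in
        u<v , ((λ u≡v → <⇒≢ u<v (cong toℕ u≡v)) , eq) , ∈-cover⁺ (lose q∈es (eq , inj₁ refl)) , ∈-cover⁺ (lose q∈es (eq , inj₂ refl)))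
    where
    colour : Fin n × Fin n → Fin m
    colour q = col c (proj₁ q) (proj₂ q)

  multiplicity : Fin n → ℕ
  multiplicity v = count (λ i → covered? i v) (allFin m)

  full? : Decidable (λ v → m ≤ multiplicity v)
  full? v = m ≤? multiplicity v

  thin? : Decidable (λ v → multiplicity v < p)
  thin? v = suc (multiplicity v) ≤? p

  -- `full` is the set X. A `thin` vertex misses at least two colours, hence lies in at least one
  -- Y_i fewer than the p which the count allows it.
  full thin : List (Fin n)
  full = filter full? (allFin n)
  thin = filter thin? (allFin n)

  sum-cover : Sum (λ i → length (cover i)) (allFin m) + length thin ≤ n * p + length full
  sum-cover = begin
    Sum (λ i → length (cover i)) (allFin m) + length thin ≡⟨ cong₂ _+_ (count-swap covered? (allFin m) (allFin n)) (count-Sum thin? (allFin n)) ⟩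
    Sum multiplicity (allFin n) + Sum (indicator ∘ thin?) (allFin n) ≡⟨ Sum-+ multiplicity (indicator ∘ thin?) (allFin n) ⟨
    Sum (λ v → multiplicity v + indicator (thin? v)) (allFin n) ≤⟨ Sum-mono (allFin n) (λ {v} _ → pointwise v) ⟩
    Sum (λ v → p + indicator (full? v)) (allFin n) ≡⟨ Sum-+ (λ _ → p) (indicator ∘ full?) (allFin n) ⟩
    Sum (λ _ → p) (allFin n) + Sum (indicator ∘ full?) (allFin n) ≡⟨ cong₂ _+_ (trans (Sum-const p (allFin n)) (cong (_* p) (length-allFin n))) (sym (count-Sum full? (allFin n))) ⟩
    n * p + length full ∎
    where
    open ≤-Reasoning
    pointwise : ∀ v → multiplicity v + indicator (thin? v) ≤ p + indicator (full? v)
    pointwise v with thin? v | full? v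
    ... | yes lt | yes ge = contradiction (≤-trans (n≤1+n p) (≤-trans (≤-reflexive (sym m≡)) ge)) (<⇒≱ lt)
    ... | yes lt | no _ = ≤-trans (≤-reflexive (+-comm _ 1)) (≤-trans lt (≤-reflexive (sym (+-identityʳ p))))
    ... | no _ | yes _ = ≤-trans (≤-reflexive (+-identityʳ _)) (≤-trans (length-filter (λ i → covered? i v) (allFin m)) (≤-reflexive (trans (length-allFin m) (trans m≡ (+-comm 1 p)))))
    ... | no _ | no ¬ge = +-monoˡ-≤ 0 (s≤s⁻¹ (≤-trans (≰⇒> ¬ge) (≤-reflexive m≡)))

  full-covered : ∀ {v} → v ∈ full → ∀ i → Covered i v
  full-covered {v} v∈ i = decidable-stable (covered? i v) λ ¬cov → <⇒≱
    (filter-notAll (λ i → covered? i v) (allFin m) (lose (∈-allFin i) ¬cov))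
    (≤-trans (≤-reflexive (length-allFin m)) (proj₂ (∈-filter⁻ full? {xs = allFin n} v∈)))

  -- A second uncovered colour would bring the multiplicity down to m - 2 = p - 1.
  covered-but-one : ∀ {v} i → ¬ (multiplicity v < p) → ¬ Covered i v → ∀ {k} → k ≢ i → Covered k v
  covered-but-one {v} i ¬thin ¬i {k} k≢i = decidable-stable (covered? k v) λ ¬k → ¬thin (s≤s⁻¹ (≤-trans
    (unique-⊆-length {xs = i ∷ k ∷ filter (λ i → covered? i v) (allFin m)}
      (((k≢i ∘ sym) ∷ All.tabulate (λ x∈ → λ { refl → ¬i (here-covered x∈) })) ∷ All.tabulate (λ x∈ → λ { refl → ¬k (here-covered x∈) })
        ∷ Unique.filter⁺ (λ i → covered? i v) (Unique.allFin⁺ m)) (λ {x} _ → ∈-allFin x))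
    (≤-reflexive (trans (length-allFin m) m≡))))
    where here-covered : ∀ {x} → x ∈ filter (λ i → covered? i v) (allFin m) → Covered x v
          here-covered x∈ = proj₂ (∈-filter⁻ (λ i → covered? i v) {xs = allFin m} x∈)

  -- The value is arbitrary on vertices covered in every colour; it is relied on only outside
  -- `full`.
  missing : Fin n → Fin m
  missing v with any? (λ i → ¬? (covered? i v)) (allFin m)
  ... | yes found = proj₁ (find found)
  ... | no _ = Fin.fromℕ< 2≤m

  missing-uncovered : ∀ v → ¬ (m ≤ multiplicity v) → ¬ Covered (missing v) v
  missing-uncovered v ¬full with any? (λ i → ¬? (covered? i v)) (allFin m)
  ... | yes found = proj₂ (proj₂ (find found))
  ... | no none = contradiction (≤-reflexive (sym (trans (cong length (filter-all (λ i → covered? i v) {xs = allFin m}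
      (All.tabulate λ {i} i∈ → decidable-stable (covered? i v) λ ¬cov → none (lose i∈ ¬cov)))) (length-allFin m)))) ¬full

  tri-≤-Sum : ∀ {S} → Unique S → tri (length S) ≤ Sum (λ i → H.e i S) (allFin m)
  tri-≤-Sum [] = z≤n
  tri-≤-Sum {v ∷ S} (v# ∷ u) = ≤-trans (+-mono-≤ degrees (tri-≤-Sum u)) (≤-reflexive (sym (Sum-+ (λ i → H.deg i v S) (λ i → H.e i S) (allFin m))))
    where
    degrees : length S ≤ Sum (λ i → H.deg i v S) (allFin m)
    degrees = ≤-trans (≤-reflexive (sym (trans (Sum-const 1 S) (*-identityʳ _)))) (≤-trans (Sum-mono S λ {w} w∈ →
      unique-⊆-length {xs = [ col c v w ]} ([] ∷ []) λ { (here refl) → ∈-filter⁺ (λ i → E? i v w) (∈-allFin (col c v w)) (All.lookup v# w∈ , refl) })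
      (≤-reflexive (sym (count-swap (λ i → E? i v) (allFin m) S))))
      where E? = λ i → SimpleGraph.E? (colourGraph c i)

  -- If no colour had a long path inside W, the Erdős-Gallai bound in each colour would give w² ≤ (2
  -- m j + 1) w for w = |W|, while m² - 2 m j - 1 = 4j + 3 > 0. The path is given under a double
  -- negation only; its uses prove a contradiction or a decidable inequality.
  some-long-path : ∀ {W} → Unique W → m * m ≤ length W → ¬ (∀ κ P → H.Path κ W P → ¬ p < length P)
  some-long-path {W} u large none = contradiction (begin-strict
      length W * length W ≡⟨ tri-double (length W) ⟨
      tri (length W) + tri (length W) + length W ≤⟨ +-monoˡ-≤ (length W) (+-mono-≤ total total) ⟩
      m * (j * length W) + m * (j * length W) + length W <⟨ m<m+n _ {(4 * j + 3) * length W} (*-mono-≤ (≤-trans (s≤s z≤n) (m≤n+m 3 (4 * j))) pos) ⟩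
      m * (j * length W) + m * (j * length W) + length W + (4 * j + 3) * length W ≡⟨ lemma m j (length W) (trans m≡ (cong suc p≡)) ⟩
      m * m * length W ≤⟨ *-monoˡ-≤ (length W) large ⟩
      length W * length W ∎) (<-irrefl refl)
    where
    open ≤-Reasoning
    pos : 1 ≤ length W
    pos = ≤-trans (*-mono-≤ (<⇒≤ 2≤m) (<⇒≤ 2≤m)) large
    total : tri (length W) ≤ m * (j * length W)
    total = ≤-trans (tri-≤-Sum u) (≤-trans (Sum-mono (allFin m) λ {i} _ → H.erdős-gallai i j (length W) W ≤-refl u
        (subst (λ q → H.NoPath i q W) p≡ λ P pt → ≮⇒≥ (none i P pt)))
      (≤-reflexive (trans (Sum-const (j * length W) (allFin m)) (cong (_* (j * length W)) (length-allFin m)))))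
    lemma₁ : ∀ j w → suc (suc (j + j)) * (j * w) + suc (suc (j + j)) * (j * w) + w + (4 * j + 3) * w ≡ suc (suc (j + j)) * suc (suc (j + j)) * w
    lemma₁ = solve-∀
    lemma : ∀ m j w → m ≡ suc (suc (j + j)) → m * (j * w) + m * (j * w) + w + (4 * j + 3) * w ≡ m * m * w
    lemma _ j w refl = lemma₁ j w

  -- One pigeonhole step for each vertex of U, keeping at least the m-th part of the list.
  shrink : ∀ U W₀ → Unique W₀ → ∃ λ W → Unique W × (∀ {w} → w ∈ W → w ∈ W₀) ×
    (∀ {u} → u ∈ U → ∃ λ i → ∀ {w} → w ∈ W → col c u w ≡ i) × length W₀ ≤ m ^ length U * length W
  shrink [] W₀ uW = W₀ , uW , id , (λ ()) , ≤-reflexive (sym (*-identityˡ _))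
  shrink (u ∷ U) W₀ uW₀ with shrink U W₀ uW₀
  ... | W , uW , sub , mono , le with pigeonhole (<⇒≤ 2≤m) (col c u) W
  ... | i , le′ = filter (λ w → col c u w ≟ i) W , Unique.filter⁺ (λ w → col c u w ≟ i) uW
      , (λ w∈ → sub (proj₁ (∈-filter⁻ (λ w → col c u w ≟ i) {xs = W} w∈)))
      , (λ { (here refl) → i , (λ w∈ → proj₂ (∈-filter⁻ (λ w → col c u w ≟ i) {xs = W} w∈))
           ; (there u∈) → let k , h = mono u∈ in k , λ w∈ → h (proj₁ (∈-filter⁻ (λ w → col c u w ≟ i) {xs = W} w∈)) })
      , ≤-trans le (≤-trans (*-monoʳ-≤ (m ^ length U) le′) (≤-reflexive (lemma (m ^ length U) m (count (λ w → col c u w ≟ i) W))))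
    where lemma : ∀ a b d → a * (b * d) ≡ b * a * d
          lemma = solve-∀

  others : Fin m → Fin m → ℕ
  others κ i = indicator (¬? (κ ≟ i))

  Sum-others : ∀ κ → Sum (others κ) (allFin m) ≡ p
  Sum-others κ = suc-injective (trans (cong₂ _+_ (sym (count-one κ)) (sym (count-Sum (λ i → ¬? (κ ≟ i)) (allFin m))))
    (trans (count-complement (κ ≟_) (allFin m)) (trans (length-allFin m) m≡)))

  -- U is a parameter because there are two uses: p j + 1 vertices of `full`, to refute that there
  -- are so many, and then `full` itself.
  module Classes (U W : List (Fin n)) (uU : Unique U) (U-covered : ∀ {u} → u ∈ U → ∀ i → Covered i u) (uW : Unique W)
    (disjoint : ∀ {v} → v ∈ U → v ∉ W) (shade : Fin n → Fin m) (mono : ∀ {u w} → u ∈ U → w ∈ W → col c u w ≡ shade u)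
    (large : suc j ≤ length W) where

    class : Fin m → List (Fin n)
    class i = filter (λ u → shade u ≟ i) U

    ∈-class⁻ : ∀ {i u} → u ∈ class i → u ∈ U × shade u ≡ i
    ∈-class⁻ {i} = ∈-filter⁻ (λ u → shade u ≟ i) {xs = U}

    adjacent : ∀ {i u w} → u ∈ class i → w ∈ W → SimpleGraph.E (colourGraph c i) u w
    adjacent u∈ w∈ = let u∈U , eq = ∈-class⁻ u∈ in (λ { refl → disjoint u∈U w∈ }) , trans (mono u∈U w∈) eq

    -- Alternating j + 1 vertices of the class with j + 1 of W gives a path of colour i on 2j + 2 >
    -- p vertices that starts at a covered vertex.
    class-small : ∀ i → length (class i) ≤ j
    class-small i = ≮⇒≥ λ lt → <⇒≱ (≤-reflexive (cong suc (trans p≡ (sym (+-suc j j)))))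
      (bound (class i) W (Unique.filter⁺ (λ u → shade u ≟ i) uU) uW id id lt large)
      where
      bound : ∀ A B → Unique A → Unique B → (∀ {u} → u ∈ A → u ∈ class i) → (∀ {w} → w ∈ B → w ∈ W) →
        suc j ≤ length A → suc j ≤ length B → suc j + suc j ≤ p
      bound (a ∷ A) (b ∷ B) uA uB A⊆ B⊆ leA leB = ≤-trans (length-alternate (suc j) (a ∷ A) (b ∷ B) leA leB)
        (covered-end (U-covered (proj₁ (∈-class⁻ (A⊆ (here refl)))) i)
          (Unique-alternate uA uB (λ u∈ w∈ → disjoint (proj₁ (∈-class⁻ (A⊆ u∈))) (B⊆ w∈))
          , Linked-alternate (a ∷ A) (b ∷ B) λ u∈ w∈ → let ad = adjacent (A⊆ u∈) (B⊆ w∈) in ad , SimpleGraph.E-sym (colourGraph c i) ad))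

    -- A vertex that sees W in colour κ could be put in front of the long path, which would then
    -- start at a covered vertex.
    class-empty : ∀ {κ P} → H.Path κ W P → p < length P → ∀ {u} → u ∉ class κ
    class-empty {P = v ∷ P} pt lt {u} u∈ = contradiction (covered-end (U-covered (proj₁ (∈-class⁻ u∈)) _)
        (All.tabulate (λ x∈ → λ { refl → disjoint (proj₁ (∈-class⁻ u∈)) (OnGraph.inside pt x∈) }) ∷ OnGraph.unique pt
        , adjacent u∈ (OnGraph.inside pt (here refl)) ∷ OnGraph.linked pt))
      (<⇒≱ (<-trans lt (n<1+n _)))

    class-bound : ∀ {κ P} → H.Path κ W P → p < length P → ∀ i → length (class i) ≤ others κ i * j
    class-bound {κ} pt lt i with κ ≟ i
    ... | no _ = ≤-trans (class-small i) (≤-reflexive (sym (*-identityˡ j)))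
    ... | yes refl with class κ | class-empty pt lt
    ... | [] | _ = z≤n
    ... | u ∷ _ | empty = contradiction (here refl) empty

    length-U : ∀ {κ P} → H.Path κ W P → p < length P → length U ≤ p * j
    length-U {κ} pt lt = begin
      length U ≡⟨ Sum-fibres shade U ⟨
      Sum (λ i → length (class i)) (allFin m) ≤⟨ Sum-mono (allFin m) (λ {i} _ → class-bound pt lt i) ⟩
      Sum (λ i → others κ i * j) (allFin m) ≡⟨ Sum-*ʳ (others κ) j (allFin m) ⟩
      Sum (others κ) (allFin m) * j ≡⟨ cong (_* j) (Sum-others κ) ⟩
      p * j ∎
      where open ≤-Reasoning

  private
    D : ℕ
    D = tri (suc j)

  D≤jj : D ≤ j * j
  D≤jj = ≤-trans (m≤n+m D (tri j)) (≤-reflexive (tri+tri-suc j))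

  p*suc-j≤mm : p * suc j + suc j ≤ m * m
  p*suc-j≤mm = begin
    p * suc j + suc j ≡⟨ +-comm _ (suc j) ⟩
    suc p * suc j ≡⟨ cong (_* suc j) m≡ ⟨
    m * suc j ≤⟨ *-monoʳ-≤ m (≤-trans (s≤s (≤-trans (m≤m+n j j) (n≤1+n _))) (≤-reflexive (sym (trans m≡ (cong suc p≡))))) ⟩
    m * m ∎
    where open ≤-Reasoning

  p+D≤mm : p + D ≤ m * m
  p+D≤mm = ≤-trans (+-mono-≤ (≤-reflexive p≡) D≤jj) (≤-trans (≤-trans (m≤m+n _ (3 * (j * j) + 6 * j + 3)) (≤-reflexive (lemma j)))
      (≤-reflexive (sym (cong₂ _*_ m≡′ m≡′))))
    where m≡′ = trans m≡ (cong suc p≡)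
          lemma : ∀ j → suc (j + j) + j * j + (3 * (j * j) + 6 * j + 3) ≡ suc (suc (j + j)) * suc (suc (j + j))
          lemma = solve-∀

  cover-bound : ∀ i → H.e i (cover i) ≤ length (cover i) * j
  cover-bound i = ≤-trans (H.erdős-gallai i j _ (cover i) ≤-refl (Unique-cover i) (subst (λ q → H.NoPath i q (cover i)) p≡ (cover-noPath i)))
    (≤-reflexive (*-comm j _))

  -- The upper bound in disguise: j n - D is at most the Turán number and p j² = j C(p, 2). The term
  -- p D stands on the left to avoid subtraction.
  Total : Set
  Total = Sum (λ i → H.e i (cover i)) (allFin m) + p * D ≤ p * (j * n) + p * (j * j)

  -- Each thin vertex saves j in the estimate j Σ |Y_i|, so enough of them pay for p D.
  total-thin : length full ≤ p * j → p * D ≤ j * length thin → Total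
  total-thin full≤ thin≥ = begin
    Sum (λ i → H.e i (cover i)) (allFin m) + p * D ≤⟨ +-mono-≤ (Sum-mono (allFin m) λ {i} _ → cover-bound i) thin≥ ⟩
    Sum (λ i → length (cover i) * j) (allFin m) + j * length thin ≡⟨ cong₂ _+_ (Sum-*ʳ (λ i → length (cover i)) j (allFin m)) (*-comm j _) ⟩
    Sum (λ i → length (cover i)) (allFin m) * j + length thin * j ≡⟨ *-distribʳ-+ j (Sum (λ i → length (cover i)) (allFin m)) _ ⟨
    (Sum (λ i → length (cover i)) (allFin m) + length thin) * j ≤⟨ *-monoˡ-≤ j (≤-trans sum-cover (+-monoʳ-≤ (n * p) full≤)) ⟩
    (n * p + p * j) * j ≡⟨ lemma n p j ⟩
    p * (j * n) + p * (j * j) ∎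
    where open ≤-Reasoning
          lemma : ∀ n p j → (n * p + p * j) * j ≡ p * (j * n) + p * (j * j)
          lemma = solve-∀

  module _ (W : List (Fin n)) (uW : Unique W) (disjoint : ∀ {v} → v ∈ full → v ∉ W) (shade : Fin n → Fin m)
    (mono : ∀ {u w} → u ∈ full → w ∈ W → col c u w ≡ shade u) (large : suc j ≤ length W)
    {W₂ : List (Fin n)} (uW₂ : Unique W₂) (W₂⊆W : ∀ {w} → w ∈ W₂ → w ∈ W) (κ : Fin m)
    (covers-W₂ : ∀ {i w} → w ∈ W₂ → i ≢ κ → Covered i w) (large₂ : m * m ≤ length W₂) where

    open Classes full W (Unique.filter⁺ full? (Unique.allFin⁺ n)) full-covered uW disjoint shade mono large

    -- Each vertex of X costs an extra j, charged to the colour in which it sees W. In a colour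
    -- other than κ this charge and the required D are covered by j² together with the slack of Y_i;
    -- colour κ has an empty class and owes nothing.
    total-by-classes : ∀ {P} → H.Path κ W P → p < length P → Total
    total-by-classes pt lt = cancel-≤ (length full * j) refl refl (begin
        length full * j + (Sum (λ i → H.e i (cover i)) (allFin m) + p * D) ≡⟨ +-comm (length full * j) _ ⟩
        Sum (λ i → H.e i (cover i)) (allFin m) + p * D + length full * j
          ≡⟨ cong₂ (λ x y → Sum (λ i → H.e i (cover i)) (allFin m) + x * D + y * j) (Sum-others κ) (Sum-fibres shade full) ⟨
        Sum (λ i → H.e i (cover i)) (allFin m) + Sum (others κ) (allFin m) * D + Sum (λ i → length (class i)) (allFin m) * j
          ≡⟨ cong₂ (λ x y → Sum (λ i → H.e i (cover i)) (allFin m) + x + y) (Sum-*ʳ (others κ) D (allFin m)) (Sum-*ʳ (λ i → length (class i)) j (allFin m)) ⟨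
        Sum (λ i → H.e i (cover i)) (allFin m) + Sum (λ i → others κ i * D) (allFin m) + Sum (λ i → length (class i) * j) (allFin m)
          ≡⟨ cong (_+ Sum (λ i → length (class i) * j) (allFin m)) (Sum-+ (λ i → H.e i (cover i)) (λ i → others κ i * D) (allFin m)) ⟨
        Sum (λ i → H.e i (cover i) + others κ i * D) (allFin m) + Sum (λ i → length (class i) * j) (allFin m)
          ≡⟨ Sum-+ (λ i → H.e i (cover i) + others κ i * D) (λ i → length (class i) * j) (allFin m) ⟨
        Sum (λ i → H.e i (cover i) + others κ i * D + length (class i) * j) (allFin m) ≤⟨ Sum-mono (allFin m) (λ {i} _ → per-colour i) ⟩
        Sum (λ i → length (cover i) * j + others κ i * (j * j)) (allFin m)
          ≡⟨ Sum-+ (λ i → length (cover i) * j) (λ i → others κ i * (j * j)) (allFin m) ⟩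
        Sum (λ i → length (cover i) * j) (allFin m) + Sum (λ i → others κ i * (j * j)) (allFin m)
          ≡⟨ cong₂ _+_ (Sum-*ʳ (λ i → length (cover i)) j (allFin m)) (trans (Sum-*ʳ (others κ) (j * j) (allFin m)) (cong (_* (j * j)) (Sum-others κ))) ⟩
        Sum (λ i → length (cover i)) (allFin m) * j + p * (j * j) ≤⟨ +-monoˡ-≤ (p * (j * j)) (*-monoˡ-≤ j (≤-trans (m≤m+n _ (length thin)) sum-cover)) ⟩
        (n * p + length full) * j + p * (j * j) ≡⟨ lemma n p (length full) j ⟩
        length full * j + (p * (j * n) + p * (j * j)) ∎)
      where
      open ≤-Reasoning
      lemma : ∀ n p f j → (n * p + f) * j + p * (j * j) ≡ f * j + (p * (j * n) + p * (j * j))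
      lemma = solve-∀

      -- W₂ lies in Y_i and is joined to x in colour i, so x has degree at least m² ≥ p + D there,
      -- as the deficit lemma with t = D demands.
      nonempty : ∀ {i x} → κ ≢ i → x ∈ class i → H.e i (cover i) + D ≤ length (cover i) * j
      nonempty {i} {x} κ≢i x∈ = ≤-trans (H.high-degree-deficit i j _ (cover i) x D ≤-refl ≤-refl (Unique-cover i)
          (subst (λ q → H.NoPath i q (cover i)) p≡ (cover-noPath i)) (∈-cover⁺ (full-covered (proj₁ (∈-class⁻ x∈)) i))
          (≤-trans (≤-reflexive (cong (_+ D) (sym p≡))) (≤-trans p+D≤mm (≤-trans large₂ (unique-⊆-length uW₂ λ w∈ →
            ∈-filter⁺ (SimpleGraph.E? (colourGraph c i) x) (∈-cover⁺ (covers-W₂ w∈ (κ≢i ∘ sym))) (adjacent x∈ (W₂⊆W w∈)))))))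
        (≤-reflexive (*-comm j _))

      per-colour : ∀ i → H.e i (cover i) + others κ i * D + length (class i) * j ≤ length (cover i) * j + others κ i * (j * j)
      per-colour i with κ ≟ i | class-bound pt lt i
      ... | yes _ | le = +-mono-≤ (≤-trans (≤-reflexive (+-identityʳ _)) (cover-bound i)) (*-monoˡ-≤ j le)
      ... | no κ≢i | le with class i in eq
      -- An empty class leaves j² unspent, and j² ≥ D. A nonempty one may spend all of j², but saves
      -- D inside Y_i.
      ... | [] = ≤-trans (≤-reflexive (+-identityʳ _)) (+-mono-≤ (cover-bound i) (*-monoʳ-≤ 1 D≤jj))
      ... | x ∷ _ = +-mono-≤ (≤-trans (≤-reflexive (cong (H.e i (cover i) +_) (*-identityˡ D))) (nonempty κ≢i (subst (x ∈_) (sym eq) (here refl))))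
          (≤-trans (*-monoˡ-≤ j (≤-trans le (≤-reflexive (*-identityˡ j)))) (≤-reflexive (sym (*-identityˡ (j * j)))))

  n<m^n : ∀ x → x < m ^ x
  n<m^n zero = s≤s z≤n
  n<m^n (suc x) = ≤-trans (+-mono-≤ (≤-trans (s≤s z≤n) (n<m^n x)) (n<m^n x))
    (≤-trans (≤-reflexive (cong (m ^ x +_) (sym (+-identityʳ _)))) (*-monoˡ-≤ (m ^ x) 2≤m))

  module _ (j>0 : 0 < j) (n-large : m ^ (suc (p * j) + 4) ≤ n) where

    record CommonNeighbourhood (U : List (Fin n)) : Set where
      field
        W : List (Fin n)
        unique-W : Unique W
        disjoint : ∀ {v} → v ∈ U → v ∉ W
        shade : Fin n → Fin m
        mono : ∀ {u w} → u ∈ U → w ∈ W → col c u w ≡ shade u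
        large : m ^ 4 ≤ length W

    -- With s = p j + 1, fewer than m⁴ remaining vertices would give n = |U| + |W₀| < m^s + m^s |W|
    -- ≤ m^(s + 4).
    common-neighbourhood : ∀ {U} → Unique U → length U ≤ suc (p * j) → CommonNeighbourhood U
    common-neighbourhood {U} uU le with complement uU (λ {v} _ → ∈-allFin v)
    ... | W₀ , pm with shrink U W₀ (Unique-++ʳ U (Unique-resp pm (Unique.allFin⁺ n)))
    ... | W , uW , sub , mono , bound = build W uW sub mono W-large
      where
      s : ℕ
      s = suc (p * j)
      instance
        m≢0 : NonZero m
        m≢0 = >-nonZero (<⇒≤ 2≤m)
      W-large : m ^ 4 ≤ length W
      W-large = ≮⇒≥ λ lt → <-irrefl refl (begin-strict
        n ≡⟨ trans (sym (length-allFin n)) (trans (↭-length pm) (length-++ U)) ⟩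
        length U + length W₀ <⟨ +-mono-<-≤ (≤-<-trans le (n<m^n s)) (≤-trans bound (*-monoˡ-≤ (length W) (^-monoʳ-≤ m le))) ⟩
        m ^ s + m ^ s * length W ≡⟨ *-suc (m ^ s) _ ⟨
        m ^ s * suc (length W) ≤⟨ *-monoʳ-≤ (m ^ s) lt ⟩
        m ^ s * m ^ 4 ≡⟨ ^-distribˡ-+-* m s 4 ⟨
        m ^ (s + 4) ≤⟨ n-large ⟩
        n ∎)
        where open ≤-Reasoning
      build : ∀ W → Unique W → (∀ {w} → w ∈ W → w ∈ W₀) → (∀ {u} → u ∈ U → ∃ λ i → ∀ {w} → w ∈ W → col c u w ≡ i) →
        m ^ 4 ≤ length W → CommonNeighbourhood U
      build [] _ _ _ le = contradiction le (<⇒≱ (m^n>0 m 4))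
      build (w₀ ∷ W) uW sub mono le = record
        { W = w₀ ∷ W ; unique-W = uW ; large = le
        ; disjoint = λ v∈ v∈W → Unique-disjoint U (Unique-resp pm (Unique.allFin⁺ n)) v∈ (sub v∈W)
        -- The colour towards one fixed vertex of W turns the existence of a colour for each u into
        -- a function.
        ; shade = λ u → col c u w₀
        ; mono = λ u∈ w∈ → let _ , h = mono u∈ in trans (h w∈) (sym (h (here refl))) }

    mm≤m⁴ : m * m ≤ m ^ 4
    mm≤m⁴ = *-monoʳ-≤ m (≤-trans (≤-reflexive (sym (*-identityʳ m))) (*-monoʳ-≤ m (m^n>0 m 2)))
      where instance
              m≢0 : NonZero m
              m≢0 = >-nonZero (<⇒≤ 2≤m)

    j<m⁴ : suc j ≤ m ^ 4
    j<m⁴ = ≤-trans (≤-trans (m≤n+m (suc j) (p * suc j)) p*suc-j≤mm) mm≤m⁴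

    -- Only p j + 1 vertices of X are pigeonholed, so that the loss is a fixed power of m; that many
    -- already contradict `length-U`.
    full-small : length full ≤ p * j
    full-small = ≮⇒≥ λ lt → too-large (take (suc (p * j)) full) (Unique.take⁺ (suc (p * j)) (Unique.filter⁺ full? (Unique.allFin⁺ n)))
        (λ {u} u∈ → full-covered (subst (u ∈_) (take++drop≡id (suc (p * j)) full) (∈-++⁺ˡ u∈)))
        (trans (length-take (suc (p * j)) full) (m≤n⇒m⊓n≡m lt))
      where
      too-large : ∀ U → Unique U → (∀ {u} → u ∈ U → ∀ i → Covered i u) → length U ≡ suc (p * j) → ⊥
      too-large U uU cov len = some-long-path unique-W (≤-trans mm≤m⁴ large) λ κ P pt lt →
          <⇒≱ (≤-reflexive (sym len)) (Classes.length-U U W uU cov unique-W disjoint shade mono (≤-trans j<m⁴ large) pt lt)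
        where open CommonNeighbourhood (common-neighbourhood uU (≤-reflexive len))

    -- A vertex of W that is not thin lies outside X, so it misses exactly one colour. W₂ collects
    -- those that miss the most frequent colour ι; they are covered in all others.
    total-few-thin : j * length thin < p * D → Total
    total-few-thin few = decidable-stable (_ ≤? _) λ ¬total → some-long-path unique-W₂ large₂ λ κ P pt lt →
        ¬total (total-by-classes W unique-W disjoint shade mono (≤-trans j<m⁴ large) unique-W₂ W₂⊆W κ
          (λ w∈ i≢κ → covers w∈ (λ i≡ι → i≢κ (trans i≡ι (sym (κ≡ι pt lt))))) large₂ (OnGraph.Path-mono _≟_ (colourGraph c κ) W₂⊆W pt) lt)
      where
      open CommonNeighbourhood (common-neighbourhood (Unique.filter⁺ full? (Unique.allFin⁺ n)) (≤-trans full-small (n≤1+n _)))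
      W₁ = filter (λ w → ¬? (thin? w)) W
      ι : Fin m
      ι = proj₁ (pigeonhole (<⇒≤ 2≤m) missing W₁)
      W₂ = filter (λ w → missing w ≟ ι) W₁
      unique-W₂ : Unique W₂
      unique-W₂ = Unique.filter⁺ (λ w → missing w ≟ ι) (Unique.filter⁺ (λ w → ¬? (thin? w)) unique-W)
      ∈-W₂ : ∀ {w} → w ∈ W₂ → w ∈ W × ¬ (multiplicity w < p) × missing w ≡ ι
      ∈-W₂ w∈ = let w∈₁ , eq = ∈-filter⁻ (λ w → missing w ≟ ι) {xs = W₁} w∈ ; w∈W , ¬t = ∈-filter⁻ (λ w → ¬? (thin? w)) {xs = W} w∈₁ in w∈W , ¬t , eq
      W₂⊆W : ∀ {w} → w ∈ W₂ → w ∈ W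
      W₂⊆W = proj₁ ∘ ∈-W₂
      covers : ∀ {i w} → w ∈ W₂ → i ≢ ι → Covered i w
      covers {i} {w} w∈ i≢ι = let w∈W , ¬t , eq = ∈-W₂ w∈ in covered-but-one (missing w) ¬t
        (missing-uncovered w λ f → disjoint (∈-filter⁺ full? (∈-allFin w) f) w∈W) (λ i≡ → i≢ι (trans i≡ eq))
      -- For κ different from ι, W₂ would lie in Y_κ, which has no long path of colour κ.
      κ≡ι : ∀ {κ P} → H.Path κ W₂ P → p < length P → κ ≡ ι
      κ≡ι {κ} {P} pt lt = decidable-stable (κ ≟ ι) λ κ≢ι → <⇒≱ lt
        (cover-noPath κ P (OnGraph.Path-mono _≟_ (colourGraph c κ) (λ w∈ → ∈-cover⁺ (covers w∈ κ≢ι)) pt))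
      thin< : length thin < m * m
      thin< = <-≤-trans (*-cancelˡ-< j (length thin) (p * suc j) (<-≤-trans few (≤-trans (*-monoʳ-≤ p (tri-≤ j (s≤s (m≤m+n j j))))
          (≤-reflexive (lemma p j (suc j)))))) (≤-trans (m≤m+n _ (suc j)) p*suc-j≤mm)
        where lemma : ∀ p j s → p * (j * s) ≡ j * (p * s)
              lemma = solve-∀
      -- Origin of m⁴: at most m² vertices are thin, and each of m colours would account for at most
      -- m² others, while m² + m³ ≤ 2 m³ ≤ m⁴.
      large₂ : m * m ≤ length W₂
      large₂ = ≮⇒≥ λ lt → <-irrefl refl (begin-strict
          m ^ 4 ≤⟨ large ⟩
          length W ≡⟨ count-complement thin? W ⟨
          count thin? W + length W₁ ≤⟨ +-mono-≤ (unique-⊆-length (Unique.filter⁺ thin? unique-W) λ {w} w∈ →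
              ∈-filter⁺ thin? (∈-allFin w) (proj₂ (∈-filter⁻ thin? {xs = W} w∈))) (proj₂ (pigeonhole (<⇒≤ 2≤m) missing W₁)) ⟩
          length thin + m * length W₂ <⟨ +-mono-<-≤ thin< (*-monoʳ-≤ m (<⇒≤ lt)) ⟩
          m * m + m * (m * m) ≤⟨ +-monoˡ-≤ (m * (m * m)) (≤-trans (≤-reflexive (sym (*-identityˡ (m * m)))) (*-monoˡ-≤ (m * m) (<⇒≤ 2≤m))) ⟩
          m * (m * m) + m * (m * m) ≡⟨ lemma (m * (m * m)) ⟩
          2 * (m * (m * m)) ≤⟨ *-monoˡ-≤ (m * (m * m)) 2≤m ⟩
          m * (m * (m * m)) ≡⟨ lemma′ m ⟩
          m ^ 4 ∎)
        where open ≤-Reasoning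
              lemma : ∀ x → x + x ≡ 2 * x
              lemma = solve-∀
              lemma′ : ∀ m → m * (m * (m * m)) ≡ m * (m * (m * (m * 1)))
              lemma′ = solve-∀

    total-positive : Total
    total-positive with p * D ≤? j * length thin
    ... | yes many = total-thin full-small many
    ... | no few = total-few-thin (≰⇒> few)

  -- For j = 0 the exponent p j + 5 exceeds 2k² = 2, so n need not be large enough; but then
  -- `cover-bound` leaves no edges at all.
  total : (0 < j → m ^ (suc (p * j) + 4) ≤ n) → Total
  total large with 0 <? j
  ... | yes j>0 = total-positive j>0 (large j>0)
  ... | no j≯0 = ≤-trans (+-mono-≤ (≤-trans (Sum-mono (allFin m) λ {i} _ → cover-bound i)
          (≤-reflexive (trans (Sum-*ʳ (λ i → length (cover i)) j (allFin m)) (trans (cong (covers *_) j≡0) (*-zeroʳ covers)))))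
        (*-monoʳ-≤ p D≤jj)) (m≤n+m _ (p * (j * n)))
    where covers = Sum (λ i → length (cover i)) (allFin m)
          j≡0 : j ≡ 0
          j≡0 = n≤0⇒n≡0 (≮⇒≥ j≯0)

  -- E stands for the Turán number, of which only the lower bound j n - D enters.
  nim-bound : (0 < j → m ^ (suc (p * j) + 4) ≤ n) → ∀ E → j * n ≤ E + D → length es ≤ p * E + j * (j * p)
  nim-bound large E E≥ = cancel-≤ (p * D) (+-comm (p * D) (length es)) refl (begin
      length es + p * D ≤⟨ +-monoˡ-≤ (p * D) length-es ⟩
      Sum (λ i → H.e i (cover i)) (allFin m) + p * D ≤⟨ total large ⟩
      p * (j * n) + p * (j * j) ≤⟨ +-monoˡ-≤ (p * (j * j)) (*-monoʳ-≤ p E≥) ⟩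
      p * (E + D) + p * (j * j) ≡⟨ lemma p E D j ⟩
      p * D + (p * E + j * (j * p)) ∎)
    where open ≤-Reasoning
          lemma : ∀ p E D j → p * (E + D) + p * (j * j) ≡ p * D + (p * E + j * (j * p))
          lemma = solve-∀

-- Lower bound

module _ {A : Set} where

  count-≤-cons : ∀ {P : A → Set} (P? : Decidable P) x L → count P? L ≤ count P? (x ∷ L)
  count-≤-cons P? x L with P? x
  ... | yes _ = n≤1+n _
  ... | no _ = ≤-refl

  -- A set that meets every edge of a path contains at least every second vertex.
  length-dominated : ∀ {P : A → Set} (P? : Decidable P) L → Linked (λ u v → P u ⊎ P v) L → length L ≤ suc (count P? L + count P? L)
  length-dominated P? [] _ = z≤n
  length-dominated P? (x ∷ []) _ = s≤s z≤n
  length-dominated P? (x ∷ y ∷ L) (xy ∷ l) = s≤s (≤-trans (s≤s (length-dominated P? L (Linked.tail l)))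
      (≤-trans (≤-reflexive (cong suc (sym (+-suc _ _)))) (+-mono-≤ (one-more xy) (one-more xy))))
    where
    one-more : _ → suc (count P? L) ≤ count P? (x ∷ y ∷ L)
    one-more (inj₁ px) = ≤-trans (s≤s (count-≤-cons P? y L)) (≤-reflexive (sym (count-accept P? (y ∷ L) px)))
    one-more (inj₂ py) = ≤-trans (≤-reflexive (sym (count-accept P? L py))) (count-≤-cons P? x (y ∷ L))

  Unique-map : ∀ {B : Set} (f : A → B) {L} → Unique L → (∀ {u v} → u ∈ L → v ∈ L → f u ≡ f v → u ≡ v) → Unique (map f L)
  Unique-map f [] _ = []
  Unique-map f {x ∷ L} (x# ∷ u) inj = All.tabulate (λ y∈ → case ∈-map⁻ f y∈ of λ { (v , v∈ , refl) eq → All.lookup x# v∈ (inj (here refl) (there v∈) eq) })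
    ∷ Unique-map f u (λ p q → inj (there p) (there q))

  length-image : ∀ {B : Set} (f : A → B) {L} ys → Unique L → (∀ {u v} → u ∈ L → v ∈ L → f u ≡ f v → u ≡ v) →
    (∀ {v} → v ∈ L → f v ∈ ys) → length L ≤ length ys
  length-image f {L} ys u inj sub = ≤-trans (≤-reflexive (sym (length-map f L))) (unique-⊆-length (Unique-map f u inj)
    λ y∈ → case ∈-map⁻ f y∈ of λ { (v , v∈ , refl) → sub v∈ })

-- Edge counts of cliques and joins

module _ {V : Set} (_≟V_ : DecidableEquality V) (G : SimpleGraph V) where
  open SimpleGraph G
  open OnGraph _≟V_ G

  e-join : ∀ A B → Unique (A ++ B) → (∀ {a w} → a ∈ A → w ∈ A ++ B → a ≢ w → E a w) →
    tri (length A) + length A * length B ≤ e (A ++ B)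
  e-join [] B _ _ = z≤n
  e-join (a ∷ A) B (a# ∷ u) adjacent = begin
      length A + tri (length A) + (length B + length A * length B) ≡⟨ lemma (length A) (tri (length A)) (length B) (length A * length B) ⟩
      length A + length B + (tri (length A) + length A * length B) ≤⟨ +-mono-≤ (≤-reflexive degree) (e-join A B u (λ p q → adjacent (there p) (there q))) ⟩
      deg a (A ++ B) + e (A ++ B) ∎
    where
    open ≤-Reasoning
    lemma : ∀ a t b x → a + t + (b + x) ≡ a + b + (t + x)
    lemma = solve-∀
    degree : length A + length B ≡ deg a (A ++ B)
    degree = sym (trans (cong length (filter-all (E? a) (All.tabulate λ w∈ → adjacent (here refl) (there w∈) (All.lookup a# w∈)))) (length-++ A))

  e-clique : ∀ A → Unique A → (∀ {a w} → a ∈ A → w ∈ A → a ≢ w → E a w) → tri (length A) ≤ e A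
  e-clique A u adjacent = subst (λ L → tri (length A) ≤ e L) (++-identityʳ A)
    (≤-trans (m≤m+n _ _) (e-join A [] (subst Unique (sym (++-identityʳ A)) u) (λ {a} {w} p q → adjacent p (subst (w ∈_) (++-identityʳ A) q))))

  e-classes : ∀ {r} (f : V → Fin r) S → Sum (λ b → e (filter (λ v → f v ≟ b) S)) (allFin r) ≤ e S
  e-classes {r} f [] = ≤-reflexive (Sum-zero (allFin r))
  e-classes {r} f (v ∷ S) = begin
      Sum (λ b → e (filter (λ v → f v ≟ b) (v ∷ S))) (allFin r) ≤⟨ Sum-mono (allFin r) (λ {b} _ → step b) ⟩
      Sum (λ b → indicator (f v ≟ b) * deg v S + e (filter (λ v → f v ≟ b) S)) (allFin r)
        ≡⟨ Sum-+ (λ b → indicator (f v ≟ b) * deg v S) (λ b → e (filter (λ v → f v ≟ b) S)) (allFin r) ⟩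
      Sum (λ b → indicator (f v ≟ b) * deg v S) (allFin r) + Sum (λ b → e (filter (λ v → f v ≟ b) S)) (allFin r)
        ≤⟨ +-mono-≤ (≤-reflexive (trans (Sum-*ʳ (λ b → indicator (f v ≟ b)) (deg v S) (allFin r))
             (cong (_* deg v S) (trans (sym (count-Sum (f v ≟_) (allFin r))) (count-one (f v)))))) (e-classes f S) ⟩
      1 * deg v S + e S ≡⟨ cong (_+ e S) (*-identityˡ (deg v S)) ⟩
      deg v S + e S ∎
    where
    open ≤-Reasoning
    step : ∀ b → e (filter (λ v → f v ≟ b) (v ∷ S)) ≤ indicator (f v ≟ b) * deg v S + e (filter (λ v → f v ≟ b) S)
    step b with f v ≟ b
    ... | no _ = ≤-refl
    ... | yes _ = +-monoˡ-≤ (e (filter (λ v → f v ≟ b) S)) (≤-trans (≤-trans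
            (m≤m+n _ (count (E? v) (filter (λ v → ¬? (f v ≟ b)) S))) (≤-reflexive (count-filter S))) (≤-reflexive (sym (*-identityˡ (deg v S)))))
      where
      count-filter : ∀ T → count (E? v) (filter (λ v → f v ≟ b) T) + count (E? v) (filter (λ v → ¬? (f v ≟ b)) T) ≡ count (E? v) T
      count-filter [] = refl
      count-filter (w ∷ T) with f w ≟ b
      ... | yes _ with E? v w
      ...   | yes _ = cong suc (count-filter T)
      ...   | no _ = count-filter T
      count-filter (w ∷ T) | no _ with E? v w
      ...   | yes _ = trans (+-suc _ _) (cong suc (count-filter T))
      ...   | no _ = count-filter T

module Join (j n : ℕ) (j≤n : j ≤ n) where

  joinGraph : Graph n
  joinGraph = record { adj = λ u v → (toℕ u <ᵇ j) ∨ (toℕ v <ᵇ j) ; sym = λ u v → ∨-comm (toℕ u <ᵇ j) (toℕ v <ᵇ j) }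

  hub? : Decidable (λ (u : Fin n) → toℕ u < j)
  hub? u = suc (toℕ u) ≤? j

  adjacent⇒hub : ∀ {u v} → adj joinGraph u v ≡ true → toℕ u < j ⊎ toℕ v < j
  adjacent⇒hub {u} {v} eq with Equivalence.to (T-∨ {toℕ u <ᵇ j}) (Equivalence.from T-≡ eq)
  ... | inj₁ t = inj₁ (<ᵇ⇒< (toℕ u) j t)
  ... | inj₂ t = inj₂ (<ᵇ⇒< (toℕ v) j t)

  hub⇒adjacent : ∀ {u v} → toℕ u < j → adj joinGraph u v ≡ true
  hub⇒adjacent {u} {v} lt = Equivalence.to T-≡ (Equivalence.from (T-∨ {toℕ u <ᵇ j}) (inj₁ (<⇒<ᵇ lt)))

  -- Every edge meets the j hubs, so a path has at most 2j + 1 vertices.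
  join-noPath : ¬ ContainsPath (suc (suc (j + j))) joinGraph
  join-noPath (f , inj , linked) = <-irrefl refl (begin-strict
      suc (j + j) <⟨ n<1+n _ ⟩
      suc (suc (j + j)) ≡⟨ length-tabulate f ⟨
      length (tabulate f) ≤⟨ length-dominated hub? (tabulate f) (tabulate-linked f λ i k eq → adjacent⇒hub (linked i k eq)) ⟩
      suc (count hub? (tabulate f) + count hub? (tabulate f)) ≤⟨ s≤s (+-mono-≤ few few) ⟩
      suc (j + j) ∎)
    where
    open ≤-Reasoning
    few : count hub? (tabulate f) ≤ j
    few = ≤-trans (length-image toℕ (upTo j) (Unique.filter⁺ hub? (Unique.tabulate⁺ inj)) (λ _ _ → toℕ-injective)
      λ v∈ → ∈-upTo⁺ (proj₂ (∈-filter⁻ hub? {xs = tabulate f} v∈))) (≤-reflexive (length-upTo j))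

  join-edges : j * n ≤ edgeCount joinGraph + tri (suc j)
  join-edges with complement (Unique.tabulate⁺ {f = λ (t : Fin j) → Fin.inject≤ t j≤n} (inject≤-injective j≤n j≤n _ _)) (λ {v} _ → ∈-allFin v)
  ... | B , pm = begin
      j * n ≡⟨ cong (j *_) (trans (sym (length-allFin n)) (trans (↭-length pm) (trans (length-++ A) (cong (_+ length B) lenA)))) ⟩
      j * (j + length B) ≡⟨ trans (*-distribˡ-+ j j _) (cong (_+ j * length B) (sym (tri+tri-suc j))) ⟩
      tri j + tri (suc j) + j * length B ≡⟨ lemma (tri j) (tri (suc j)) (j * length B) ⟩
      tri j + j * length B + tri (suc j) ≡⟨ cong (λ a → tri a + a * length B + tri (suc j)) lenA ⟨
      tri (length A) + length A * length B + tri (suc j) ≤⟨ +-monoˡ-≤ (tri (suc j)) (e-join _≟_ (graphOf joinGraph) A B (Unique-resp pm (Unique.allFin⁺ n))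
          λ a∈ _ ne → ne , hub⇒adjacent (hub a∈)) ⟩
      e (A ++ B) + tri (suc j) ≡⟨ cong (_+ tri (suc j)) (trans (sym (e-↭ pm)) (sym (edgeCount≡e joinGraph))) ⟩
      edgeCount joinGraph + tri (suc j) ∎
    where
    open ≤-Reasoning
    open OnGraph _≟_ (graphOf joinGraph)
    A = tabulate λ (t : Fin j) → Fin.inject≤ t j≤n
    lenA : length A ≡ j
    lenA = length-tabulate (λ (t : Fin j) → Fin.inject≤ t j≤n)
    lemma : ∀ a b d → a + b + d ≡ a + d + b
    lemma = solve-∀
    hub : ∀ {a} → a ∈ A → toℕ a < j
    hub a∈ with t , refl ← ∈-tabulate⁻ a∈ = ≤-trans (≤-reflexive (cong suc (toℕ-inject≤ t j≤n))) (toℕ<n t)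

Sum-allFin-suc : ∀ {r} (f : Fin (suc r) → ℕ) → Sum f (allFin (suc r)) ≡ f zero + Sum (f ∘ suc) (allFin r)
Sum-allFin-suc {r} f = cong (λ l → f zero + sum l) (trans (map-tabulate suc f) (sym (map-tabulate id (f ∘ suc))))

-- The affine-plane colouring

module Construction (j q n : ℕ) (q≡ : q ≡ j + j) (pp≤n : suc q * suc q ≤ n) (prime : Prime (suc q)) where

  private
    p : ℕ
    p = suc q

  open Modular p using (line; line-injective; ordinate; line-ordinate; line-unique; line-exists; line-axis)

  -- The first p² vertices form the affine plane over ℤ/p; every other vertex gets the coordinates of the origin.
  locate : (v : Fin n) → Dec (toℕ v < p * p) → Fin p × Fin p
  locate v (yes lt) = Fin.remQuot p (Fin.fromℕ< lt)
  locate v (no _) = zero , zero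

  coordinates : Fin n → Fin p × Fin p
  coordinates v = locate v (toℕ v <? p * p)

  point : Fin p → Fin p → Fin n
  point x y = Fin.inject≤ (Fin.combine x y) pp≤n

  coordinates-point : ∀ x y → coordinates (point x y) ≡ (x , y)
  coordinates-point x y = go (toℕ (point x y) <? p * p)
    where
    go : ∀ d → locate (point x y) d ≡ (x , y)
    go (yes lt) = trans (cong (Fin.remQuot p) (toℕ-injective (trans (toℕ-fromℕ< lt) (toℕ-inject≤ (Fin.combine x y) pp≤n)))) (remQuot-combine x y)
    go (no ≮) = contradiction (≤-trans (≤-reflexive (cong suc (toℕ-inject≤ (Fin.combine x y) pp≤n))) (toℕ<n (Fin.combine x y))) ≮

  opaque

    X Y : Fin n → Fin p
    X v = proj₁ (coordinates v)
    Y v = proj₂ (coordinates v)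

    X-point : ∀ x y → X (point x y) ≡ x
    X-point x y = cong proj₁ (coordinates-point x y)

    Y-point : ∀ x y → Y (point x y) ≡ y
    Y-point x y = cong proj₂ (coordinates-point x y)

    coordinates-injective : ∀ {u v} → X u ≡ X v → Y u ≡ Y v → ¬ (X u ≡ zero × Y u ≡ zero) → u ≡ v
    coordinates-injective {u} {v} = go (toℕ u <? p * p) (toℕ v <? p * p)
      where
      go : ∀ d d′ → proj₁ (locate u d) ≡ proj₁ (locate v d′) → proj₂ (locate u d) ≡ proj₂ (locate v d′) →
        ¬ (proj₁ (locate u d) ≡ zero × proj₂ (locate u d) ≡ zero) → u ≡ v
      go (no _) _ _ _ nz = contradiction (refl , refl) nz
      go (yes _) (no _) ex ey nz = contradiction (ex , ey) nz
      go (yes lt) (yes lt′) ex ey _ = toℕ-injective (trans (sym (toℕ-fromℕ< lt)) (trans (cong toℕ (trans (sym (combine-remQuot p (Fin.fromℕ< lt)))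
        (trans (cong₂ Fin.combine ex ey) (combine-remQuot p (Fin.fromℕ< lt′))))) (toℕ-fromℕ< lt′)))

  Central : Fin p → Set
  Central x = 1 ≤ toℕ x × toℕ x ≤ j

  central? : Decidable Central
  central? x = (1 ≤? toℕ x) ×-dec (toℕ x ≤? j)

  central≢0 : ∀ {x} → Central x → x ≢ zero
  central≢0 (() , _) refl

  column-injective : ∀ {u v} → Central (X u) → X u ≡ X v → Y u ≡ Y v → u ≡ v
  column-injective cen ex ey = coordinates-injective ex ey λ (x0 , _) → central≢0 cen x0

  label : Fin p → Fin n → Fin p
  label i v = line i (X v) (Y v)

  label-injective : ∀ {i u v} → X u ≡ X v → label i u ≡ label i v → Y u ≡ Y v
  label-injective {i} {u} {v} ex el = line-injective i (X v) (trans (cong (λ x → line i x (Y u)) (sym ex)) el)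

  -- Hence all vertices outside the plane belong to class `zero` in every direction.
  label-origin : ∀ {i v} → X v ≡ zero → Y v ≡ zero → label i v ≡ zero
  label-origin {i} {v} ex ey = trans (line-axis i (Y v) (cong toℕ ex)) ey

  -- Direction i colours the lines of that direction, except that the line through the origin is replaced
  -- by the join of its j central vertices with the rest of the line and all vertices outside the plane.
  record Aligned (i : Fin p) (u v : Fin n) : Set where
    constructor aligned
    field
      same-label : label i u ≡ label i v
      side : label i u ≢ zero ⊎ Central (X u) ⊎ Central (X v)
  open Aligned

  aligned? : ∀ i u v → Dec (Aligned i u v)
  aligned? i u v = map′ (λ (eq , s) → aligned eq s) (λ a → same-label a , side a)
    ((label i u ≟ label i v) ×-dec (¬? (label i u ≟ zero) ⊎-dec (central? (X u) ⊎-dec central? (X v))))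

  Aligned-sym : ∀ {i u v} → Aligned i u v → Aligned i v u
  Aligned-sym (aligned eq (inj₁ nz)) = aligned (sym eq) (inj₁ (nz ∘ trans eq))
  Aligned-sym (aligned eq (inj₂ (inj₁ c))) = aligned (sym eq) (inj₂ (inj₂ c))
  Aligned-sym (aligned eq (inj₂ (inj₂ c))) = aligned (sym eq) (inj₂ (inj₁ c))

  -- Equal X and equal label leave only two vertices that share the coordinates of the origin, and
  -- for these `side` fails. With distinct X the direction is unique, so the colour is well defined.
  aligned⇒X≢ : ∀ {i u v} → u ≢ v → Aligned i u v → X u ≢ X v
  aligned⇒X≢ {i} {u} {v} u≢v (aligned eq sd) ex = u≢v (coordinates-injective ex (label-injective {i} ex eq) λ (x0 , y0) → case sd of λ
    { (inj₁ nz) → nz (label-origin {i} x0 y0)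
    ; (inj₂ (inj₁ c)) → central≢0 c x0
    ; (inj₂ (inj₂ c)) → central≢0 c (trans (sym ex) x0) })

  aligned-unique : ∀ {i k u v} → u ≢ v → Aligned i u v → Aligned k u v → i ≡ k
  aligned-unique u≢v a b = line-unique prime (aligned⇒X≢ u≢v a) (same-label a) (same-label b)

  -- Direction i gets colour `suc i`; `zero` is the last colour of the overview.
  pick : ∀ {P : Fin p → Set} → Dec (∃ P) → Fin (suc p)
  pick (yes (i , _)) = suc i
  pick (no _) = zero

  opaque

    direction? : ∀ u v → Dec (∃ λ i → Aligned i u v)
    direction? u v = Fin.any? (λ i → aligned? i u v)

    colour : Fin n → Fin n → Fin (suc p)
    colour u v = pick (direction? u v)

    aligned⇒colour : ∀ {i u v} → u ≢ v → Aligned i u v → colour u v ≡ suc i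
    aligned⇒colour {i} {u} {v} u≢v a = go (direction? u v)
      where go : (d : Dec (∃ λ i → Aligned i u v)) → pick d ≡ suc i
            go (yes (k , a′)) = cong suc (aligned-unique u≢v a′ a)
            go (no none) = contradiction (i , a) none

    colour⇒aligned : ∀ {i u v} → colour u v ≡ suc i → Aligned i u v
    colour⇒aligned {i} {u} {v} = go (direction? u v)
      where go : (d : Dec (∃ λ i → Aligned i u v)) → pick d ≡ suc i → Aligned i u v
            go (yes (k , a)) refl = a

    ¬aligned⇒colour : ∀ {u v} → ¬ (∃ λ i → Aligned i u v) → colour u v ≡ zero
    ¬aligned⇒colour {u} {v} none = go (direction? u v)
      where go : (d : Dec (∃ λ i → Aligned i u v)) → pick d ≡ zero
            go (yes a) = contradiction a none
            go (no _) = refl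

  colour-sym : ∀ u v → colour u v ≡ colour v u
  colour-sym u v with u ≟ v
  ... | yes refl = refl
  ... | no u≢v = go (direction? u v)
    where go : Dec (∃ λ i → Aligned i u v) → colour u v ≡ colour v u
          go (yes (i , a)) = trans (aligned⇒colour u≢v a) (sym (aligned⇒colour (u≢v ∘ sym) (Aligned-sym a)))
          go (no none) = trans (¬aligned⇒colour none) (sym (¬aligned⇒colour λ (i , a) → none (i , Aligned-sym a)))

  colouring : Colouring (suc p) n
  colouring = record { col = colour ; col-sym = colour-sym }

  -- The label is constant along the path. If it is nonzero, the vertices have distinct X. If it is
  -- zero, every edge has a central end and each of the j central columns meets the line once, which
  -- allows 2j + 1 = p vertices.
  aligned-path : ∀ {i} L → Unique L → Linked (Aligned i) L → length L ≤ p
  aligned-path [] _ _ = z≤n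
  aligned-path {i} L@(v ∷ _) uL lL = go (label i v ≟ zero)
    where
    same : ∀ {v L} → Linked (Aligned i) (v ∷ L) → ∀ {w} → w ∈ v ∷ L → label i w ≡ label i v
    same _ (here refl) = refl
    same (a ∷ l) (there w∈) = trans (same l w∈) (sym (same-label a))
    Xs-injective : ∀ {u w} → u ∈ L → w ∈ L → (label i v ≢ zero ⊎ Central (X u)) → X u ≡ X w → u ≡ w
    Xs-injective {u} u∈ w∈ side ex = coordinates-injective ex (label-injective {i} ex (trans (same lL u∈) (sym (same lL w∈))))
      λ (x0 , y0) → case side of λ { (inj₁ nz) → nz (trans (sym (same lL u∈)) (label-origin {i} x0 y0)) ; (inj₂ c) → central≢0 c x0 }
    go : Dec (label i v ≡ zero) → length L ≤ p
    go (no nz) = ≤-trans (length-image X (allFin p) uL (λ u∈ w∈ → Xs-injective u∈ w∈ (inj₁ nz)) λ {u} _ → ∈-allFin (X u)) (≤-reflexive (length-allFin p))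
    go (yes z) = ≤-trans (length-dominated (central? ∘ X) L (centred L lL id)) (s≤s (≤-trans (+-mono-≤ few few) (≤-reflexive (sym q≡))))
      where
      centred : ∀ L′ → Linked (Aligned i) L′ → (∀ {w} → w ∈ L′ → w ∈ L) → Linked (λ u w → Central (X u) ⊎ Central (X w)) L′
      centred [] _ _ = []
      centred (x ∷ []) _ _ = [-]
      centred (x ∷ y ∷ L′) (aligned _ sd ∷ l) sub = (case sd of λ
        { (inj₁ nz) → contradiction (trans (same lL (sub (here refl))) z) nz ; (inj₂ c) → c }) ∷ centred (y ∷ L′) l (sub ∘ there)
      few : count (central? ∘ X) L ≤ j
      few = ≤-trans (length-image (toℕ ∘ X) (map suc (upTo j)) (Unique.filter⁺ (central? ∘ X) uL)
          (λ u∈ w∈ ex → let u∈L , c = ∈-filter⁻ (central? ∘ X) {xs = L} u∈ in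
            Xs-injective u∈L (proj₁ (∈-filter⁻ (central? ∘ X) {xs = L} w∈)) (inj₂ c) (toℕ-injective ex))
          (λ {w} w∈ → in-range (proj₂ (∈-filter⁻ (central? ∘ X) {xs = L} w∈))))
        (≤-reflexive (trans (length-map suc (upTo j)) (length-upTo j)))
        where in-range : ∀ {x} → Central x → toℕ x ∈ map suc (upTo j)
              in-range {suc x} (_ , s≤s le) = ∈-map⁺ suc (∈-upTo⁺ (s≤s le))

  -- A central vertex is aligned with every vertex of different X, also with those outside the
  -- plane. So a path of colour `zero` cannot leave a central column, which has p vertices.
  column-path : ∀ {x} L → Unique L → Linked (λ u v → u ≢ v × colour u v ≡ zero) L → x ∈ L → Central (X x) → length L ≤ p
  column-path {x} L uL lL x∈ cen = ≤-trans (length-image Y (allFin p) uL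
      (λ u∈ w∈ ey → column-injective (subst Central (sym (whole L lL x∈ u∈ refl)) cen) (trans (whole L lL x∈ u∈ refl) (sym (whole L lL x∈ w∈ refl))) ey)
      λ {u} _ → ∈-allFin (Y u)) (≤-reflexive (length-allFin p))
    where
    step : ∀ {u w} → u ≢ w → colour u w ≡ zero → X u ≡ X x → X w ≡ X x
    step {u} {w} u≢w eq ex = decidable-stable (X w ≟ X x) λ ne →
      let i , el = line-exists prime (Y u) (Y w) (λ e → ne (trans (sym e) ex)) in
      case trans (sym eq) (aligned⇒colour u≢w (aligned el (inj₂ (inj₁ (subst Central (sym ex) cen))))) of λ ()
    whole : ∀ L → Linked (λ u v → u ≢ v × colour u v ≡ zero) L → ∀ {u w} → u ∈ L → w ∈ L → X u ≡ X x → X w ≡ X x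
    whole (_ ∷ _) _ (here refl) (here refl) ex = ex
    whole (v ∷ y ∷ L) ((ne , eq) ∷ l) (here refl) (there w∈) ex = whole (y ∷ L) l (here refl) w∈ (step ne eq ex)
    whole (v ∷ y ∷ L) ((ne , eq) ∷ l) (there u∈) (here refl) ex =
      step (ne ∘ sym) (trans (colour-sym y v) eq) (whole (y ∷ L) l u∈ (here refl) ex)
    whole (v ∷ y ∷ L) ((ne , eq) ∷ l) (there u∈) (there w∈) ex = whole (y ∷ L) l u∈ w∈ ex

  Good : Fin n → Fin n → Set
  Good u v = (∃ λ i → Aligned i u v) ⊎ (X u ≡ X v × Central (X u))

  column⇒colour : ∀ {u v} → u ≢ v → X u ≡ X v → colour u v ≡ zero
  column⇒colour u≢v ex = ¬aligned⇒colour λ (i , a) → aligned⇒X≢ u≢v a ex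

  good⇒NIM : ∀ {u v} → u ≢ v → Good u v → NIM colouring (suc p) u v
  good⇒NIM {u} {v} u≢v good (κ , f , (inj , linked) , a , b , eq , ends) = <⇒≱ (n<1+n p) (≤-trans (≤-reflexive (sym (length-tabulate f))) (short good))
    where
    u∈ : u ∈ tabulate f
    u∈ = case ends of λ { (inj₁ (refl , _)) → ∈-tabulate⁺ {f = f} a ; (inj₂ (_ , refl)) → ∈-tabulate⁺ {f = f} b }
    κ≡ : colour u v ≡ κ
    κ≡ = case ends of λ { (inj₁ (refl , refl)) → linked a b eq ; (inj₂ (refl , refl)) → trans (colour-sym _ _) (linked a b eq) }
    L-unique : Unique (tabulate f)
    L-unique = Unique.tabulate⁺ inj
    short : Good u v → length (tabulate f) ≤ p
    short (inj₁ (i , al)) = aligned-path {i} (tabulate f) L-unique (tabulate-linked f λ s t e →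
      colour⇒aligned (trans (linked s t e) (trans (sym κ≡) (aligned⇒colour u≢v al))))
    short (inj₂ (ex , cen)) = column-path (tabulate f) L-unique (tabulate-linked f λ s t e →
      (λ fs≡ft → <⇒≢ (≤-reflexive (sym e)) (cong toℕ (inj fs≡ft))) , trans (linked s t e) (trans (sym κ≡) (column⇒colour u≢v ex))) u∈ cen

  good? : ∀ u v → Dec (Good u v)
  good? u v = direction? u v ⊎-dec ((X u ≟ X v) ×-dec central? (X u))

  Good-sym : ∀ {u v} → Good u v → Good v u
  Good-sym (inj₁ (i , a)) = inj₁ (i , Aligned-sym a)
  Good-sym (inj₂ (ex , cen)) = inj₂ (sym ex , subst Central ex cen)

  goodGraph columnGraph : SimpleGraph (Fin n)
  goodGraph = record
    { E = λ u v → u ≢ v × Good u v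
    ; E? = λ u v → ¬? (u ≟ v) ×-dec good? u v
    ; E-sym = λ (ne , g) → (ne ∘ sym) , Good-sym g
    ; E-irr = λ (ne , _) → ne refl
    }
  columnGraph = record
    { E = λ u v → u ≢ v × X u ≡ X v × Central (X u)
    ; E? = λ u v → ¬? (u ≟ v) ×-dec ((X u ≟ X v) ×-dec central? (X u))
    ; E-sym = λ (ne , ex , cen) → (ne ∘ sym) , sym ex , subst Central ex cen
    ; E-irr = λ (ne , _) → ne refl
    }

  alignedGraph : Fin p → SimpleGraph (Fin n)
  alignedGraph i = record
    { E = λ u v → u ≢ v × Aligned i u v
    ; E? = λ u v → ¬? (u ≟ v) ×-dec aligned? i u v
    ; E-sym = λ (ne , a) → (ne ∘ sym) , Aligned-sym a
    ; E-irr = λ (ne , _) → ne refl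
    }

  nimEdges : List (Fin n × Fin n)
  nimEdges = Edges.edges goodGraph (allFin n)

  nimEdges-NIM : NIMList colouring (suc p) nimEdges
  nimEdges-NIM = Edges.Unique-edges goodGraph (ascending-allFin n) , All.tabulate λ uv∈ →
    let _ , _ , lt , (ne , good) = Edges.∈-edges⁻ goodGraph (ascending-allFin n) uv∈ in lt , good⇒NIM ne good

  edges-of-colour : ∀ (G : SimpleGraph (Fin n)) κ → (∀ {u v} → SimpleGraph.E G u v → u ≢ v × Good u v × colour u v ≡ κ) →
    OnGraph.e _≟_ G (allFin n) ≤ count (λ uv → colour (proj₁ uv) (proj₂ uv) ≟ κ) nimEdges
  edges-of-colour G κ h = ≤-trans (≤-reflexive (sym (Edges.length-edges G (allFin n))))
    (unique-⊆-length (Edges.Unique-edges G (ascending-allFin n)) λ {uv} uv∈ →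
      let u∈ , v∈ , lt , ev = Edges.∈-edges⁻ G (ascending-allFin n) uv∈ ; ne , good , eq = h ev in
      ∈-filter⁺ (λ uv → colour (proj₁ uv) (proj₂ uv) ≟ κ) (Edges.∈-edges⁺ goodGraph (ascending-allFin n) u∈ v∈ lt (ne , good)) eq)

  length-nimEdges : OnGraph.e _≟_ columnGraph (allFin n) + Sum (λ i → OnGraph.e _≟_ (alignedGraph i) (allFin n)) (allFin p) ≤ length nimEdges
  length-nimEdges = ≤-trans (+-mono-≤
      (edges-of-colour columnGraph zero λ (ne , ex , cen) → ne , inj₂ (ex , cen) , column⇒colour ne ex)
      (Sum-mono (allFin p) λ {i} _ → edges-of-colour (alignedGraph i) (suc i) λ (ne , a) → ne , inj₁ (i , a) , aligned⇒colour ne a))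
    (≤-reflexive (trans (sym (Sum-allFin-suc (λ κ → count (λ uv → colour (proj₁ uv) (proj₂ uv) ≟ κ) nimEdges)))
      (Sum-fibres (λ uv → colour (proj₁ uv) (proj₂ uv)) nimEdges)))

  sj≤p : suc j ≤ p
  sj≤p = s≤s (≤-trans (m≤m+n j j) (≤-reflexive (sym q≡)))

  central : Fin j → Fin p
  central t = Fin.inject≤ (suc t) sj≤p

  toℕ-central : ∀ t → toℕ (central t) ≡ suc (toℕ t)
  toℕ-central t = toℕ-inject≤ (suc t) sj≤p

  Central-central : ∀ t → Central (central t)
  Central-central t = ≤-trans (s≤s z≤n) (≤-reflexive (sym (toℕ-central t))) , ≤-trans (≤-reflexive (toℕ-central t)) (toℕ<n t)

  central-injective : ∀ {s t} → central s ≡ central t → s ≡ t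
  central-injective {s} {t} eq = toℕ-injective (suc-injective (trans (sym (toℕ-central s)) (trans (cong toℕ eq) (toℕ-central t))))

  tri-p : tri p ≡ j * p
  tri-p = subst (λ q → tri (suc q) ≡ j * suc q) (sym q≡) (tri-edge j)

  -- Each of the j central columns is a clique on p vertices; together they supply the summand (k -
  -- 1) C(p, 2).
  column-edges : j * (j * p) ≤ OnGraph.e _≟_ columnGraph (allFin n)
  column-edges = begin
      j * (j * p) ≤⟨ *-monoˡ-≤ (j * p) many ⟩
      count central? (allFin p) * (j * p) ≡⟨ cong (_* (j * p)) (count-Sum central? (allFin p)) ⟩
      Sum (indicator ∘ central?) (allFin p) * (j * p) ≡⟨ Sum-*ʳ (indicator ∘ central?) (j * p) (allFin p) ⟨
      Sum (λ x → indicator (central? x) * (j * p)) (allFin p) ≤⟨ Sum-mono (allFin p) (λ {x} _ → column x) ⟩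
      Sum (λ x → e (filter (λ v → X v ≟ x) (allFin n))) (allFin p) ≤⟨ e-classes _≟_ columnGraph X (allFin n) ⟩
      e (allFin n) ∎
    where
    open ≤-Reasoning
    open OnGraph _≟_ columnGraph using (e; e-mono)
    many : j ≤ count central? (allFin p)
    many = ≤-trans (≤-reflexive (sym (length-tabulate central))) (unique-⊆-length (Unique.tabulate⁺ central-injective)
      λ {x} x∈ → case ∈-tabulate⁻ {f = central} x∈ of λ { (t , refl) → ∈-filter⁺ central? (∈-allFin (central t)) (Central-central t) })
    column : ∀ x → indicator (central? x) * (j * p) ≤ e (filter (λ v → X v ≟ x) (allFin n))
    column x with central? x
    ... | no _ = z≤n
    ... | yes cen = ≤-trans (≤-reflexive (trans (*-identityˡ (j * p)) (trans (sym tri-p) (cong tri (sym (length-tabulate (point x)))))))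
        (≤-trans (e-clique _≟_ columnGraph (tabulate (point x)) unique-points λ a∈ w∈ ne →
            ne , trans (on-column a∈) (sym (on-column w∈)) , subst Central (sym (on-column a∈)) cen)
          (e-mono unique-points λ {v} v∈ → ∈-filter⁺ (λ v → X v ≟ x) (∈-allFin v) (on-column v∈)))
      where
      unique-points : Unique (tabulate (point x))
      unique-points = Unique.tabulate⁺ λ {y} {y′} eq → trans (sym (Y-point x y)) (trans (cong Y eq) (Y-point x y′))
      on-column : ∀ {v} → v ∈ tabulate (point x) → X v ≡ x
      on-column v∈ with y , refl ← ∈-tabulate⁻ {f = point x} v∈ = X-point x y

  module _ (i : Fin p) where

    open OnGraph _≟_ (alignedGraph i) using (e; e-mono; e-↭)

    private
      D : ℕ
      D = tri (suc j)

    at : Fin p → Fin p → Fin n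
    at b x = point x (ordinate i b x)

    label-at : ∀ b x → label i (at b x) ≡ b
    label-at b x = trans (cong₂ (line i) (X-point x _) (Y-point x _)) (line-ordinate i b x)

    X-at : ∀ b x → X (at b x) ≡ x
    X-at b x = X-point x _

    class : Fin p → List (Fin n)
    class b = filter (λ v → label i v ≟ b) (allFin n)

    ∈-class⁺ : ∀ {b v} → label i v ≡ b → v ∈ class b
    ∈-class⁺ {b} {v} eq = ∈-filter⁺ (λ v → label i v ≟ b) (∈-allFin v) eq

    ∈-class⁻ : ∀ {b v} → v ∈ class b → label i v ≡ b
    ∈-class⁻ {b} v∈ = proj₂ (∈-filter⁻ (λ v → label i v ≟ b) {xs = allFin n} v∈)

    Unique-class : ∀ b → Unique (class b)
    Unique-class b = Unique.filter⁺ (λ v → label i v ≟ b) (Unique.allFin⁺ n)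

    -- A line off the origin is a clique on p vertices, which has exactly j edges per vertex, so
    -- nothing is lost.
    proper-class : ∀ {b} → b ≢ zero → length (class b) * j ≤ e (class b)
    proper-class {b} nz = begin
        length (class b) * j ≤⟨ *-monoˡ-≤ j (≤-trans (length-image X (allFin p) (Unique-class b) (λ {u} {v} u∈ v∈ ex →
            coordinates-injective ex (label-injective {i} ex (trans (∈-class⁻ u∈) (sym (∈-class⁻ v∈))))
              λ (x0 , y0) → nz (trans (sym (∈-class⁻ u∈)) (label-origin {i} x0 y0))) λ {v} _ → ∈-allFin (X v)) (≤-reflexive (length-allFin p))) ⟩
        p * j ≡⟨ trans (*-comm p j) (trans (sym tri-p) (cong tri (sym (length-tabulate (at b))))) ⟩
        tri (length (tabulate (at b))) ≤⟨ e-clique _≟_ (alignedGraph i) (tabulate (at b)) unique-points (λ a∈ w∈ ne →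
            ne , aligned (trans (on-line a∈) (sym (on-line w∈))) (inj₁ λ z → nz (trans (sym (on-line a∈)) z))) ⟩
        e (tabulate (at b)) ≤⟨ e-mono unique-points (∈-class⁺ ∘ on-line) ⟩
        e (class b) ∎
      where
      open ≤-Reasoning
      unique-points : Unique (tabulate (at b))
      unique-points = Unique.tabulate⁺ λ {x} {x′} eq → trans (sym (X-at b x)) (trans (cong X eq) (X-at b x′))
      on-line : ∀ {v} → v ∈ tabulate (at b) → label i v ≡ b
      on-line v∈ with x , refl ← ∈-tabulate⁻ {f = at b} v∈ = label-at b x

    hubs : List (Fin n)
    hubs = tabulate (at zero ∘ central)

    hub : ∀ {v} → v ∈ hubs → label i v ≡ zero × Central (X v)
    hub v∈ with t , refl ← ∈-tabulate⁻ {f = at zero ∘ central} v∈ = label-at zero (central t) , subst Central (sym (X-at zero (central t))) (Central-central t)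

    -- The join of the j hubs with the rest of the class falls short of j edges per vertex by D, the
    -- only loss in a direction.
    origin-class : length (class zero) * j ≤ e (class zero) + D
    origin-class with complement (Unique.tabulate⁺ {f = at zero ∘ central} λ {s} {t} eq → central-injective
        (trans (sym (X-at zero (central s))) (trans (cong X eq) (X-at zero (central t))))) (∈-class⁺ ∘ proj₁ ∘ hub)
    ... | R , pm = begin
        length (class zero) * j ≡⟨ cong (_* j) (trans (↭-length pm) (trans (length-++ hubs) (cong (_+ length R) lenA))) ⟩
        (j + length R) * j ≡⟨ trans (*-distribʳ-+ j j _) (cong₂ _+_ (sym (tri+tri-suc j)) (*-comm _ j)) ⟩
        tri j + D + j * length R ≡⟨ lemma (tri j) D (j * length R) ⟩
        tri j + j * length R + D ≡⟨ cong (λ a → tri a + a * length R + D) lenA ⟨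
        tri (length hubs) + length hubs * length R + D ≤⟨ +-monoˡ-≤ D (e-join _≟_ (alignedGraph i) hubs R (Unique-resp pm (Unique-class zero))
            λ a∈ w∈ ne → ne , aligned (trans (proj₁ (hub a∈)) (sym (∈-class⁻ (∈-resp-↭ (↭-sym pm) w∈)))) (inj₂ (inj₁ (proj₂ (hub a∈))))) ⟩
        e (hubs ++ R) + D ≡⟨ cong (_+ D) (e-↭ pm) ⟨
        e (class zero) + D ∎
      where
      open ≤-Reasoning
      lenA : length hubs ≡ j
      lenA = length-tabulate (at zero ∘ central)
      lemma : ∀ a b d → a + b + d ≡ a + d + b
      lemma = solve-∀

    aligned-edges : n * j ≤ e (allFin n) + D
    aligned-edges = begin
        n * j ≡⟨ cong (_* j) (trans (sym (length-allFin n)) (sym (Sum-fibres (label i) (allFin n)))) ⟩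
        Sum (λ b → length (class b)) (allFin p) * j ≡⟨ Sum-*ʳ (λ b → length (class b)) j (allFin p) ⟨
        Sum (λ b → length (class b) * j) (allFin p) ≤⟨ Sum-mono (allFin p) (λ {b} _ → bound b) ⟩
        Sum (λ b → e (class b) + indicator (zero ≟ b) * D) (allFin p) ≡⟨ Sum-+ (λ b → e (class b)) (λ b → indicator (zero ≟ b) * D) (allFin p) ⟩
        Sum (λ b → e (class b)) (allFin p) + Sum (λ b → indicator (zero ≟ b) * D) (allFin p)
          ≤⟨ +-mono-≤ (e-classes _≟_ (alignedGraph i) (label i) (allFin n)) (≤-reflexive (trans (Sum-*ʳ (λ b → indicator (zero ≟ b)) D (allFin p))
             (trans (cong (_* D) (trans (sym (count-Sum (zero ≟_) (allFin p))) (count-one {p} zero))) (*-identityˡ D)))) ⟩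
        e (allFin n) + D ∎
      where
      open ≤-Reasoning
      bound : ∀ b → length (class b) * j ≤ e (class b) + indicator (zero ≟ b) * D
      bound b with zero ≟ b
      ... | yes refl = ≤-trans origin-class (≤-reflexive (cong (e (class zero) +_) (sym (*-identityˡ D))))
      ... | no z≢b = ≤-trans (proper-class (z≢b ∘ sym)) (m≤m+n _ _)

  many-nimEdges : ∀ E → E + tri (suc j) ≤ j * n → p * E + j * (j * p) ≤ length nimEdges
  many-nimEdges E E≤ = ≤-trans (≤-trans (+-mono-≤ (cancel-≤ (p * tri (suc j)) refl refl (begin
      p * tri (suc j) + p * E ≡⟨ trans (+-comm _ (p * E)) (sym (*-distribˡ-+ p E _)) ⟩
      p * (E + tri (suc j)) ≤⟨ *-monoʳ-≤ p (≤-trans E≤ (≤-reflexive (*-comm j n))) ⟩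
      p * (n * j) ≡⟨ sym (trans (Sum-const (n * j) (allFin p)) (cong (_* (n * j)) (length-allFin p))) ⟩
      Sum (λ _ → n * j) (allFin p) ≤⟨ Sum-mono (allFin p) (λ {i} _ → aligned-edges i) ⟩
      Sum (λ i → OnGraph.e _≟_ (alignedGraph i) (allFin n) + tri (suc j)) (allFin p)
        ≡⟨ Sum-+ (λ i → OnGraph.e _≟_ (alignedGraph i) (allFin n)) (λ _ → tri (suc j)) (allFin p) ⟩
      Sum (λ i → OnGraph.e _≟_ (alignedGraph i) (allFin n)) (allFin p) + Sum (λ _ → tri (suc j)) (allFin p)
        ≡⟨ trans (+-comm (Sum (λ i → OnGraph.e _≟_ (alignedGraph i) (allFin n)) (allFin p)) _)
             (cong (_+ Sum (λ i → OnGraph.e _≟_ (alignedGraph i) (allFin n)) (allFin p)) (trans (Sum-const (tri (suc j)) (allFin p)) (cong (_* tri (suc j)) (length-allFin p)))) ⟩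
      p * tri (suc j) + Sum (λ i → OnGraph.e _≟_ (alignedGraph i) (allFin n)) (allFin p) ∎)) column-edges)
    (≤-reflexive (+-comm (Sum (λ i → OnGraph.e _≟_ (alignedGraph i) (allFin n)) (allFin p)) _))) length-nimEdges
    where open ≤-Reasoning

-- The Turán number and the final assembly

choose-2 : ∀ r → r C 2 ≡ tri r
choose-2 zero = refl
choose-2 (suc r) = trans (sym (nCk+nC[k+1]≡[n+1]C[k+1] r 1)) (cong₂ _+_ (nC1≡n r) (choose-2 r))

join-deficit : ∀ j n E → j ≤ n → (∀ (G : Graph n) → ¬ ContainsPath (suc (suc (j + j))) G → edgeCount G ≤ E) → j * n ≤ E + tri (suc j)
join-deficit j n E j≤n bound = ≤-trans join-edges (+-monoˡ-≤ (tri (suc j)) (bound joinGraph join-noPath))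
  where open Join j n j≤n

-- The residues j and j + 1 are the equality cases of `tri-deficit`: there the union of cliques has
-- exactly as many edges as the join, namely j n - D.
extremal-deficit : ∀ j n a (G : Graph n) → ¬ ContainsPath (suc (suc (j + j))) G →
  n ≡ a * suc (j + j) + j ⊎ n ≡ a * suc (j + j) + suc j → edgeCount G + tri (suc j) ≤ j * n
extremal-deficit j n a G none residue = go residue
  where
  open OnGraph _≟_ (graphOf G)
  open ≤-Reasoning
  p : ℕ
  p = suc (j + j)
  edges≤ : ∀ r → n ≡ a * p + r → r ≤ p → edgeCount G ≤ a * p * j + tri r
  edges≤ r eq r≤ = ≤-trans (≤-reflexive (edgeCount≡e G)) (faudree-schelp j n (allFin n) a r (≤-reflexive (length-allFin n))
    (trans (length-allFin n) eq) r≤ (Unique.allFin⁺ n) (noPath-of-graph G none))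
  lemma : ∀ x j s t → x * j + s + t ≡ j * x + (s + t)
  lemma = solve-∀
  go : n ≡ a * p + j ⊎ n ≡ a * p + suc j → edgeCount G + tri (suc j) ≤ j * n
  go (inj₁ eq) = begin
    edgeCount G + tri (suc j) ≤⟨ +-monoˡ-≤ (tri (suc j)) (edges≤ j eq (≤-trans (m≤m+n j j) (n≤1+n _))) ⟩
    a * p * j + tri j + tri (suc j) ≡⟨ lemma (a * p) j (tri j) (tri (suc j)) ⟩
    j * (a * p) + (tri j + tri (suc j)) ≡⟨ cong (j * (a * p) +_) (tri+tri-suc j) ⟩
    j * (a * p) + j * j ≡⟨ *-distribˡ-+ j (a * p) j ⟨
    j * (a * p + j) ≡⟨ cong (j *_) eq ⟨
    j * n ∎
  go (inj₂ eq) = begin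
    edgeCount G + tri (suc j) ≤⟨ +-monoˡ-≤ (tri (suc j)) (edges≤ (suc j) eq (s≤s (m≤m+n j j))) ⟩
    a * p * j + tri (suc j) + tri (suc j) ≡⟨ lemma (a * p) j (tri (suc j)) (tri (suc j)) ⟩
    j * (a * p) + (tri (suc j) + tri (suc j)) ≡⟨ cong (j * (a * p) +_) (trans (lemma₂ j (tri j)) (trans (cong (_+ j) (tri+tri-suc j)) (trans (+-comm (j * j) j) (sym (*-suc j j))))) ⟩
    j * (a * p) + j * suc j ≡⟨ *-distribˡ-+ j (a * p) (suc j) ⟨
    j * (a * p + suc j) ≡⟨ cong (j *_) eq ⟨
    j * n ∎
    where lemma₂ : ∀ j t → j + t + (j + t) ≡ t + (j + t) + j
          lemma₂ = solve-∀

affine-plane-colouring : ∀ j n m p → m ≡ suc p → p ≡ suc (j + j) → Prime p → p * p ≤ n → ∀ E → E + tri (suc j) ≤ j * n →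
  Σ (Colouring m n) λ c → NIMCount≥ c m (p * E + j * (p C 2))
affine-plane-colouring j n _ _ refl refl isPrime pp≤n E E≤ =
  -- `NIMCount≥` asks for a list of exactly b edges, so the longer list is cut.
  colouring , take b nimEdges , (Unique.take⁺ b (proj₁ nimEdges-NIM) , Allₚ.take⁺ b (proj₂ nimEdges-NIM)) ,
  trans (length-take b nimEdges) (m≤n⇒m⊓n≡m (≤-trans (≤-reflexive (cong (λ x → suc (j + j) * E + j * x) (trans (choose-2 (suc (j + j))) (tri-edge j)))) (many-nimEdges E E≤)))
  where
  open Construction j (j + j) n refl pp≤n isPrime
  b : ℕ
  b = suc (j + j) * E + j * (suc (j + j) C 2)

theorem1p5 : (k n : ℕ) → 1 ≤ k → (2 * k) ^ (2 * (k * k)) ≤ n →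
    (e : ℕ) → IsExPath n (2 * k) e →
    ((c : Colouring (2 * k) n) →
    NIMCount≤ c (2 * k) ((2 * k ∸ 1) * e + (k ∸ 1) * ((2 * k ∸ 1) C 2)))
    × (Prime (2 * k ∸ 1) →
    (a : ℕ) → (n ≡ a * (2 * k ∸ 1) + (k ∸ 1) ⊎ n ≡ a * (2 * k ∸ 1) + k) →
    Σ (Colouring (2 * k) n) λ c →
    NIMCount≥ c (2 * k) ((2 * k ∸ 1) * e + (k ∸ 1) * ((2 * k ∸ 1) C 2)))
theorem1p5 (suc j) n _ n-large e ((G , none , G-edges) , bound) = upper , lower
  where
  p : ℕ
  -- This is what 2 * suc j ∸ 1 unfolds to.
  p = j + suc (j + 0)
  m : ℕ
  m = suc p
  p≡ : p ≡ suc (j + j)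
  p≡ = trans (+-suc j (j + 0)) (cong (λ x → suc (j + x)) (+-identityʳ j))
  m^≤ : ∀ {x} → x ≤ 2 * (suc j * suc j) → m ^ x ≤ n
  m^≤ le = ≤-trans (^-monoʳ-≤ m le) n-large
  mm≤n : m * m ≤ n
  mm≤n = ≤-trans (≤-reflexive (cong (m *_) (sym (*-identityʳ m)))) (m^≤ {2} (*-monoʳ-≤ 2 (s≤s z≤n)))
  p≤m : p ≤ m
  p≤m = n≤1+n p
  upper : (c : Colouring m n) → NIMCount≤ c m (p * e + j * (p C 2))
  upper c es nim = ≤-trans (UpperBound.nim-bound j p m n p≡ refl c es nim (λ j>0 → m^≤ (exponent j>0)) e
      (join-deficit j n e (≤-trans (≤-trans (m≤m+n j _) p≤m) (≤-trans (m≤m*n m m) mm≤n)) λ G′ none′ → bound G′ (none′ ∘ subst (λ x → ContainsPath (suc x) G′) p≡)))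
    (≤-reflexive (cong (λ x → p * e + j * x) (sym (trans (choose-2 p) (subst (λ x → tri x ≡ j * x) (sym p≡) (tri-edge j))))))
    where
    -- The left side is 2j² + j + 5 and the right side 2j² + 4j + 2, which is why j must be
    -- positive.
    exponent : 0 < j → suc (p * j) + 4 ≤ 2 * (suc j * suc j)
    exponent j>0 = begin
        suc (p * j) + 4 ≡⟨ cong (λ x → suc (x * j) + 4) p≡ ⟩
        suc (suc (j + j) * j) + 4 ≡⟨ lemma₁ j ⟩
        2 + 2 * j * j + j + 3 * 1 ≤⟨ +-monoʳ-≤ (2 + 2 * j * j + j) (*-monoʳ-≤ 3 j>0) ⟩
        2 + 2 * j * j + j + 3 * j ≡⟨ lemma₂ j ⟩
        2 * (suc j * suc j) ∎
      where
      open ≤-Reasoning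
      lemma₁ : ∀ j → suc (suc (j + j) * j) + 4 ≡ 2 + 2 * j * j + j + 3 * 1
      lemma₁ = solve-∀
      lemma₂ : ∀ j → 2 + 2 * j * j + j + 3 * j ≡ 2 * (suc j * suc j)
      lemma₂ = solve-∀
  lower : Prime p → (a : ℕ) → (n ≡ a * p + j ⊎ n ≡ a * p + suc j) → Σ (Colouring m n) λ c → NIMCount≥ c m (p * e + j * (p C 2))
  lower isPrime a residue = affine-plane-colouring j n m p refl p≡ isPrime (≤-trans (*-mono-≤ p≤m p≤m) mm≤n) e
    (subst (λ x → x + tri (suc j) ≤ j * n) G-edges (extremal-deficit j n a G (none ∘ subst (λ x → ContainsPath (suc x) G) (sym p≡))
      (subst (λ x → n ≡ a * x + j ⊎ n ≡ a * x + suc j) p≡ residue)))
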